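{- Let $d\ge 1$ be a constant, let $r>0$ be a fixed distance threshold, and let $A,B$ be two sets of points in $\mathbb{R}^d$ with $|A|+|B|=n$. There is a data structure of $\widetilde{O}(n)$ size that can be built in $\widetilde{O}(n)$ time and updated in $\widetilde{O}(1)$ amortized time (per insertion or deletion of a point in $A$ or $B$), while supporting $\widetilde{O}(1)$-delay enumeration of the similarity join of $A$ and $B$ with threshold $r$ under the $\ell_1$ metric.
   Context: Similarity join: given $A,B\subset\mathbb{R}^d$, a metric $\phi$ and a threshold $r>0$, report all pairs $(a,b)\in A\times B$ with $\phi(a,b)\le r$ (each pair once). Here $\phi(a,b)=\|a-b\|_1$. The threshold $r$ is fixed and known when the data structure is built. $\delta$-delay enumeration: whenever an enumeration request is issued, the results for the current $A,B$ are reported one by one, and the time between the start of the enumeration and the first result, between any two consecutive results, and between the last result and the termination of the enumeration is at most $\delta$. The notation $\widetilde{O}(\cdot)$ hides a factor $\log^{O(1)} n$; here $d$ is constant and the exponent of the logarithm may depend (at most linearly) on $d$. -}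

module Defs where

open import Algebra.Structures using (IsCommutativeRing)
open import Data.Bool using (if_then_else_)
open import Data.Fin using (Fin)
open import Data.List as List using (List; []; _∷_; _++_; length)
open import Data.List.Relation.Unary.All using (All)
open import Data.Nat as ℕ using (ℕ; zero; suc)
open import Data.Nat.Logarithm using (⌈log₂_⌉)
open import Data.Product using (∃; ∃-syntax; _×_; _,_)
open import Data.Vec as Vec using (Vec; []; _∷_)
import Data.List.Membership.DecPropositional as DecMembership
import Data.Vec.Properties as Vecₚ
open import Function using (_∘_)
open import Relation.Binary using (DecidableEquality; IsDecTotalOrder)
open import Relation.Binary.PropositionalEquality using (_≡_; _≢_)
open import Relation.Nullary using (¬_; ¬?; does)

-- ℝ, characterised as the complete ordered field.  The order is decidable
-- because comparing two reals is a primitive step of a real RAM.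
record CompleteOrderedField : Set₁ where
  infix  8 -_
  infixl 7 _*_
  infixl 6 _+_ _-_
  infix  4 _≤_ _<_
  field
    Carrier           : Set
    _+_ _*_           : Carrier → Carrier → Carrier
    -_                : Carrier → Carrier
    0# 1#             : Carrier
    _≤_               : Carrier → Carrier → Set
    isCommutativeRing : IsCommutativeRing _≡_ _+_ _*_ -_ 0# 1#
    0≢1               : 0# ≢ 1#
    inverse           : ∀ x → x ≢ 0# → ∃[ y ] x * y ≡ 1#
    isDecTotalOrder   : IsDecTotalOrder _≡_ _≤_
    +-monoˡ-≤         : ∀ z {x y} → x ≤ y → x + z ≤ y + z
    *-nonNeg          : ∀ {x y} → 0# ≤ x → 0# ≤ y → 0# ≤ x * y

  UpperBound : (Carrier → Set) → Carrier → Set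
  UpperBound P u = ∀ x → P x → x ≤ u

  field
    supremum : (P : Carrier → Set) → ∃ P → ∃ (UpperBound P) →
               ∃[ s ] UpperBound P s × (∀ u → UpperBound P u → s ≤ u)

  open IsDecTotalOrder isDecTotalOrder public using (_≟_; _≤?_)

  _-_ : Carrier → Carrier → Carrier
  x - y = x + (- y)

  _<_ : Carrier → Carrier → Set
  x < y = x ≤ y × x ≢ y

  ∣_∣ : Carrier → Carrier
  ∣ x ∣ = if does (0# ≤? x) then x else - x

-- logᵏ n, shifted so that it is positive for every n, including n = 0.
polylog : ℕ → ℕ → ℕ
polylog k n = ⌈log₂ (2 ℕ.+ n) ⌉ ℕ.^ k

-- Programs of a unit-cost pointer machine over the reals: a first-order
-- language with mutually recursive functions on immutable binary cells.
-- Operands are variables (de Bruijn indices), so each construct costs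
-- O(1) steps on a real RAM.  `Γ` lists the arities of the functions.

data ArithOp : Set where
  add sub mul quo : ArithOp

data Exp (Γ : List ℕ) (n : ℕ) : Set where
  var     : Fin n → Exp Γ n
  nil     : Exp Γ n
  zeroᴿ   : Exp Γ n
  oneᴿ    : Exp Γ n
  cons    : Fin n → Fin n → Exp Γ n
  arith   : ArithOp → Fin n → Fin n → Exp Γ n
  -- if x ≤ y then _ else _
  ifLeq   : Fin n → Fin n → Exp Γ n → Exp Γ n → Exp Γ n
  -- Branches for nil, a real, and a cell; the last one binds the two
  -- components, the left one being variable 0.
  case    : Fin n → Exp Γ n → Exp Γ n → Exp Γ (2 ℕ.+ n) → Exp Γ n
  letIn   : Exp Γ n → Exp Γ (suc n) → Exp Γ n
  call    : (f : Fin (length Γ)) → Vec (Fin n) (List.lookup Γ f) → Exp Γ n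
  -- Report the value as the next result of an enumeration.
  emit    : Fin n → Exp Γ n

data Side : Set where
  inA inB : Side

data Kind : Set where
  insertion deletion : Kind

-- The procedures take, in this order:
--   build: the threshold, the list of A, the list of B;
--   update: the data structure, the point inserted or deleted;
--   enumerate: the data structure.
record DataStructure : Set where
  field
    arities   : List ℕ
    body      : (f : Fin (length arities)) → Exp arities (List.lookup arities f)
    build     : Exp arities 3
    update    : Kind → Side → Exp arities 2
    enumerate : Exp arities 1

module _ (ℝ : CompleteOrderedField) where
  open CompleteOrderedField ℝ

  data Value : Set where
    nil  : Value
    real : Carrier → Value
    cell : Value → Value → Value

  -- Sharing of cells is ignored, so this bounds the memory occupied
  -- from above.
  size : Value → ℕ
  size nil        = 1
  size (real _)   = 1
  size (cell v w) = suc (size v ℕ.+ size w)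

  -- A trace records elapsed time units and reported results in order.
  data Event : Set where
    tick : Event
    out  : Value → Event

  Trace : Set
  Trace = List Event

  time : Trace → ℕ
  time []          = 0
  time (tick  ∷ τ) = suc (time τ)
  time (out _ ∷ τ) = time τ

  outputs : Trace → List Value
  outputs []          = []
  outputs (tick  ∷ τ) = outputs τ
  outputs (out v ∷ τ) = v ∷ outputs τ

  -- The times from the start to the first result, between consecutive
  -- results, and from the last result to termination; `g` is the time
  -- already elapsed in the current gap.
  gapsFrom : ℕ → Trace → List ℕ
  gapsFrom g []          = g ∷ []
  gapsFrom g (tick  ∷ τ) = gapsFrom (suc g) τ
  gapsFrom g (out _ ∷ τ) = g ∷ gapsFrom 0 τ

  HasDelay : ℕ → Trace → Set
  HasDelay δ τ = All (ℕ._≤ δ) (gapsFrom 0 τ)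

  data Computes : ArithOp → Carrier → Carrier → Carrier → Set where
    add : ∀ {x y} → Computes add x y (x + y)
    sub : ∀ {x y} → Computes sub x y (x - y)
    mul : ∀ {x y} → Computes mul x y (x * y)
    quo : ∀ {x y z} → y ≢ 0# → z * y ≡ x → Computes quo x y z

  module _ (𝒟 : DataStructure) where
    open DataStructure 𝒟

    private variable
      n       : ℕ
      ρ       : Vec Value n
      i j     : Fin n
      x y z   : Carrier
      v w     : Value
      τ τ₁ τ₂ : Trace
      op      : ArithOp
      e₁ e₂   : Exp arities n
      e₃      : Exp arities (2 ℕ.+ n)
      e₄      : Exp arities (suc n)

    -- In environment ρ, the expression evaluates to v with trace τ.
    -- There is no rule for a run-time error such as division by zero.
    infix 3 _⊢_⇓_∣_
    data _⊢_⇓_∣_ {n} (ρ : Vec Value n) :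
                 Exp arities n → Value → Trace → Set where
      var   : ρ ⊢ var i ⇓ Vec.lookup ρ i ∣ tick ∷ []
      nil   : ρ ⊢ nil ⇓ nil ∣ tick ∷ []
      zeroᴿ : ρ ⊢ zeroᴿ ⇓ real 0# ∣ tick ∷ []
      oneᴿ  : ρ ⊢ oneᴿ ⇓ real 1# ∣ tick ∷ []
      cons  : ρ ⊢ cons i j ⇓ cell (Vec.lookup ρ i) (Vec.lookup ρ j) ∣ tick ∷ []
      arith : Vec.lookup ρ i ≡ real x → Vec.lookup ρ j ≡ real y →
              Computes op x y z →
              ρ ⊢ arith op i j ⇓ real z ∣ tick ∷ []
      ifLeq-then : Vec.lookup ρ i ≡ real x → Vec.lookup ρ j ≡ real y →
                   x ≤ y → ρ ⊢ e₁ ⇓ v ∣ τ →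
                   ρ ⊢ ifLeq i j e₁ e₂ ⇓ v ∣ tick ∷ τ
      ifLeq-else : Vec.lookup ρ i ≡ real x → Vec.lookup ρ j ≡ real y →
                   ¬ (x ≤ y) → ρ ⊢ e₂ ⇓ v ∣ τ →
                   ρ ⊢ ifLeq i j e₁ e₂ ⇓ v ∣ tick ∷ τ
      case-nil  : Vec.lookup ρ i ≡ nil → ρ ⊢ e₁ ⇓ v ∣ τ →
                  ρ ⊢ case i e₁ e₂ e₃ ⇓ v ∣ tick ∷ τ
      case-real : Vec.lookup ρ i ≡ real x → ρ ⊢ e₂ ⇓ v ∣ τ →
                  ρ ⊢ case i e₁ e₂ e₃ ⇓ v ∣ tick ∷ τ
      case-cell : ∀ {h t} → Vec.lookup ρ i ≡ cell h t →
                  h ∷ t ∷ ρ ⊢ e₃ ⇓ v ∣ τ →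
                  ρ ⊢ case i e₁ e₂ e₃ ⇓ v ∣ tick ∷ τ
      letIn : ρ ⊢ e₁ ⇓ w ∣ τ₁ → w ∷ ρ ⊢ e₄ ⇓ v ∣ τ₂ →
              ρ ⊢ letIn e₁ e₄ ⇓ v ∣ tick ∷ τ₁ ++ τ₂
      call  : ∀ {f is} → Vec.map (Vec.lookup ρ) is ⊢ body f ⇓ v ∣ τ →
              ρ ⊢ call f is ⇓ v ∣ tick ∷ τ
      emit  : ρ ⊢ emit i ⇓ nil ∣ tick ∷ out (Vec.lookup ρ i) ∷ []

  encodeList : List Value → Value
  encodeList = List.foldr cell nil

  module _ (d : ℕ) where

    Point : Set
    Point = Vec Carrier d

    _≟ₚ_ : DecidableEquality Point
    _≟ₚ_ = Vecₚ.≡-dec _≟_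

    open DecMembership _≟ₚ_ using (_∈?_)

    ‖_‖₁ : Point → Carrier
    ‖ p ‖₁ = Vec.foldr′ (λ x s → ∣ x ∣ + s) 0# p

    dist : Point → Point → Carrier
    dist a b = ‖ Vec.zipWith _-_ a b ‖₁

    -- For duplicate-free A and B every pair of the join is listed once.
    similarityJoin : Carrier → List Point → List Point → List (Point × Point)
    similarityJoin r A B =
      List.filter (λ (a , b) → dist a b ≤? r) (List.cartesianProduct A B)

    -- The current sets A and B, listed without duplicates.
    State : Set
    State = List Point × List Point

    cardinality : State → ℕ
    cardinality (A , B) = length A ℕ.+ length B

    record Update : Set where
      constructor mkUpdate
      field
        kind  : Kind
        side  : Side
        point : Point

    applyToSet : Kind → Point → List Point → List Point
    applyToSet insertion p X = if does (p ∈? X) then X else p ∷ X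
    applyToSet deletion  p X = List.filter (¬? ∘ (p ≟ₚ_)) X

    apply : State → Update → State
    apply (A , B) (mkUpdate k inA p) = applyToSet k p A , B
    apply (A , B) (mkUpdate k inB p) = A , applyToSet k p B

    applyAll : State → List Update → State
    applyAll = List.foldl apply

    -- The value of |A| + |B| right after each of the updates.
    cardinalities : State → List Update → List ℕ
    cardinalities S []       = []
    cardinalities S (u ∷ us) = cardinality (apply S u) ∷ cardinalities (apply S u) us

    encodePoint : Point → Value
    encodePoint p = encodeList (List.map real (Vec.toList p))

    encodePoints : List Point → Value
    encodePoints ps = encodeList (List.map encodePoint ps)

    encodePair : Point × Point → Value
    encodePair (a , b) = cell (encodePoint a) (encodePoint b)

    module _ (𝒟 : DataStructure) where
      open DataStructure 𝒟

      Builds : Carrier → State → Value → Trace → Set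
      Builds r (A , B) D τ =
        _⊢_⇓_∣_ 𝒟 (real r ∷ encodePoints A ∷ encodePoints B ∷ []) build D τ

      -- Updates D us D′ t: performing us one after the other turns D
      -- into D′ in total time t.
      data Updates : Value → List Update → Value → ℕ → Set where
        []  : ∀ {D} → Updates D [] D 0
        _∷_ : ∀ {D D′ D″ τ t k s p us} →
              _⊢_⇓_∣_ 𝒟 (D ∷ encodePoint p ∷ []) (update k s) D′ τ →
              Updates D′ us D″ t →
              Updates D (mkUpdate k s p ∷ us) D″ (time τ ℕ.+ t)

      Enumerates : Value → Trace → Set
      Enumerates D τ = ∃[ v ] _⊢_⇓_∣_ 𝒟 (D ∷ []) enumerate v τ

{-# OPTIONS --safe #-}

-- A multi-level range tree without orthants.  A balanced search tree on the
-- first coordinate separates every pair (a, b) at exactly one node, where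
-- ∣ a₁ - b₁ ∣ is b₁ - a₁ or a₁ - b₁ depending on the side of a.  The node
-- stores two secondary structures for the remaining coordinates, one for A on
-- the left and B on the right and one for the converse, in which every point
-- carries the signed sum of its processed coordinates.  Each element of the
-- node belongs to just one of the two.  At the last level ‖ a - b ‖₁ ≤ r has
-- become a bound on the sum of a number of a and a number of b, and subtree
-- minima show which subtrees take part in the join; at the other levels a flag
-- does so, hence every subtree that is visited yields a result.
--
-- A subtree of n elements is rebuilt from scratch when ⌊n/8⌋ updates have
-- passed through its root since it was built.  Its potential is the number of
-- these updates times the price of rebuilding per element; it vanishes for
-- freshly built structures.
module Submission where

open import Defs
open import Data.List using (List; map; sum)
open import Data.List.Relation.Binary.Permutation.Propositional using (_↭_)
open import Data.List.Relation.Unary.Unique.Propositional using (Unique)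
open import Data.Nat using (ℕ; suc; _*_; _≤_)
open import Data.Product using (Σ; ∃-syntax; _×_; _,_; uncurry)

open import Algebra.Bundles using (CommutativeRing)
import Algebra.Properties.Ring as RingProperties
import Algebra.Solver.CommutativeMonoid as CommutativeMonoidSolver
open import Data.Bool using (Bool; true; false; T; _∨_; if_then_else_)
open import Data.Bool.Properties using (∨-assoc; ∨-conicalˡ; ∨-conicalʳ; ∨-identityʳ)
open import Data.Empty using (⊥-elim)
open import Data.Fin as Fin using (Fin)
open import Data.Fin.Patterns
open import Data.List as List using ([]; _∷_; _++_; length)
import Data.List.Membership.DecPropositional as DecMembership
open import Data.List.Membership.Propositional using (_∈_; find; lose)
open import Data.List.Membership.Propositional.Properties
open import Data.List.Membership.Propositional.Properties.WithK using (unique∧set⇒bag)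
open import Data.List.Properties as Listₚ
  using (++-assoc; ++-identityʳ; length-++; length-map; map-++; ∷-injective)
open import Data.List.Relation.Binary.BagAndSetEquality using (∼bag⇒↭)
open import Data.List.Relation.Binary.Permutation.Propositional using (↭-trans; ↭-reflexive)
import Data.List.Relation.Binary.Permutation.Propositional.Properties as ↭ₚ
open import Data.List.Relation.Unary.All as All using (All; []; _∷_)
open import Data.List.Relation.Unary.AllPairs as AllPairs using (AllPairs; []; _∷_)
import Data.List.Relation.Unary.AllPairs.Properties as AllPairsₚ
open import Data.List.Relation.Unary.Any as Any using (here; there)
import Data.List.Relation.Unary.Unique.Propositional.Properties as Uniqueₚ
open import Data.Maybe using (Maybe; just; nothing)
open import Data.Nat
open import Data.Nat.Induction using (<-rec)
open import Data.Nat.Logarithm using (⌈log₂_⌉; ⌈log₂⌉-mono-≤; ⌈log₂⌈n/2⌉⌉≡⌈log₂n⌉∸1)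
open import Data.Nat.Properties
import Data.Nat.Tactic.RingSolver as Ring
open import Data.Product using (Σ-syntax; proj₁; proj₂)
open import Data.Sum as Sum using (_⊎_; inj₁; inj₂; [_,_]′)
open import Data.Unit using (⊤; tt)
open import Data.Vec as Vec using (Vec; []; _∷_; lookup)
open import Data.Vec.Properties as Vecₚ using (length-toList; toList-injective)
open import Function using (_∘_; _⇔_; mk⇔; Equivalence; case_of_)
open import Function.Properties.Equivalence using () renaming (sym to ⇔-sym; trans to ⇔-trans)
open import Relation.Binary using (DecidableEquality; IsDecTotalOrder)
open import Relation.Binary.PropositionalEquality hiding ([_])
open import Relation.Nullary using (¬_; ¬?; Dec; yes; no; does)
open Equivalence using (to; from)

-- A `Run` couples a derivation of the big-step semantics with a time bound, so correctness and
-- running time come from one induction. The program is the same for every dimension: it reads the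
-- level off the remaining coordinates of an item or off the form of a stored sum. The obstacle in
-- the enumeration is that delays do not add up: when two parts are concatenated, it matters whether
-- each of them reports anything. `Paced` records this, and a silent part costs a constant because
-- it is an unflagged subtree below a flagged one. The fraction 1/8 ensures that a child has at its
-- birth at most 3/4 of the elements that its parent had at birth; three levels halve this number,
-- so heights are about three logarithms. An update changes one secondary structure per node of its
-- path. Its price thus gains a logarithm per level for the path, next to the price of rebuilding;
-- the crude exponent for the `d + 1` levels is `2 * (d + 1)`, at most `4 * d`, whence the constant
-- 4 of the theorem. The delay stays logarithmic, since on the way to a result the enumeration
-- passes to each further level only once.

-- Arithmetic of the cost bounds

-- Inequalities between polynomials with natural coefficients, certified by
-- comparing the coefficients of the two normal forms.
module Poly where

  infixl 6 _:+_
  infixl 7 _:*_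

  data Poly (n : ℕ) : Set where
    con       : ℕ → Poly n
    var       : Fin n → Poly n
    _:+_ _:*_ : Poly n → Poly n → Poly n

  ⟦_⟧ : ∀ {n} → Poly n → Vec ℕ n → ℕ
  ⟦ con c ⟧ ρ  = c
  ⟦ var i ⟧ ρ  = Vec.lookup ρ i
  ⟦ p :+ q ⟧ ρ = ⟦ p ⟧ ρ + ⟦ q ⟧ ρ
  ⟦ p :* q ⟧ ρ = ⟦ p ⟧ ρ * ⟦ q ⟧ ρ

  module _ {n : ℕ} where

    Monomial = List (Fin n)
    Normal   = List (ℕ × Monomial)

    insertVar : Fin n → Monomial → Monomial
    insertVar i []       = i ∷ []
    insertVar i (j ∷ js) with Fin.toℕ i ≤ᵇ Fin.toℕ j
    ... | true  = i ∷ j ∷ js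
    ... | false = j ∷ insertVar i js

    mulMonomial : Monomial → Monomial → Monomial
    mulMonomial is js = List.foldr insertVar js is

    _≟ᴹ_ : DecidableEquality Monomial
    _≟ᴹ_ = Listₚ.≡-dec Fin._≟_

    insertTerm : ℕ → Monomial → Normal → Normal
    insertTerm c m []              = (c , m) ∷ []
    insertTerm c m ((c′ , m′) ∷ p) with m ≟ᴹ m′
    ... | yes _ = (c + c′ , m′) ∷ p
    ... | no  _ = (c′ , m′) ∷ insertTerm c m p

    addN : Normal → Normal → Normal
    addN []            q = q
    addN ((c , m) ∷ p) q = insertTerm c m (addN p q)

    mulTerm : ℕ → Monomial → Normal → Normal
    mulTerm c m []              = []
    mulTerm c m ((c′ , m′) ∷ p) = (c * c′ , mulMonomial m m′) ∷ mulTerm c m p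

    mulN : Normal → Normal → Normal
    mulN []            q = []
    mulN ((c , m) ∷ p) q = addN (mulTerm c m q) (mulN p q)

    normal : Poly n → Normal
    normal (con c)  = (c , []) ∷ []
    normal (var i)  = (1 , i ∷ []) ∷ []
    normal (p :+ q) = addN (normal p) (normal q)
    normal (p :* q) = mulN (normal p) (normal q)

    covers : ℕ → Monomial → Normal → Bool
    covers zero    m p               = true
    covers (suc _) m []              = false
    covers c@(suc _) m ((c′ , m′) ∷ p) with m ≟ᴹ m′
    ... | yes _ = c ≤ᵇ c′
    ... | no  _ = covers c m p

    remove : ℕ → Monomial → Normal → Normal
    remove c m []              = []
    remove c m ((c′ , m′) ∷ p) with m ≟ᴹ m′
    ... | yes _ = (c′ ∸ c , m′) ∷ p
    ... | no  _ = (c′ , m′) ∷ remove c m p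

    -- Greedy: each term on the left is subtracted from a term with the same monomial on the right.
    -- Comparing coefficients suffices because the variables range over natural numbers.
    below : Normal → Normal → Bool
    below []            q = true
    below ((c , m) ∷ p) q with covers c m q
    ... | true  = below p (remove c m q)
    ... | false = false

    module _ (ρ : Vec ℕ n) where

      evM : Monomial → ℕ
      evM []       = 1
      evM (i ∷ is) = Vec.lookup ρ i * evM is

      evN : Normal → ℕ
      evN []            = 0
      evN ((c , m) ∷ p) = c * evM m + evN p

      evM-insert : ∀ i m → evM (insertVar i m) ≡ Vec.lookup ρ i * evM m
      evM-insert i []       = refl
      evM-insert i (j ∷ js) with Fin.toℕ i ≤ᵇ Fin.toℕ j
      ... | true  = refl
      ... | false rewrite evM-insert i js = swap (Vec.lookup ρ i) (Vec.lookup ρ j) (evM js)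
        where
        swap : ∀ x y z → y * (x * z) ≡ x * (y * z)
        swap = Ring.solve-∀

      evM-mul : ∀ m m′ → evM (mulMonomial m m′) ≡ evM m * evM m′
      evM-mul []      m′ = sym (+-identityʳ _)
      evM-mul (i ∷ m) m′ = begin
        evM (insertVar i (mulMonomial m m′))    ≡⟨ evM-insert i (mulMonomial m m′) ⟩
        Vec.lookup ρ i * evM (mulMonomial m m′) ≡⟨ cong (Vec.lookup ρ i *_) (evM-mul m m′) ⟩
        Vec.lookup ρ i * (evM m * evM m′)       ≡⟨ *-assoc (Vec.lookup ρ i) _ _ ⟨
        Vec.lookup ρ i * evM m * evM m′         ∎
        where open ≡-Reasoning

      evN-insert : ∀ c m p → evN (insertTerm c m p) ≡ c * evM m + evN p
      evN-insert c m []              = refl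
      evN-insert c m ((c′ , m′) ∷ p) with m ≟ᴹ m′
      ... | yes refl = lemma c c′ (evM m) (evN p)
        where
        lemma : ∀ c c′ x y → (c + c′) * x + y ≡ c * x + (c′ * x + y)
        lemma = Ring.solve-∀
      ... | no _ rewrite evN-insert c m p = lemma (c * evM m) (c′ * evM m′) (evN p)
        where
        lemma : ∀ x y z → y + (x + z) ≡ x + (y + z)
        lemma = Ring.solve-∀

      evN-add : ∀ p q → evN (addN p q) ≡ evN p + evN q
      evN-add []            q = refl
      evN-add ((c , m) ∷ p) q rewrite evN-insert c m (addN p q) | evN-add p q =
        sym (+-assoc (c * evM m) _ _)

      evN-mulTerm : ∀ c m p → evN (mulTerm c m p) ≡ c * evM m * evN p
      evN-mulTerm c m []              = sym (*-zeroʳ (c * evM m))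
      evN-mulTerm c m ((c′ , m′) ∷ p) rewrite evM-mul m m′ | evN-mulTerm c m p =
        lemma c c′ (evM m) (evM m′) (evN p)
        where
        lemma : ∀ c c′ x y z → c * c′ * (x * y) + c * x * z ≡ c * x * (c′ * y + z)
        lemma = Ring.solve-∀

      evN-mul : ∀ p q → evN (mulN p q) ≡ evN p * evN q
      evN-mul []            q = refl
      evN-mul ((c , m) ∷ p) q
        rewrite evN-add (mulTerm c m q) (mulN p q) | evN-mulTerm c m q | evN-mul p q =
        sym (*-distribʳ-+ (evN q) (c * evM m) (evN p))

      evN-normal : ∀ p → evN (normal p) ≡ ⟦ p ⟧ ρ
      evN-normal (con c)  = trans (+-identityʳ (c * 1)) (*-identityʳ c)
      evN-normal (var i)  = lemma (Vec.lookup ρ i)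
        where
        lemma : ∀ x → 1 * (x * 1) + 0 ≡ x
        lemma = Ring.solve-∀
      evN-normal (p :+ q) rewrite evN-add (normal p) (normal q) =
        cong₂ _+_ (evN-normal p) (evN-normal q)
      evN-normal (p :* q) rewrite evN-mul (normal p) (normal q) =
        cong₂ _*_ (evN-normal p) (evN-normal q)

      covers-sound : ∀ c m p → T (covers c m p) → c * evM m + evN (remove c m p) ≤ evN p
      covers-sound zero    m []              _ = z≤n
      covers-sound zero    m ((c′ , m′) ∷ p) _ with m ≟ᴹ m′
      ... | yes _ = ≤-refl
      ... | no  _ = +-monoʳ-≤ (c′ * evM m′) (covers-sound zero m p tt)
      covers-sound (suc c) m ((c′ , m′) ∷ p) h with m ≟ᴹ m′
      ... | yes refl = ≤-reflexive (begin
        suc c * evM m + ((c′ ∸ suc c) * evM m + evN p) ≡⟨ lemma (suc c) (c′ ∸ suc c) (evM m) (evN p) ⟩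
        (c′ ∸ suc c + suc c) * evM m + evN p           ≡⟨ cong (λ k → k * evM m + evN p) (m∸n+n≡m (≤ᵇ⇒≤ (suc c) c′ h)) ⟩
        c′ * evM m + evN p                             ∎)
        where
        open ≡-Reasoning
        lemma : ∀ c k x y → c * x + (k * x + y) ≡ (k + c) * x + y
        lemma = Ring.solve-∀
      ... | no _ = begin
        suc c * evM m + (c′ * evM m′ + evN (remove (suc c) m p)) ≡⟨ lemma (suc c * evM m) (c′ * evM m′) _ ⟩
        c′ * evM m′ + (suc c * evM m + evN (remove (suc c) m p)) ≤⟨ +-monoʳ-≤ (c′ * evM m′) (covers-sound (suc c) m p h) ⟩
        c′ * evM m′ + evN p                                      ∎
        where
        open ≤-Reasoning
        lemma : ∀ x y z → x + (y + z) ≡ y + (x + z)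
        lemma = Ring.solve-∀

      below-sound : ∀ p q → T (below p q) → evN p ≤ evN q
      below-sound []            q h = z≤n
      below-sound ((c , m) ∷ p) q h with covers c m q in eq
      ... | true = ≤-trans (+-monoʳ-≤ (c * evM m) (below-sound p (remove c m q) h))
                           (covers-sound c m q (subst T (sym eq) tt))

  infix 4 _:≤_
  _:≤_ : ∀ {n} → Poly n → Poly n → Poly n × Poly n
  p :≤ q = p , q

  Curried : ℕ → Set → Set → Set
  Curried zero    A B = B
  Curried (suc n) A B = A → Curried n A B

  applyⁿ : ∀ {n} {A B : Set} → Curried n A B → Vec A n → B
  applyⁿ f []       = f
  applyⁿ f (x ∷ xs) = applyⁿ (f x) xs

  Inequality : ℕ → Set
  Inequality n = Curried n (Poly n) (Poly n × Poly n)

  holds : ∀ {n} → Inequality n → Bool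
  holds {n} f = let p , q = applyⁿ {B = Poly n × Poly n} f (Vec.tabulate var) in below (normal p) (normal q)

  -- `poly n (λ x … → p :≤ q) (a ∷ … ∷ [])` proves p[a…] ≤ q[a…].
  poly : ∀ n (f : Inequality n) (ρ : Vec ℕ n) {_ : T (holds f)} →
         let p , q = applyⁿ {B = Poly n × Poly n} f (Vec.tabulate var) in ⟦ p ⟧ ρ ≤ ⟦ q ⟧ ρ
  poly n f ρ {h} = let p , q = applyⁿ {B = Poly n × Poly n} f (Vec.tabulate var) in
    subst₂ _≤_ (evN-normal ρ p) (evN-normal ρ q) (below-sound ρ (normal p) (normal q) h)

open Poly using (poly; con; _:+_; _:*_; _:≤_)

-- The interface between hypotheses and `poly`: a weighted sum of the hypotheses is passed as
-- `l ≤ r`, and what remains is an inequality that holds coefficient by coefficient.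
cancel : ∀ {a b l r} → l ≤ r → a + r ≤ b + l → a ≤ b
cancel {a} {b} {l} {r} h k =
  +-cancelʳ-≤ r a b (≤-trans k (+-monoʳ-≤ b h))

-- The program

module Program where

  pattern 10F = Fin.suc 9F
  pattern 11F = Fin.suc 10F
  pattern 12F = Fin.suc 11F
  pattern 13F = Fin.suc 12F
  pattern 14F = Fin.suc 13F
  pattern 15F = Fin.suc 14F
  pattern 16F = Fin.suc 15F
  pattern 17F = Fin.suc 16F
  pattern 18F = Fin.suc 17F
  pattern 19F = Fin.suc 18F
  pattern 20F = Fin.suc 19F
  pattern 21F = Fin.suc 20F
  pattern 22F = Fin.suc 21F
  pattern 23F = Fin.suc 22F
  pattern 24F = Fin.suc 23F
  pattern 25F = Fin.suc 24F
  pattern 26F = Fin.suc 25F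
  pattern 27F = Fin.suc 26F
  pattern 28F = Fin.suc 27F
  pattern 29F = Fin.suc 28F
  pattern 30F = Fin.suc 29F

  arities : List ℕ
  arities = 2 ∷ 1 ∷ 2 ∷ 2 ∷ 2 ∷ 2 ∷ 1 ∷ 2 ∷ 2 ∷ 2 ∷ 3 ∷ 2 ∷ 1 ∷ 1 ∷ 2 ∷ 2 ∷
    2 ∷ 1 ∷ 2 ∷ 4 ∷ 5 ∷ 4 ∷ 3 ∷ 7 ∷ 7 ∷ 3 ∷ 1 ∷ 2 ∷ 4 ∷ 3 ∷ 4 ∷ []

  pattern cmpᶠ = 0F
  pattern keyᶠ = 1F
  pattern cmpItemᶠ = 2F
  pattern mergeᶠ = 3F
  pattern removeᶠ = 4F
  pattern halfᶠ = 5F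
  pattern sortᶠ = 6F
  pattern flatᶠ = 7F
  pattern advanceᶠ = 8F
  pattern targetᶠ = 9F
  pattern splitᶠ = 10F
  pattern secondariesᶠ = 11F
  pattern balanceᶠ = 12F
  pattern buildᶠ = 13F
  pattern minimumᶠ = 14F
  pattern optMinᶠ = 15F
  pattern testᶠ = 16F
  pattern flagᶠ = 17F
  pattern orᶠ = 18F
  pattern summaryᶠ = 19F
  pattern nodeᶠ = 20F
  pattern pushᶠ = 21F
  pattern rebuildᶠ = 22F
  pattern leftᶠ = 23F
  pattern rightᶠ = 24F
  pattern updᶠ = 25F
  pattern enumᶠ = 26F
  pattern visitᶠ = 27F
  pattern travᶠ = 28F
  pattern mkItemᶠ = 29F
  pattern mkItemsᶠ = 30F

  -- A point is stored as an item, with its remaining coordinates, the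
  -- contribution of the processed coordinates to the distance, its side
  -- (0 for A, 1 for B) and all its coordinates:
  --   item = cell rem (cell acc (cell side coords)).
  -- The trees of the data structure are
  --   nil | cell nil item
  --     | cell (cell splitter fuel) (cell sum (cell (cell L R) (cell X Y))),
  -- where X joins A in L with B in R, and Y joins A in R with B in L.

  -- The last branch binds X Y L R (cell L R) (cell X Y) sum _ splitter fuel _ _.
  caseTree : ∀ {n} → Fin n → Exp arities n → Exp arities (2 + n) →
             Exp arities (12 + n) → Exp arities n
  caseTree i e₁ e₂ e₃ = case i e₁ nil (case 0F e₂ nil (case 3F nil nil
    (case 1F nil nil (case 0F nil nil (case 3F nil nil e₃)))))

  -- Left and right, deletion and insertion, false and true are nil and 0; a
  -- comparison yields nil for =, 0 for < and a cell for >.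
  functions : (f : Fin (length arities)) → Exp arities (List.lookup arities f)
  functions cmpᶠ = case 0F nil nil (case 3F nil nil
    (ifLeq 2F 0F (ifLeq 0F 2F (call cmpᶠ (3F ∷ 1F ∷ [])) zeroᴿ) (letIn nil (cons 0F 0F))))
  functions keyᶠ = case 0F nil nil (case 1F nil nil (case 2F (var 1F) nil (cons 0F 3F)))
  functions cmpItemᶠ = letIn (call keyᶠ (0F ∷ [])) (letIn (call keyᶠ (2F ∷ [])) (call cmpᶠ (1F ∷ 0F ∷ [])))
  functions mergeᶠ = case 0F (var 1F) nil (case 3F (var 2F) nil
    (letIn (call cmpItemᶠ (2F ∷ 0F ∷ [])) (case 0F
      (call mergeᶠ (4F ∷ 6F ∷ []))
      (letIn (call mergeᶠ (4F ∷ 6F ∷ [])) (cons 4F 0F))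
      (letIn (call mergeᶠ (7F ∷ 4F ∷ [])) (cons 4F 0F)))))
  functions removeᶠ = case 1F nil nil (letIn (call removeᶠ (2F ∷ 1F ∷ []))
    (letIn (call cmpItemᶠ (3F ∷ 1F ∷ [])) (case 0F (var 1F) (cons 2F 1F) (cons 4F 3F))))
  functions halfᶠ = case 1F (letIn nil (cons 0F 1F)) nil (case 1F (letIn nil (cons 0F 3F)) nil
    (case 4F nil nil (letIn (call halfᶠ (1F ∷ 3F ∷ []))
      (case 0F nil nil (letIn (cons 3F 0F) (cons 0F 2F))))))
  functions sortᶠ = case 0F nil nil (case 1F (var 2F) nil
    (letIn (call halfᶠ (4F ∷ 4F ∷ [])) (case 0F nil nil
      (letIn (call sortᶠ (0F ∷ [])) (letIn (call sortᶠ (2F ∷ [])) (call mergeᶠ (1F ∷ 0F ∷ [])))))))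
  functions flatᶠ = caseTree 0F (var 1F) (cons 1F 3F)
    (letIn (call flatᶠ (3F ∷ 13F ∷ [])) (call flatᶠ (3F ∷ 0F ∷ [])))
  functions advanceᶠ = case 1F nil nil (case 0F nil nil (case 3F nil nil
    (letIn (case 6F (arith sub 0F 2F) (arith add 0F 2F) nil)
      (letIn (cons 0F 2F) (cons 5F 0F)))))
  functions targetᶠ = case 1F nil nil (case 1F nil nil (case 1F nil nil (case 6F
    (letIn zeroᴿ (ifLeq 1F 0F nil zeroᴿ)) (letIn zeroᴿ (ifLeq 1F 0F zeroᴿ nil)) nil)))
  functions splitᶠ = case 1F (var 2F) nil (letIn (call splitᶠ (2F ∷ 1F ∷ 4F ∷ []))
    (letIn (call advanceᶠ (3F ∷ 1F ∷ [])) (letIn (call targetᶠ (4F ∷ 2F ∷ []))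
      (case 2F nil nil (case 2F
        (letIn (cons 3F 0F) (cons 0F 2F)) (letIn (cons 3F 1F) (cons 1F 0F)) nil)))))
  -- The first item of the second list tells the level: without remaining coordinates there is
  -- nothing to join further and both secondary structures are nil.
  functions secondariesᶠ = case 1F nil nil (case 0F nil nil (case 0F (letIn nil (cons 0F 0F)) nil
    (letIn nil (letIn (cons 0F 0F) (letIn zeroᴿ
      (letIn (call splitᶠ (0F ∷ 10F ∷ 1F ∷ [])) (letIn (call splitᶠ (3F ∷ 10F ∷ 0F ∷ []))
        (case 0F nil nil (letIn (call buildᶠ (0F ∷ [])) (letIn (call buildᶠ (2F ∷ []))
          (cons 1F 0F)))))))))))
  -- Three halvings leave a prefix of length ⌊n/8⌋. This is the fuel, a list that serves as a unary
  -- counter of the updates until the next rebuilding.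
  functions balanceᶠ = case 0F nil nil (case 1F (letIn nil (cons 0F 1F)) nil
    (letIn (call halfᶠ (4F ∷ 4F ∷ [])) (case 0F nil nil
    (letIn (call halfᶠ (0F ∷ 0F ∷ [])) (case 0F nil nil
    (letIn (call halfᶠ (0F ∷ 0F ∷ [])) (case 0F nil nil
    (letIn (call balanceᶠ (6F ∷ [])) (letIn (call balanceᶠ (8F ∷ []))
    (letIn (call secondariesᶠ (8F ∷ 9F ∷ [])) (case 10F nil nil
    (call nodeᶠ (0F ∷ 5F ∷ 4F ∷ 3F ∷ 2F ∷ [])))))))))))))
  functions buildᶠ = letIn (call sortᶠ (0F ∷ [])) (call balanceᶠ (0F ∷ []))
  functions minimumᶠ = caseTree 1F nil
    (case 1F nil nil (case 1F nil nil (case 1F nil nil (ifLeq 0F 8F (ifLeq 8F 0F (var 2F) nil) nil))))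
    (case 6F nil nil (letIn zeroᴿ (ifLeq 15F 0F (var 1F) (var 2F))))
  functions optMinᶠ = case 0F (var 1F) (case 1F (var 0F) (ifLeq 0F 1F (var 0F) (var 1F)) nil) nil
  functions testᶠ = case 0F nil (case 1F nil
    (letIn (arith add 0F 1F) (letIn zeroᴿ (ifLeq 1F 0F zeroᴿ nil))) nil) nil
  functions flagᶠ = caseTree 0F nil nil (case 6F nil (var 6F) (call testᶠ (0F ∷ 1F ∷ [])))
  functions orᶠ = case 0F (var 1F) (var 0F) nil
  functions summaryᶠ = case 0F nil nil (case 0F
    (letIn zeroᴿ (letIn (call minimumᶠ (0F ∷ 4F ∷ [])) (letIn (call minimumᶠ (1F ∷ 6F ∷ []))
      (letIn (call optMinᶠ (1F ∷ 0F ∷ []))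
    (letIn oneᴿ (letIn (call minimumᶠ (0F ∷ 8F ∷ [])) (letIn (call minimumᶠ (1F ∷ 10F ∷ []))
      (letIn (call optMinᶠ (1F ∷ 0F ∷ [])) (cons 4F 0F)))))))))
    nil
    (letIn (call flagᶠ (5F ∷ [])) (letIn (call flagᶠ (7F ∷ [])) (letIn (call orᶠ (1F ∷ 0F ∷ []))
    (case 10F nil nil (letIn (call flagᶠ (0F ∷ [])) (letIn (call flagᶠ (2F ∷ []))
    (letIn (call orᶠ (1F ∷ 0F ∷ [])) (call orᶠ (5F ∷ 0F ∷ []))))))))))
  functions nodeᶠ = letIn (call summaryᶠ (0F ∷ 2F ∷ 3F ∷ 4F ∷ [])) (letIn (cons 3F 4F) (letIn (cons 0F 6F)
    (letIn (cons 2F 0F) (letIn (cons 4F 5F) (cons 0F 1F)))))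
  functions pushᶠ = case 2F nil nil (case 0F (var 5F) nil
    (letIn (call advanceᶠ (5F ∷ 6F ∷ [])) (letIn (call targetᶠ (6F ∷ 7F ∷ []))
      (case 9F nil nil (case 2F
        (letIn (call updᶠ (8F ∷ 3F ∷ 0F ∷ [])) (cons 0F 2F))
        (letIn (call updᶠ (8F ∷ 3F ∷ 1F ∷ [])) (cons 1F 0F)) nil)))))
  functions rebuildᶠ = letIn nil (letIn (call flatᶠ (3F ∷ 0F ∷ [])) (case 2F
    (letIn (call removeᶠ (3F ∷ 0F ∷ [])) (call balanceᶠ (0F ∷ [])))
    (letIn (cons 3F 1F) (letIn (call mergeᶠ (0F ∷ 1F ∷ [])) (call balanceᶠ (0F ∷ []))))
    nil))
  functions leftᶠ = letIn (call updᶠ (0F ∷ 1F ∷ 4F ∷ [])) (letIn nil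
    (letIn (call pushᶠ (2F ∷ 0F ∷ 3F ∷ 8F ∷ [])) (call nodeᶠ (5F ∷ 6F ∷ 2F ∷ 8F ∷ 0F ∷ []))))
  functions rightᶠ = letIn (call updᶠ (0F ∷ 1F ∷ 5F ∷ [])) (letIn zeroᴿ
    (letIn (call pushᶠ (2F ∷ 0F ∷ 3F ∷ 8F ∷ [])) (call nodeᶠ (5F ∷ 6F ∷ 7F ∷ 2F ∷ 0F ∷ []))))
  functions updᶠ = caseTree 2F (call rebuildᶠ (0F ∷ 1F ∷ 2F ∷ [])) (call rebuildᶠ (2F ∷ 3F ∷ 4F ∷ []))
    (case 9F (call rebuildᶠ (12F ∷ 13F ∷ 14F ∷ [])) nil (letIn (call cmpItemᶠ (15F ∷ 10F ∷ [])) (case 0F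
      (call rightᶠ (15F ∷ 16F ∷ 11F ∷ 2F ∷ 5F ∷ 6F ∷ 8F ∷ []))
      (call leftᶠ (15F ∷ 16F ∷ 11F ∷ 2F ∷ 5F ∷ 6F ∷ 8F ∷ []))
      (call rightᶠ (17F ∷ 18F ∷ 13F ∷ 4F ∷ 7F ∷ 8F ∷ 10F ∷ [])))))
  -- The stored sum tells the level: a pair of minima at the last one, a flag at the others.
  functions enumᶠ = letIn (call flagᶠ (0F ∷ [])) (case 0F nil
    (caseTree 1F nil nil (case 6F nil
      (letIn (call enumᶠ (2F ∷ [])) (letIn (call enumᶠ (4F ∷ []))
        (letIn (call enumᶠ (2F ∷ [])) (call enumᶠ (4F ∷ [])))))
      -- The search through A is bounded by the minimum of B, so that it finds exactly the elements
      -- with a partner. The tree is passed twice, the second time for the nested search through B.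
      (letIn zeroᴿ (call travᶠ (0F ∷ 2F ∷ 16F ∷ 16F ∷ [])))))
    nil)
  -- An element of A starts the search for its partners, with its coordinates as the first half of
  -- the pair; an element of B completes the pair.
  functions visitᶠ = case 0F nil nil (case 1F nil nil (case 1F nil nil (letIn zeroᴿ (ifLeq 1F 0F
    (letIn oneᴿ (call travᶠ (0F ∷ 4F ∷ 9F ∷ 3F ∷ [])))
    (letIn (cons 8F 2F) (emit 0F))))))
  functions travᶠ = letIn (call minimumᶠ (0F ∷ 2F ∷ [])) (letIn (call testᶠ (0F ∷ 2F ∷ [])) (case 0F nil
    (caseTree 4F nil (call visitᶠ (1F ∷ 7F ∷ []))
      (letIn (call travᶠ (14F ∷ 15F ∷ 2F ∷ 17F ∷ [])) (call travᶠ (15F ∷ 16F ∷ 4F ∷ 18F ∷ []))))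
    nil))
  functions mkItemᶠ = letIn zeroᴿ (letIn (ifLeq 1F 0F (var 0F) (arith sub 0F 2F))
    (letIn (cons 2F 4F) (letIn (cons 1F 0F) (cons 6F 0F))))
  functions mkItemsᶠ = case 2F (var 3F) nil (letIn (call mkItemsᶠ (2F ∷ 3F ∷ 1F ∷ 5F ∷ []))
    (letIn (call mkItemᶠ (3F ∷ 4F ∷ 1F ∷ [])) (cons 0F 1F)))

  sideExp : ∀ {n} → Side → Exp arities n
  sideExp inA = zeroᴿ
  sideExp inB = oneᴿ

  kindExp : ∀ {n} → Kind → Exp arities n
  kindExp insertion = zeroᴿ
  kindExp deletion  = nil

  program : DataStructure
  program = record
    { arities   = arities
    ; body      = functions
    ; build     =
        letIn nil (letIn oneᴿ (letIn (call mkItemsᶠ (0F ∷ 2F ∷ 4F ∷ 1F ∷ []))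
        (letIn zeroᴿ (letIn (call mkItemsᶠ (0F ∷ 4F ∷ 5F ∷ 1F ∷ []))
        (letIn (call buildᶠ (0F ∷ [])) (cons 6F 0F))))))
    ; update    = λ k s →
        case 0F nil nil (letIn (sideExp s) (letIn (call mkItemᶠ (0F ∷ 1F ∷ 4F ∷ []))
        (letIn (kindExp k) (letIn (call updᶠ (0F ∷ 1F ∷ 4F ∷ [])) (cons 4F 0F)))))
    ; enumerate = case 0F nil nil (call enumᶠ (1F ∷ []))
    }

open Program

module _ (ℝ : CompleteOrderedField) (d : ℕ) where

  open CompleteOrderedField ℝ using (Carrier; 0#; 1#; isDecTotalOrder)
    renaming (_+_ to _+ᴿ_; _-_ to _-ᴿ_; _≤_ to _≤ᴿ_; _≤?_ to _≤ᴿ?_; ∣_∣ to ∣_∣ᴿ; +-monoˡ-≤ to +ᴿ-monoˡ-≤; *-nonNeg to *ᴿ-nonNeg)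
  open IsDecTotalOrder isDecTotalOrder using ()
    renaming (refl to ≤ᴿ-refl; trans to ≤ᴿ-trans; antisym to ≤ᴿ-antisym; total to ≤ᴿ-total)

  -- Silent evaluations with time bounds

  Val : Set
  Val = Value ℝ

  Eval : ∀ {n} → Vec Val n → Exp arities n → Val → Trace ℝ → Set
  Eval = _⊢_⇓_∣_ ℝ program

  time-++ : ∀ σ τ → time ℝ (σ ++ τ) ≡ time ℝ σ + time ℝ τ
  time-++ []          τ = refl
  time-++ (tick  ∷ σ) τ = cong suc (time-++ σ τ)
  time-++ (out _ ∷ σ) τ = time-++ σ τ

  outputs-++ : ∀ σ τ → outputs ℝ (σ ++ τ) ≡ outputs ℝ σ ++ outputs ℝ τ
  outputs-++ []          τ = refl
  outputs-++ (tick  ∷ σ) τ = outputs-++ σ τ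
  outputs-++ (out v ∷ σ) τ = cong (v ∷_) (outputs-++ σ τ)

  treeNode : (s f m l r x y : Val) → Val
  treeNode s f m l r x y = cell (cell s f) (cell m (cell (cell l r) (cell x y)))

  treeEnv : (s f m l r x y : Val) → ∀ {n} → Vec Val n → Vec Val (12 + n)
  treeEnv s f m l r x y ρ =
    x ∷ y ∷ l ∷ r ∷ cell l r ∷ cell x y ∷ m ∷ cell (cell l r) (cell x y) ∷
    s ∷ f ∷ cell s f ∷ cell m (cell (cell l r) (cell x y)) ∷ ρ

  record Run {n} (ρ : Vec Val n) (e : Exp arities n) (v : Val) (t : ℕ) : Set where
    constructor run
    field
      {trace} : Trace ℝ
      eval    : Eval ρ e v trace
      time≤   : time ℝ trace ≤ t
      silent  : outputs ℝ trace ≡ []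

  module _ {n : ℕ} {ρ : Vec Val n} where

    infixl 1 _within_
    _within_ : ∀ {e v t t′} → Run ρ e v t → t ≤ t′ → Run ρ e v t′
    run D t≤ s within h = run D (≤-trans t≤ h) s

    rCast : ∀ {e v v′ t} → v ≡ v′ → Run ρ e v t → Run ρ e v′ t
    rCast refl D = D

    rVar : ∀ {i} → Run ρ (var i) (lookup ρ i) 1
    rVar = run var ≤-refl refl

    rNil : Run ρ nil nil 1
    rNil = run nil ≤-refl refl

    rZero : Run ρ zeroᴿ (real 0#) 1
    rZero = run zeroᴿ ≤-refl refl

    rOne : Run ρ oneᴿ (real 1#) 1
    rOne = run oneᴿ ≤-refl refl

    rCons : ∀ {i j} → Run ρ (cons i j) (cell (lookup ρ i) (lookup ρ j)) 1
    rCons = run cons ≤-refl refl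

    rAdd : ∀ {i j x y} → lookup ρ i ≡ real x → lookup ρ j ≡ real y →
           Run ρ (arith add i j) (real (x +ᴿ y)) 1
    rAdd p q = run (arith p q add) ≤-refl refl

    rSub : ∀ {i j x y} → lookup ρ i ≡ real x → lookup ρ j ≡ real y →
           Run ρ (arith sub i j) (real (x -ᴿ y)) 1
    rSub p q = run (arith p q sub) ≤-refl refl

    rThen : ∀ {i j x y e₁ e₂ v t} → lookup ρ i ≡ real x → lookup ρ j ≡ real y →
            x ≤ᴿ y → Run ρ e₁ v t → Run ρ (ifLeq i j e₁ e₂) v (suc t)
    rThen p q h (run D t s) = run (ifLeq-then p q h D) (s≤s t) s

    rElse : ∀ {i j x y e₁ e₂ v t} → lookup ρ i ≡ real x → lookup ρ j ≡ real y →
            ¬ x ≤ᴿ y → Run ρ e₂ v t → Run ρ (ifLeq i j e₁ e₂) v (suc t)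
    rElse p q h (run D t s) = run (ifLeq-else p q h D) (s≤s t) s

    rCaseNil : ∀ {i e₁ e₂ e₃ v t} → lookup ρ i ≡ nil → Run ρ e₁ v t →
               Run ρ (case i e₁ e₂ e₃) v (suc t)
    rCaseNil p (run D t s) = run (case-nil p D) (s≤s t) s

    rCaseReal : ∀ {i e₁ e₂ e₃ v t x} → lookup ρ i ≡ real x → Run ρ e₂ v t →
                Run ρ (case i e₁ e₂ e₃) v (suc t)
    rCaseReal p (run D t s) = run (case-real p D) (s≤s t) s

    rCaseCell : ∀ {i e₁ e₂ e₃ v t a b} → lookup ρ i ≡ cell a b →
                Run (a ∷ b ∷ ρ) e₃ v t → Run ρ (case i e₁ e₂ e₃) v (suc t)
    rCaseCell p (run D t s) = run (case-cell p D) (s≤s t) s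

    infixr 2 rLet
    rLet : ∀ {e₁ e₂ w v t₁ t₂} → Run ρ e₁ w t₁ → Run (w ∷ ρ) e₂ v t₂ →
           Run ρ (letIn e₁ e₂) v (suc (t₁ + t₂))
    rLet (run {τ₁} D₁ t₁ s₁) (run {τ₂} D₂ t₂ s₂) = run (letIn D₁ D₂)
      (s≤s (≤-trans (≤-reflexive (time-++ τ₁ τ₂)) (+-mono-≤ t₁ t₂)))
      (trans (outputs-++ τ₁ τ₂) (cong₂ _++_ s₁ s₂))

    rCall : ∀ {f is v t} → Run (Vec.map (lookup ρ) is) (functions f) v t →
            Run ρ (call f is) v (suc t)
    rCall (run D t s) = run (call D) (s≤s t) s

    rTreeEmpty : ∀ {i e₁ e₂ e₃ v t} → lookup ρ i ≡ nil → Run ρ e₁ v t →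
                 Run ρ (caseTree i e₁ e₂ e₃) v (suc t)
    rTreeEmpty = rCaseNil

    rTreeLeaf : ∀ {i e₁ e₂ e₃ v t x} → lookup ρ i ≡ cell nil x →
                Run (nil ∷ x ∷ ρ) e₂ v t → Run ρ (caseTree i e₁ e₂ e₃) v (2 + t)
    rTreeLeaf p (run D t s) = run (case-cell p (case-nil refl D)) (s≤s (s≤s t)) s

    rTreeNode : ∀ {i e₁ e₂ e₃ v t s f m l r x y} →
                lookup ρ i ≡ treeNode s f m l r x y →
                Run (treeEnv s f m l r x y ρ) e₃ v t →
                Run ρ (caseTree i e₁ e₂ e₃) v (6 + t)
    rTreeNode p (run D t s) = run
      (case-cell p (case-cell refl (case-cell refl (case-cell refl
        (case-cell refl (case-cell refl D))))))
      (s≤s (s≤s (s≤s (s≤s (s≤s (s≤s t)))))) s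

  -- Delay of composed traces

  Bounded : ℕ → ℕ → Trace ℝ → Set
  Bounded δ g τ = All (_≤ δ) (gapsFrom ℝ g τ)

  -- A trace that reports nothing and takes time at most k, or one that reports
  -- its first result within time a and spends at most a after its last one;
  -- stated for traces that are followed by any other trace.
  Paced : ℕ → ℕ → Bool → ℕ → Trace ℝ → Set
  Paced δ k false a τ = ∀ g τ′ → (∀ g′ → g′ ≤ g + k → Bounded δ g′ τ′) → Bounded δ g (τ ++ τ′)
  Paced δ k true  a τ = ∀ g τ′ → g + a ≤ δ → (∀ g′ → g′ ≤ a → Bounded δ g′ τ′) → Bounded δ g (τ ++ τ′)

  paced-≤ : ∀ {δ k k′ a a′} b {τ} → k ≤ k′ → a ≤ a′ → Paced δ k b a τ → Paced δ k′ b a′ τ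
  paced-≤ false k≤ a≤ P g τ′ c = P g τ′ (λ g′ h → c g′ (≤-trans h (+-monoʳ-≤ g k≤)))
  paced-≤ true  k≤ a≤ P g τ′ h c =
    P g τ′ (≤-trans (+-monoʳ-≤ g a≤) h) (λ g′ h′ → c g′ (≤-trans h′ a≤))

  quiet : ∀ {δ k a} τ → time ℝ τ ≤ k → outputs ℝ τ ≡ [] → Paced δ k false a τ
  quiet []         t≤ _ g τ′ c = c g (m≤m+n g _)
  quiet {δ} {suc k} {a} (tick ∷ τ) (s≤s t≤) s g τ′ c =
    quiet {δ} {k} {a} τ t≤ s (suc g) τ′ (λ g′ h → c g′ (≤-trans h (≤-reflexive (sym (+-suc g k)))))

  paced-tick : ∀ {δ k a} b {τ} → Paced δ k b a τ → Paced δ (suc k) b (suc a) (tick ∷ τ)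
  paced-tick {k = k} false P g τ′ c =
    P (suc g) τ′ (λ g′ h → c g′ (≤-trans h (≤-reflexive (sym (+-suc g k)))))
  paced-tick {a = a} true  P g τ′ h c =
    P (suc g) τ′ (≤-trans (≤-reflexive (sym (+-suc g a))) h) (λ g′ h′ → c g′ (m≤n⇒m≤1+n h′))

  -- If both parts report, the gap between them consists of the tail of the first and the head of
  -- the second, hence `a + a ≤ δ`. A silent part lengthens the head or the tail of the other by its
  -- own time, hence the slack `k + k′ + a`.
  paced-++ : ∀ {δ k k′ a} b b′ {τ₁ τ₂} → a + a ≤ δ →
             Paced δ k b a τ₁ → Paced δ k′ b′ a τ₂ →
             Paced δ (k + k′) (b ∨ b′) (k + k′ + a) (τ₁ ++ τ₂)
  paced-++ {δ} {k} {k′} {a} false false {τ₁} {τ₂} _ P Q g τ′ c =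
    subst (Bounded δ g) (sym (++-assoc τ₁ τ₂ τ′))
      (P g (τ₂ ++ τ′) λ g₁ h₁ → Q g₁ τ′ λ g₂ h₂ → c g₂
        (≤-trans h₂ (≤-trans (+-monoˡ-≤ k′ h₁) (≤-reflexive (+-assoc g k k′)))))
  paced-++ {δ} {k} {k′} {a} false true {τ₁} {τ₂} _ P Q g τ′ h c =
    subst (Bounded δ g) (sym (++-assoc τ₁ τ₂ τ′))
      (P g (τ₂ ++ τ′) λ g₁ h₁ → Q g₁ τ′
        (≤-trans (+-monoˡ-≤ a h₁)
          (≤-trans (poly 4 (λ g k k′ a → g :+ k :+ a :≤ g :+ (k :+ k′ :+ a)) (g ∷ k ∷ k′ ∷ a ∷ [])) h))
        λ g₂ h₂ → c g₂ (≤-trans h₂ (m≤n+m a (k + k′))))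
  paced-++ {δ} {k} {k′} {a} true false {τ₁} {τ₂} _ P Q g τ′ h c =
    subst (Bounded δ g) (sym (++-assoc τ₁ τ₂ τ′))
      (P g (τ₂ ++ τ′) (≤-trans (+-monoʳ-≤ g (m≤n+m a (k + k′))) h)
        λ g₁ h₁ → Q g₁ τ′ λ g₂ h₂ → c g₂ (≤-trans h₂ (≤-trans (+-monoˡ-≤ k′ h₁)
          (poly 3 (λ k k′ a → a :+ k′ :≤ k :+ k′ :+ a) (k ∷ k′ ∷ a ∷ [])))))
  paced-++ {δ} {k} {k′} {a} true true {τ₁} {τ₂} a≤ P Q g τ′ h c =
    subst (Bounded δ g) (sym (++-assoc τ₁ τ₂ τ′))
      (P g (τ₂ ++ τ′) (≤-trans (+-monoʳ-≤ g (m≤n+m a (k + k′))) h)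
        λ g₁ h₁ → Q g₁ τ′ (≤-trans (+-monoˡ-≤ a h₁) a≤)
          λ g₂ h₂ → c g₂ (≤-trans h₂ (m≤n+m a (k + k′))))

  record Emits (δ k : ℕ) (b : Bool) (a : ℕ) {n} (ρ : Vec Val n) (e : Exp arities n)
               (vs : List Val) : Set where
    constructor emits
    field
      {value} : Val
      {trace} : Trace ℝ
      eval    : Eval ρ e value trace
      outputs≡ : outputs ℝ trace ≡ vs
      paced   : Paced δ k b a trace

  module _ {δ n : ℕ} {ρ : Vec Val n} where

    eWeaken : ∀ {k k′ a a′ e vs} b → k ≤ k′ → a ≤ a′ →
              Emits δ k b a ρ e vs → Emits δ k′ b a′ ρ e vs
    eWeaken b k≤ a≤ (emits {trace = τ} D o p) = emits D o (paced-≤ b {τ} k≤ a≤ p)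

    eSilent : ∀ {e v t a} → Run ρ e v t → Emits δ t false a ρ e []
    eSilent {a = a} (run {τ} D t s) = emits D s (quiet {a = a} τ t s)

    eEmit : ∀ {i k} → Emits δ k true 1 ρ (emit i) (lookup ρ i ∷ [])
    eEmit {i} {k} = emits emit refl λ g τ′ h c →
      subst (_≤ δ) (+-comm g 1) h ∷ c 0 z≤n

    eThen : ∀ {i j x y e₁ e₂ k a vs} b → lookup ρ i ≡ real x → lookup ρ j ≡ real y →
            x ≤ᴿ y → Emits δ k b a ρ e₁ vs → Emits δ (suc k) b (suc a) ρ (ifLeq i j e₁ e₂) vs
    eThen b p q h (emits {trace = τ} D o P) = emits (ifLeq-then p q h D) o (paced-tick b {τ} P)

    eElse : ∀ {i j x y e₁ e₂ k a vs} b → lookup ρ i ≡ real x → lookup ρ j ≡ real y →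
            ¬ x ≤ᴿ y → Emits δ k b a ρ e₂ vs → Emits δ (suc k) b (suc a) ρ (ifLeq i j e₁ e₂) vs
    eElse b p q h (emits {trace = τ} D o P) = emits (ifLeq-else p q h D) o (paced-tick b {τ} P)

    eCaseReal : ∀ {i e₁ e₂ e₃ k a vs x} b → lookup ρ i ≡ real x → Emits δ k b a ρ e₂ vs →
                Emits δ (suc k) b (suc a) ρ (case i e₁ e₂ e₃) vs
    eCaseReal b p (emits {trace = τ} D o P) = emits (case-real p D) o (paced-tick b {τ} P)

    eCaseCell : ∀ {i e₁ e₂ e₃ k a vs x y} b → lookup ρ i ≡ cell x y →
                Emits δ k b a (x ∷ y ∷ ρ) e₃ vs →
                Emits δ (suc k) b (suc a) ρ (case i e₁ e₂ e₃) vs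
    eCaseCell b p (emits {trace = τ} D o P) = emits (case-cell p D) o (paced-tick b {τ} P)

    eCall : ∀ {f is k a vs} b → Emits δ k b a (Vec.map (lookup ρ) is) (functions f) vs →
            Emits δ (suc k) b (suc a) ρ (call f is) vs
    eCall b (emits {trace = τ} D o P) = emits (call D) o (paced-tick b {τ} P)

    eLet : ∀ {e₁ e₂ k k′ a vs₁ vs₂} b b′ → a + a ≤ δ → Emits δ k b a ρ e₁ vs₁ →
           (∀ v → Emits δ k′ b′ a (v ∷ ρ) e₂ vs₂) →
           Emits δ (suc (k + k′)) (b ∨ b′) (suc (k + k′ + a)) ρ (letIn e₁ e₂) (vs₁ ++ vs₂)
    eLet b b′ h (emits {v} {τ₁} D₁ o₁ P₁) E with E v
    ... | emits {_} {τ₂} D₂ o₂ P₂ = emits (letIn D₁ D₂)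
      (trans (outputs-++ τ₁ τ₂) (cong₂ _++_ o₁ o₂))
      (paced-tick (b ∨ b′) {τ₁ ++ τ₂} (paced-++ b b′ {τ₁} {τ₂} h P₁ P₂))

    -- A silent first part needs no room in δ.
    eAfter : ∀ {e₁ e₂ w t k a vs} b → Run ρ e₁ w t → Emits δ k b a (w ∷ ρ) e₂ vs →
             Emits δ (suc (t + k)) b (suc (t + a)) ρ (letIn e₁ e₂) vs
    eAfter {t = t} {k} {a} b (run {τ₁} D₁ t₁ s₁) (emits {_} {τ₂} D₂ o₂ P₂) =
      emits (letIn D₁ D₂) (trans (outputs-++ τ₁ τ₂) (cong₂ _++_ s₁ o₂))
        (paced-tick b {τ₁ ++ τ₂} (go b P₂))
      where
      go : ∀ b → Paced δ k b a τ₂ → Paced δ (t + k) b (t + a) (τ₁ ++ τ₂)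
      go false Q g τ′ c = subst (Bounded δ g) (sym (++-assoc τ₁ τ₂ τ′))
        (quiet {a = 0} τ₁ t₁ s₁ g (τ₂ ++ τ′) λ g₁ h₁ → Q g₁ τ′ λ g₂ h₂ → c g₂
          (≤-trans h₂ (≤-trans (+-monoˡ-≤ k h₁) (≤-reflexive (+-assoc g t k)))))
      go true Q g τ′ h c = subst (Bounded δ g) (sym (++-assoc τ₁ τ₂ τ′))
        (quiet {a = 0} τ₁ t₁ s₁ g (τ₂ ++ τ′) λ g₁ h₁ → Q g₁ τ′
          (≤-trans (+-monoˡ-≤ a h₁) (≤-trans (≤-reflexive (+-assoc g t a)) h))
          λ g₂ h₂ → c g₂ (≤-trans h₂ (m≤n+m a t)))

    eTreeLeaf : ∀ {i e₁ e₂ e₃ k a vs x} b → lookup ρ i ≡ cell nil x →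
                Emits δ k b a (nil ∷ x ∷ ρ) e₂ vs →
                Emits δ (2 + k) b (2 + a) ρ (caseTree i e₁ e₂ e₃) vs
    eTreeLeaf b p (emits {trace = τ} D o P) = emits (case-cell p (case-nil refl D)) o
      (paced-tick b {tick ∷ τ} (paced-tick b {τ} P))

    eTreeNode : ∀ {i e₁ e₂ e₃ k a vs s f m l r x y} b →
                lookup ρ i ≡ treeNode s f m l r x y →
                Emits δ k b a (treeEnv s f m l r x y ρ) e₃ vs →
                Emits δ (6 + k) b (6 + a) ρ (caseTree i e₁ e₂ e₃) vs
    eTreeNode b p (emits {trace = τ} D o P) = emits
      (case-cell p (case-cell refl (case-cell refl (case-cell refl
        (case-cell refl (case-cell refl D)))))) o
      (ticks 6 P)
      where
      ticks : ∀ m {k a} → Paced δ k b a τ → Paced δ (m + k) b (m + a) (List.replicate m tick ++ τ)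
      ticks zero    P = P
      ticks (suc m) P = paced-tick b {List.replicate m tick ++ τ} (ticks m P)

  paced⇒delay : ∀ {δ k a} b {τ} → k ≤ δ → a ≤ δ → Paced δ k b a τ → HasDelay ℝ δ τ
  paced⇒delay {δ} false {τ} k≤ a≤ P = subst (Bounded δ 0) (++-identityʳ τ)
    (P 0 [] λ g h → ≤-trans h k≤ ∷ [])
  paced⇒delay {δ} true  {τ} k≤ a≤ P = subst (Bounded δ 0) (++-identityʳ τ)
    (P 0 [] a≤ λ g h → ≤-trans h a≤ ∷ [])

  -- Elements and their order

  Elem : Set
  Elem = Side × Point ℝ d

  sideOf : Elem → Side
  sideOf = proj₁

  sideᴿ : Side → Carrier
  sideᴿ inA = 0#
  sideᴿ inB = 1#

  reals : List Carrier → Val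
  reals xs = encodeList ℝ (List.map real xs)

  ident : Elem → List Carrier
  ident (s , p) = sideᴿ s ∷ Vec.toList p

  -- How the elements are seen after processing all but j coordinates.
  record View (j : ℕ) : Set where
    field
      acc : Elem → Carrier
      rem : Elem → Vec Carrier j

  open View public

  item : ∀ {j} → View j → Elem → Val
  item V e = cell (reals (Vec.toList (rem V e))) (cell (real (acc V e)) (reals (ident e)))

  items : ∀ {j} → View j → List Elem → Val
  items V es = encodeList ℝ (List.map (item V) es)

  -- The identity breaks ties between equal coordinates and makes keys injective, so that deletions
  -- find their element. At the last level the order is by identity alone: there the search is
  -- guided by minima, and the order serves updates only.
  keyOf : List Carrier → List Carrier → List Carrier
  keyOf []      is = is
  keyOf (x ∷ _) is = x ∷ is

  key : ∀ {j} → View j → Elem → List Carrier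
  key V e = keyOf (Vec.toList (rem V e)) (ident e)

  infix 4 _<ₗₑₓ_
  data _<ₗₑₓ_ : List Carrier → List Carrier → Set where
    here : ∀ {x y xs ys} → ¬ y ≤ᴿ x → x ∷ xs <ₗₑₓ y ∷ ys
    next : ∀ {x xs ys} → xs <ₗₑₓ ys → x ∷ xs <ₗₑₓ x ∷ ys

  <ₗₑₓ-trans : ∀ {xs ys zs} → xs <ₗₑₓ ys → ys <ₗₑₓ zs → xs <ₗₑₓ zs
  <ₗₑₓ-trans {_ ∷ _} {y ∷ _} {z ∷ _} (here p) (here q) = here λ z≤x →
    [ (λ z≤y → q z≤y) , (λ y≤z → p (≤ᴿ-trans y≤z z≤x)) ]′ (≤ᴿ-total z y)
  <ₗₑₓ-trans (here p) (next q) = here p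
  <ₗₑₓ-trans (next p) (here q) = here q
  <ₗₑₓ-trans (next p) (next q) = next (<ₗₑₓ-trans p q)

  <ₗₑₓ-irrefl : ∀ {xs} → ¬ xs <ₗₑₓ xs
  <ₗₑₓ-irrefl (here p) = p ≤ᴿ-refl
  <ₗₑₓ-irrefl (next p) = <ₗₑₓ-irrefl p

  data Compare {A : Set} (_<_ : A → A → Set) (x y : A) : Set where
    eq : x ≡ y → Compare _<_ x y
    lt : x < y → Compare _<_ x y
    gt : y < x → Compare _<_ x y

  compareV : ∀ {A : Set} {_<_ : A → A → Set} {x y} → Compare _<_ x y → Val
  compareV (eq _) = nil
  compareV (lt _) = real 0#
  compareV (gt _) = cell nil nil

  cmp-run : ∀ xs ys → length xs ≡ length ys → Σ[ c ∈ Compare _<ₗₑₓ_ xs ys ]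
            Run (reals xs ∷ reals ys ∷ []) (functions cmpᶠ) (compareV c) (length xs * 6 + 2)
  cmp-run []       []       _ = eq refl , rCaseNil refl rNil
  cmp-run (x ∷ xs) (y ∷ ys) h with x ≤ᴿ? y
  ... | no x≰y = gt (here x≰y) ,
    (rCaseCell refl (rCaseCell refl (rElse refl refl x≰y (rLet rNil rCons))) within m≤m+n 6 _)
  ... | yes x≤y with y ≤ᴿ? x
  ...   | no y≰x = lt (here y≰x) ,
    (rCaseCell refl (rCaseCell refl (rThen refl refl x≤y (rElse refl refl y≰x rZero))) within m≤m+n 5 _)
  ...   | yes y≤x with ≤ᴿ-antisym x≤y y≤x | cmp-run xs ys (suc-injective h)
  ...     | refl | c , D = extend c , rCast (extendV c)
    (rCaseCell refl (rCaseCell refl (rThen refl refl x≤y (rThen refl refl y≤x (rCall D))))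
      within n≤1+n _)
    where
    extend : Compare _<ₗₑₓ_ xs ys → Compare _<ₗₑₓ_ (x ∷ xs) (x ∷ ys)
    extend (eq p) = eq (cong (x ∷_) p)
    extend (lt p) = lt (next p)
    extend (gt p) = gt (next p)

    extendV : ∀ c → compareV c ≡ compareV (extend c)
    extendV (eq _) = refl
    extendV (lt _) = refl
    extendV (gt _) = refl

  _≺[_]_ : ∀ {j} → Elem → View j → Elem → Set
  e ≺[ V ] f = key V e <ₗₑₓ key V f

  Sorted : ∀ {j} → View j → List Elem → Set
  Sorted V = AllPairs (λ e f → e ≺[ V ] f)

  ident-injective : ∀ {e f} → ident e ≡ ident f → e ≡ f
  ident-injective {s , p} {s′ , p′} h with ∷-injective h
  ... | h₁ , h₂ = cong₂ _,_ (sides s s′ h₁)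
    (trans (sym (Vecₚ.cast-is-id refl p)) (toList-injective refl p p′ h₂))
    where
    sides : ∀ s s′ → sideᴿ s ≡ sideᴿ s′ → s ≡ s′
    sides inA inA _ = refl
    sides inA inB h = ⊥-elim (CompleteOrderedField.0≢1 ℝ h)
    sides inB inA h = ⊥-elim (CompleteOrderedField.0≢1 ℝ (sym h))
    sides inB inB _ = refl

  key-injective : ∀ {j} (V : View j) {e f} → key V e ≡ key V f → e ≡ f
  key-injective V {e} {f} h with rem V e | rem V f
  ... | []    | []    = ident-injective h
  ... | _ ∷ _ | _ ∷ _ = ident-injective (proj₂ (∷-injective h))

  length-key : ∀ {j} (V : View j) e → length (key V e) ≡ (1 ∸ (1 ∸ j)) + suc d
  length-key V e@(_ , p) with rem V e
  ... | []    = cong suc (length-toList p)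
  ... | _∷_ {n} _ _ rewrite 0∸n≡0 n = cong (λ n → suc (suc n)) (length-toList p)

  abstract
    -- A key has at most `2 + d` entries, each worth six steps. The constant is opaque so that it
    -- enters all further cost polynomials as a single atom.
    compareCost : ℕ
    compareCost = (2 + d) * 6 + 20

    compareCost-≥ : ∀ {n} → n ≤ 2 + d → 13 + (n * 6 + 2) ≤ compareCost
    compareCost-≥ n≤ = ≤-trans (+-monoʳ-≤ 13 (+-monoˡ-≤ 2 (*-monoˡ-≤ 6 n≤)))
      (poly 1 (λ n → con 13 :+ (n :+ con 2) :≤ n :+ con 20) ((2 + d) * 6 ∷ []))

  stepCost : ℕ
  stepCost = compareCost + 20

  key-run : ∀ rem a is → Run (cell (reals rem) (cell (real a) (reals is)) ∷ [])
                             (functions keyᶠ) (reals (keyOf rem is)) 4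
  key-run []      a is = rCaseCell refl (rCaseCell refl (rCaseNil refl rVar))
  key-run (x ∷ _) a is = rCaseCell refl (rCaseCell refl (rCaseCell refl rCons))

  cmpItem-run : ∀ {j} (V : View j) e f → Σ[ c ∈ Compare (λ e f → e ≺[ V ] f) e f ]
                Run (item V e ∷ item V f ∷ []) (functions cmpItemᶠ) (compareV c) compareCost
  cmpItem-run {j} V e f
    with cmp-run (key V e) (key V f) (trans (length-key V e) (sym (length-key V f)))
  ... | c , D = compareKeys c , rCast (compareKeysV c)
    (rLet (rCall (key-run (Vec.toList (rem V e)) (acc V e) (ident e))) (rLet (rCall (key-run (Vec.toList (rem V f)) (acc V f) (ident f))) (rCall D))
      within compareCost-≥ (≤-trans (≤-reflexive (length-key V e))
               (+-monoˡ-≤ (suc d) (m∸n≤m 1 (1 ∸ j)))))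
    where
    compareKeys : Compare _<ₗₑₓ_ (key V e) (key V f) → Compare (λ e f → e ≺[ V ] f) e f
    compareKeys (eq p) = eq (key-injective V p)
    compareKeys (lt p) = lt p
    compareKeys (gt p) = gt p

    compareKeysV : ∀ c → compareV c ≡ compareV (compareKeys c)
    compareKeysV (eq _) = refl
    compareKeysV (lt _) = refl
    compareKeysV (gt _) = refl

  -- Merging, removing, halving and sorting

  module _ {j : ℕ} (V : View j) where

    sorted-∷ : ∀ {x xs} → (∀ {z} → z ∈ xs → x ≺[ V ] z) → Sorted V xs → Sorted V (x ∷ xs)
    sorted-∷ h s = All.tabulate h ∷ s

    Merged : List Elem → List Elem → Set
    Merged xs ys = ∃[ zs ]
      Sorted V zs × (∀ z → z ∈ zs ⇔ (z ∈ xs ⊎ z ∈ ys)) × length zs ≤ length xs + length ys ×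
      Run (items V xs ∷ items V ys ∷ []) (functions mergeᶠ) (items V zs)
          ((length xs + length ys) * stepCost + 3)

    -- Of two equal heads one is dropped, so merging is a union of sets: inserting an element that
    -- is already present changes nothing. This is also why lengths are only bounded from above.
    merge-step : ∀ {x xs y ys} → Sorted V (x ∷ xs) → Sorted V (y ∷ ys) →
                 Merged xs (y ∷ ys) → Merged (x ∷ xs) ys → Merged (x ∷ xs) (y ∷ ys)
    merge-step {x} {xs} {y} {ys} (x≺ ∷ s) (y≺ ∷ s′) M M′ with cmpItem-run V x y
    ... | eq refl , C = let zs , sz , mem , len , D = M in zs , sz ,
      (λ z → mk⇔ ([ inj₁ ∘ there , inj₂ ]′ ∘ to (mem z))
                 λ { (inj₁ (here refl)) → from (mem z) (inj₂ (here refl))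
                   ; (inj₁ (there h)) → from (mem z) (inj₁ h)
                   ; (inj₂ h) → from (mem z) (inj₂ h) }) ,
      m≤n⇒m≤1+n len ,
      (rCaseCell refl (rCaseCell refl (rLet (rCall C) (rCaseNil refl (rCall D)))) within
        poly 2 (λ c n → con 4 :+ (c :+ (con 2 :+ (n :+ con 3))) :≤ c :+ con 20 :+ n :+ con 3)
          (compareCost ∷ (length xs + suc (length ys)) * stepCost ∷ []))
    ... | lt x≺y , C = let zs , sz , mem , len , D = M in x ∷ zs ,
      sorted-∷ (λ h → [ All.lookup x≺
                      , (λ { (here refl) → x≺y ; (there h) → <ₗₑₓ-trans x≺y (All.lookup y≺ h) }) ]′ (to (mem _) h)) sz ,
      (λ z → mk⇔ (λ { (here refl) → inj₁ (here refl) ; (there h) → [ inj₁ ∘ there , inj₂ ]′ (to (mem z) h) })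
                 λ { (inj₁ (here refl)) → here refl
                   ; (inj₁ (there h)) → there (from (mem z) (inj₁ h))
                   ; (inj₂ h) → there (from (mem z) (inj₂ h)) }) ,
      s≤s len ,
      (rCaseCell refl (rCaseCell refl (rLet (rCall C) (rCaseReal refl (rLet (rCall D) rCons)))) within
        poly 2 (λ c n → con 4 :+ (c :+ (con 3 :+ (n :+ con 3 :+ con 1))) :≤ c :+ con 20 :+ n :+ con 3)
          (compareCost ∷ (length xs + suc (length ys)) * stepCost ∷ []))
    ... | gt y≺x , C = let zs , sz , mem , len , D = M′ in y ∷ zs ,
      sorted-∷ (λ h → [ (λ { (here refl) → y≺x ; (there h) → <ₗₑₓ-trans y≺x (All.lookup x≺ h) })
                      , All.lookup y≺ ]′ (to (mem _) h)) sz ,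
      (λ z → mk⇔ (λ { (here refl) → inj₂ (here refl) ; (there h) → [ inj₁ , inj₂ ∘ there ]′ (to (mem z) h) })
                 λ { (inj₁ h) → there (from (mem z) (inj₁ h))
                   ; (inj₂ (here refl)) → here refl
                   ; (inj₂ (there h)) → there (from (mem z) (inj₂ h)) }) ,
      ≤-trans (s≤s len) (≤-reflexive (sym (+-suc (suc (length xs)) (length ys)))) ,
      (rCaseCell refl (rCaseCell refl (rLet (rCall C) (rCaseCell refl (rLet (rCall D) rCons)))) within
        poly 4 (λ c a b s → con 4 :+ (c :+ (con 3 :+ ((con 1 :+ a :+ b) :* (c :+ con 20) :+ con 3 :+ con 1)))
                       :≤ (con 1 :+ a :+ (con 1 :+ b)) :* (c :+ con 20) :+ con 3)
          (compareCost ∷ length xs ∷ length ys ∷ 0 ∷ []))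

    merge-run : ∀ xs ys → Sorted V xs → Sorted V ys → Merged xs ys
    merge-run [] ys _ s = ys , s , (λ z → mk⇔ inj₂ λ { (inj₂ h) → h ; (inj₁ ()) }) , ≤-refl ,
      (rCaseNil refl rVar within poly 1 (λ n → con 2 :≤ n :+ con 3) (length ys * stepCost ∷ []))
    merge-run xs@(_ ∷ _) [] s _ = xs , s , (λ z → mk⇔ inj₁ λ { (inj₁ h) → h ; (inj₂ ()) }) ,
      m≤m+n (length xs) 0 ,
      (rCaseCell refl (rCaseNil refl rVar) within m≤n+m 3 ((length xs + 0) * stepCost))
    merge-run (x ∷ xs) (y ∷ ys) (x≺ ∷ s) (y≺ ∷ s′) =
      merge-step (x≺ ∷ s) (y≺ ∷ s′) (merge-run xs (y ∷ ys) s (y≺ ∷ s′)) (merge-run (x ∷ xs) ys (x≺ ∷ s) s′)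

    removed-∷ : ∀ {e y : Elem} {ys zs} → y ≢ e → (∀ z → z ∈ zs ⇔ (z ∈ ys × z ≢ e)) →
                ∀ z → z ∈ y ∷ zs ⇔ (z ∈ y ∷ ys × z ≢ e)
    removed-∷ y≢e mem z = mk⇔
      (λ { (here refl) → here refl , y≢e ; (there h) → there (proj₁ (to (mem z) h)) , proj₂ (to (mem z) h) })
      (λ { (here refl , n) → here refl ; (there h , n) → there (from (mem z) (h , n)) })

    Removed : Elem → List Elem → Set
    Removed e xs = ∃[ zs ] Sorted V zs × (∀ z → z ∈ zs ⇔ (z ∈ xs × z ≢ e)) × length zs ≤ length xs ×
      Run (item V e ∷ items V xs ∷ []) (functions removeᶠ) (items V zs) (length xs * stepCost + 2)

    remove-run : ∀ e xs → Sorted V xs → Removed e xs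
    remove-run e []       _        = [] , [] , (λ z → mk⇔ (λ ()) λ ()) , z≤n , rCaseNil refl rNil
    remove-run e (y ∷ ys) (y≺ ∷ s) = step (remove-run e ys s) (cmpItem-run V e y)
      where
      cost : 1 + (2 + (length ys * stepCost + 2 + (2 + (compareCost + 2)))) ≤ stepCost + length ys * stepCost + 2
      cost = poly 2 (λ c n → con 3 :+ (n :+ con 2 :+ (con 2 :+ (c :+ con 2))) :≤ c :+ con 20 :+ n :+ con 2)
        (compareCost ∷ length ys * stepCost ∷ [])

      step : Removed e ys → (Σ[ c ∈ Compare (λ e f → e ≺[ V ] f) e y ]
               Run (item V e ∷ item V y ∷ []) (functions cmpItemᶠ) (compareV c) compareCost) → Removed e (y ∷ ys)
      step (zs , sz , mem , len , D) (eq refl , C) = zs , sz ,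
        (λ z → mk⇔ (λ h → there (proj₁ (to (mem z) h)) , proj₂ (to (mem z) h))
          λ { (here refl , n) → ⊥-elim (n refl) ; (there h , n) → from (mem z) (h , n) }) ,
        m≤n⇒m≤1+n len ,
        (rCaseCell refl (rLet (rCall D) (rLet (rCall C) (rCaseNil refl rVar))) within cost)
      step (zs , sz , mem , len , D) (lt e≺y , C) =
        y ∷ zs , sorted-∷ (λ h → All.lookup y≺ (proj₁ (to (mem _) h))) sz ,
        removed-∷ (λ { refl → <ₗₑₓ-irrefl e≺y }) mem , s≤s len ,
        (rCaseCell refl (rLet (rCall D) (rLet (rCall C) (rCaseReal refl rCons))) within cost)
      step (zs , sz , mem , len , D) (gt y≺e , C) =
        y ∷ zs , sorted-∷ (λ h → All.lookup y≺ (proj₁ (to (mem _) h))) sz ,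
        removed-∷ (λ { refl → <ₗₑₓ-irrefl y≺e }) mem , s≤s len ,
        (rCaseCell refl (rLet (rCall D) (rLet (rCall C) (rCaseCell refl rCons))) within cost)

    -- The second list is a clock that loses two elements whenever one moves to the first half.
    -- Called with the same list twice, the procedure cuts it in the middle without counting.
    half-run : ∀ xs (ys : List Elem) → length ys ≤ length xs → ∃[ l ] ∃[ r ]
      xs ≡ l ++ r × 2 * length l ≤ length ys × length ys ≤ 2 * length l + 1 ×
      Run (items V xs ∷ items V ys ∷ []) (functions halfᶠ) (cell (items V l) (items V r))
          (length ys * 5 + 5)
    half-run xs [] _ = [] , xs , refl , z≤n , z≤n , (rCaseNil refl (rLet rNil rCons) within n≤1+n 4)
    half-run xs (_ ∷ []) _ = [] , xs , refl , z≤n , ≤-refl ,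
      (rCaseCell refl (rCaseNil refl (rLet rNil rCons)) within m≤m+n 5 5)
    half-run (x ∷ xs) (_ ∷ _ ∷ ys) (s≤s h) with half-run xs ys (≤-trans (n≤1+n _) h)
    ... | l , r , p , lo , hi , D = x ∷ l , r , cong (x ∷_) p ,
      cancel lo (poly 2 (λ n y → con 2 :* (con 1 :+ n) :+ y
        :≤ con 2 :+ y :+ con 2 :* n) (length l ∷ length ys ∷ [])) ,
      cancel hi (poly 2 (λ n y → con 2 :+ y :+ (con 2 :* n :+ con 1)
        :≤ con 2 :* (con 1 :+ n) :+ con 1 :+ y) (length l ∷ length ys ∷ [])) ,
      (rCaseCell refl (rCaseCell refl (rCaseCell refl (rLet (rCall D) (rCaseCell refl (rLet rCons rCons))))) within
        poly 1 (λ n → con 5 :+ (n :* con 5 :+ con 5 :+ con 4) :≤ (con 2 :+ n) :* con 5 :+ con 5) (length ys ∷ []))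

  half-≤ : ∀ {n l r} h → n ≡ l + r → 2 * l ≤ n → n ≤ 2 * l + 1 → n ≤ 2 ^ suc h →
           l ≤ 2 ^ h × r ≤ 2 ^ h
  half-≤ {n} {l} {r} h refl lo hi n≤ =
    *-cancelˡ-≤ 2 (≤-trans lo n≤) ,
    ≤-pred (*-cancelˡ-< 2 r (suc (2 ^ h)) (cancel (+-mono-≤ hi n≤)
      (poly 3 (λ l r p → con 1 :+ con 2 :* r :+ (con 2 :* l :+ con 1 :+ con 2 :* p)
                      :≤ con 2 :* (con 1 :+ p) :+ (l :+ r :+ (l :+ r))) (l ∷ r ∷ 2 ^ h ∷ []))))

  sort-cost : ∀ s h n l r m → n ≡ l + r → m ≤ l + r → 2 ≤ n →
    4 + (n * 5 + 5 + (2 + ((1 + (suc h * (l * (s + 40)) + 3)) +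
      (2 + (suc h * (r * (s + 40)) + 3) + (1 + (m * s + 3))))))
    ≤ suc (suc h) * (n * (s + 40)) + 3
  sort-cost s h n l r m refl m≤ 2≤ = cancel (+-mono-≤ (*-monoˡ-≤ s m≤) (*-monoʳ-≤ 11 2≤))
    (poly 5 (λ h l r m s →
      con 4 :+ ((l :+ r) :* con 5 :+ con 5 :+ (con 2 :+ ((con 1 :+ ((con 1 :+ h) :* (l :* (s :+ con 40)) :+ con 3)) :+
        (con 2 :+ ((con 1 :+ h) :* (r :* (s :+ con 40)) :+ con 3) :+ (con 1 :+ (m :* s :+ con 3))))))
      :+ ((l :+ r) :* s :+ con 11 :* (l :+ r))
      :≤ (con 2 :+ h) :* ((l :+ r) :* (s :+ con 40)) :+ con 3 :+ (m :* s :+ con 11 :* con 2))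
      (h ∷ l ∷ r ∷ m ∷ s ∷ []))

  sortCost : ℕ
  sortCost = stepCost + 40

  sort-run : ∀ {j} (V : View j) h xs → length xs ≤ 2 ^ h → ∃[ ys ]
    Sorted V ys × (∀ z → z ∈ ys ⇔ z ∈ xs) × length ys ≤ length xs ×
    Run (items V xs ∷ []) (functions sortᶠ) (items V ys) (suc h * (length xs * sortCost) + 3)
  sort-run V h [] _ = [] , [] , (λ z → mk⇔ (λ h → h) (λ h → h)) , z≤n ,
    (rCaseNil refl rNil within ≤-trans (n≤1+n 2) (m≤n+m 3 (suc h * 0)))
  sort-run V h (x ∷ []) _ = x ∷ [] , [] ∷ [] , (λ z → mk⇔ (λ h → h) (λ h → h)) , ≤-refl ,
    (rCaseCell refl (rCaseNil refl rVar) within m≤n+m 3 (suc h * (1 * sortCost)))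
  sort-run V zero (_ ∷ _ ∷ _) (s≤s ())
  sort-run V (suc h) xs@(x ∷ y ∷ zs) n≤ =
    let l , r , xs≡ , lo , hi , D = half-run V xs xs ≤-refl
        n≡ = trans (cong length xs≡) (length-++ l)
        l≤ , r≤ = half-≤ h n≡ lo hi n≤
        l′ , sl , ml , ll , Dl = sort-run V h l l≤
        r′ , sr , mr , lr , Dr = sort-run V h r r≤
        ys , sy , my , ly , Dy = merge-run V l′ r′ sl sr
    in ys , sy ,
      (λ z → mk⇔
        (λ h → subst (z ∈_) (sym xs≡) ([ (λ h → ∈-++⁺ˡ (to (ml z) h)) , (λ h → ∈-++⁺ʳ l (to (mr z) h)) ]′ (to (my z) h)))
        (λ h → from (my z) ([ (λ h → inj₁ (from (ml z) h)) , (λ h → inj₂ (from (mr z) h)) ]′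
                 (∈-++⁻ l (subst (z ∈_) xs≡ h))))) ,
      ≤-trans ly (≤-trans (+-mono-≤ ll lr) (≤-reflexive (sym n≡))) ,
      (rCaseCell refl (rCaseCell refl (rLet (rCall D) (rCaseCell refl
        (rLet (rCall Dl) (rLet (rCall Dr) (rCall Dy)))))) within
        sort-cost stepCost h (length xs) (length l) (length r) (length l′ + length r′) n≡ (+-mono-≤ ll lr) (s≤s (s≤s z≤n)))

  -- Trees, views and encodings

  data Dir : Set where
    left right : Dir

  -- The children of a node, and its two secondary structures, are told apart
  -- by directions: A from child c is joined with B from the other child.
  dirOf : Dir → Side → Dir
  dirOf c     inA = c
  dirOf left  inB = right
  dirOf right inB = left

  dirOf-involutive : ∀ c σ → dirOf (dirOf c σ) σ ≡ c
  dirOf-involutive c     inA = refl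
  dirOf-involutive left  inB = refl
  dirOf-involutive right inB = refl

  dirV : Dir → Val
  dirV left  = nil
  dirV right = real 0#

  boolV : Bool → Val
  boolV false = nil
  boolV true  = real 0#

  maybeV : Maybe Carrier → Val
  maybeV nothing  = nil
  maybeV (just x) = real x

  shift : Dir → Carrier → Carrier → Carrier
  shift left  a x = a -ᴿ x
  shift right a x = a +ᴿ x

  ViewOf : ℕ → Set
  ViewOf zero    = ⊤
  ViewOf (suc j) = View j

  -- In direction `left` the point of A has the smaller coordinate x and that of B the larger one y,
  -- so y - x is split by subtracting x on the side of A and adding y on that of B. In direction
  -- `right` the signs are exchanged.
  subview : ∀ {j} → Dir → View j → ViewOf j
  subview {zero}  c V = tt
  subview {suc j} c V = record
    { acc = λ e → shift (dirOf c (sideOf e)) (acc V e) (Vec.head (rem V e))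
    ; rem = λ e → Vec.tail (rem V e)
    }

  -- A node remembers, for the analysis only, the number n of elements and a
  -- bound w on its logarithm when it was built, and the number q of updates
  -- since then.
  data Tree (S : Set) : Set where
    empty : Tree S
    leaf  : Elem → Tree S
    node  : (w n q : ℕ) (s : Elem) (fuel : List Elem) (L R : Tree S) (X Y : S) → Tree S

  module _ {S : Set} where

    elems : Tree S → List Elem
    elems empty                    = []
    elems (leaf e)                 = e ∷ []
    elems (node _ _ _ _ _ L R _ _) = elems L ++ elems R

    count : Tree S → ℕ
    count t = length (elems t)

    treeSize : Tree S → ℕ
    treeSize empty                    = 1
    treeSize (leaf e)                 = 1
    treeSize (node _ _ _ _ _ L R _ _) = suc (treeSize L + treeSize R)

    height : Tree S → ℕ
    height empty                    = 0
    height (leaf e)                 = 0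
    height (node _ _ _ _ _ L R _ _) = suc (height L ⊔ height R)

    birth : Tree S → ℕ
    birth empty                    = 1
    birth (leaf e)                 = 1
    birth (node _ n _ _ _ _ _ _ _) = n

    -- The secondary structures enter through function arguments, here as in `treePot` and
    -- `treeEnc`. This separates the recursion over the tree from that over the level.
    treeFlag : (S → S → Bool) → Tree S → Bool
    treeFlag f empty                    = false
    treeFlag f (leaf e)                 = false
    treeFlag f (node _ _ _ _ _ L R X Y) = (treeFlag f L ∨ treeFlag f R) ∨ f X Y

    treePot : (ℕ → ℕ) → (S → ℕ) → Tree S → ℕ
    treePot W pot empty                    = 0
    treePot W pot (leaf e)                 = 0
    treePot W pot (node w _ q _ _ L R X Y) =
      q * W w + (treePot W pot L + treePot W pot R + (pot X + pot Y))

  minOf : Maybe Carrier → Maybe Carrier → Maybe Carrier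
  minOf nothing  b        = b
  minOf (just x) nothing  = just x
  minOf (just x) (just y) with x ≤ᴿ? y
  ... | yes _ = just x
  ... | no  _ = just y

  select : Side → Side → Carrier → Maybe Carrier
  select inA inA x = just x
  select inA inB x = nothing
  select inB inA x = nothing
  select inB inB x = just x

  minimum : ∀ {j S} → Side → View j → Tree S → Maybe Carrier
  minimum σ V empty                    = nothing
  minimum σ V (leaf e)                 = select σ (sideOf e) (acc V e)
  minimum σ V (node _ _ _ _ _ L R _ _) = minOf (minimum σ V L) (minimum σ V R)

  within? : Maybe Carrier → Maybe Carrier → Bool
  within? nothing  _        = false
  within? (just x) nothing  = false
  within? (just x) (just y) = does (x +ᴿ y ≤ᴿ? 0#)

  St : ℕ → Set
  St zero    = ⊤
  St (suc j) = Tree (St j)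

  -- Empty trees and leaves cannot contain a point of A together with one of B, so they are
  -- unflagged at every level.
  flag : ∀ {j} → ViewOf j → St j → Bool
  flag {zero}        _ _                          = false
  flag {suc zero}    V empty                      = false
  flag {suc zero}    V (leaf _)                   = false
  flag {suc zero}    V t@(node _ _ _ _ _ _ _ _ _) = within? (minimum inA V t) (minimum inB V t)
  flag {suc (suc j)} V t = treeFlag (λ X Y → flag (subview left V) X ∨ flag (subview right V) Y) t

  sumV : ∀ {j} → View j → St (suc j) → Val
  sumV {zero}  V t = cell (maybeV (minimum inA V t)) (maybeV (minimum inB V t))
  sumV {suc j} V t = boolV (flag V t)

  treeEnc : ∀ {j S} → View j → (Tree S → Val) → (S → Val) → (S → Val) → Tree S → Val
  treeEnc V sm x y empty      = nil
  treeEnc V sm x y (leaf e)   = cell nil (item V e)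
  treeEnc V sm x y t@(node _ _ _ s f L R X Y) =
    treeNode (item V s) (items V f) (sm t) (treeEnc V sm x y L) (treeEnc V sm x y R) (x X) (y Y)

  enc : ∀ {j} → ViewOf j → St j → Val
  enc {zero}  _ _ = nil
  enc {suc j} V t = treeEnc V (sumV V) (enc (subview left V)) (enc (subview right V)) t

  -- Procedures that inspect or make a single node

  commutativeRing : CommutativeRing _ _
  commutativeRing = record { isCommutativeRing = CompleteOrderedField.isCommutativeRing ℝ }

  module ℝᶜ = CommutativeRing commutativeRing
  module ℝₚ = RingProperties ℝᶜ.ring

  -- Sides are stored as 0 and 1 and told apart by comparisons, so branching on them rests on 0 < 1.
  -- If 1 ≤ 0, then 0 ≤ -1, and 1 is the nonnegative product of -1 with itself.
  0≤1 : 0# ≤ᴿ 1#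
  0≤1 with ≤ᴿ-total 0# 1#
  ... | inj₁ h = h
  ... | inj₂ h = subst (0# ≤ᴿ_) (trans (sym (ℝₚ.-‿distribˡ-* 1# (ℝᶜ.- 1#)))
      (trans (cong ℝᶜ.-_ (ℝᶜ.*-identityˡ (ℝᶜ.- 1#))) (ℝₚ.-‿involutive 1#)))
    (*ᴿ-nonNeg 0≤-1 0≤-1)
    where
    0≤-1 : 0# ≤ᴿ ℝᶜ.- 1#
    0≤-1 = subst₂ _≤ᴿ_ (ℝᶜ.-‿inverseʳ 1#) (ℝᶜ.+-identityˡ (ℝᶜ.- 1#))
      (+ᴿ-monoˡ-≤ (ℝᶜ.- 1#) h)

  1≰0 : ¬ 1# ≤ᴿ 0#
  1≰0 h = CompleteOrderedField.0≢1 ℝ (≤ᴿ-antisym 0≤1 h)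

  rCaseDone : (xs : Vec Carrier 0) → ∀ {n} {ρ : Vec Val n} {i e₁ e₂ e₃ v t} → lookup ρ i ≡ reals (Vec.toList xs) →
              Run ρ e₁ v t → Run ρ (case i e₁ e₂ e₃) v (suc t)
  rCaseDone [] = rCaseNil

  rCaseMore : ∀ {j} (xs : Vec Carrier (suc j)) {n} {ρ : Vec Val n} {i e₁ e₂ e₃ v t} → lookup ρ i ≡ reals (Vec.toList xs) →
              Run (real (Vec.head xs) ∷ reals (Vec.toList (Vec.tail xs)) ∷ ρ) e₃ v t →
              Run ρ (case i e₁ e₂ e₃) v (suc t)
  rCaseMore (_ ∷ _) = rCaseCell

  optMin-run : ∀ a b → Run (maybeV a ∷ maybeV b ∷ []) (functions optMinᶠ) (maybeV (minOf a b)) 4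
  optMin-run nothing  b       = rCaseNil refl rVar within m≤m+n 2 2
  optMin-run (just x) nothing = rCaseReal refl (rCaseNil refl rVar) within n≤1+n 3
  optMin-run (just x) (just y) with x ≤ᴿ? y
  ... | yes h = rCaseReal refl (rCaseReal refl (rThen refl refl h rVar))
  ... | no  h = rCaseReal refl (rCaseReal refl (rElse refl refl h rVar))

  test-run : ∀ a b → Run (maybeV a ∷ maybeV b ∷ []) (functions testᶠ) (boolV (within? a b)) 8
  test-run nothing  b       = rCaseNil refl rNil within m≤m+n 2 6
  test-run (just x) nothing = rCaseReal refl (rCaseNil refl rNil) within m≤m+n 3 5
  test-run (just x) (just y) with x +ᴿ y ≤ᴿ? 0#
  ... | yes h = rCaseReal refl (rCaseReal refl (rLet (rAdd refl refl) (rLet rZero (rThen refl refl h rZero))))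
  ... | no  h = rCaseReal refl (rCaseReal refl (rLet (rAdd refl refl) (rLet rZero (rElse refl refl h rNil))))

  or-run : ∀ a b → Run (boolV a ∷ boolV b ∷ []) (functions orᶠ) (boolV (a ∨ b)) 2
  or-run false b = rCaseNil refl rVar
  or-run true  b = rCaseReal refl rVar

  minimum-run : ∀ σ (V : View 0) (t : St 1) →
    Run (real (sideᴿ σ) ∷ enc V t ∷ []) (functions minimumᶠ) (maybeV (minimum σ V t)) 11
  minimum-run σ V empty = rTreeEmpty refl rNil within m≤m+n 2 9
  minimum-run σ V (leaf e) = rTreeLeaf refl (rCaseCell refl (rCaseCell refl (rCaseCell refl (pick σ (sideOf e)))))
    within m≤m+n 8 3
    where
    pick : ∀ σ s {v₁ v₃ v₄ v₅ v₆ v₇ v₉} →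
      Run (real (sideᴿ s) ∷ v₁ ∷ real (acc V e) ∷ v₃ ∷ v₄ ∷ v₅ ∷ v₆ ∷ v₇ ∷ real (sideᴿ σ) ∷ v₉ ∷ [])
      (ifLeq 0F 8F (ifLeq 8F 0F (var 2F) nil) nil) (maybeV (select σ s (acc V e))) 3
    pick inA inA = rThen refl refl ≤ᴿ-refl (rThen refl refl ≤ᴿ-refl rVar)
    pick inA inB = rElse refl refl 1≰0 rNil within n≤1+n 2
    pick inB inA = rThen refl refl 0≤1 (rElse refl refl 1≰0 rNil)
    pick inB inB = rThen refl refl ≤ᴿ-refl (rThen refl refl ≤ᴿ-refl rVar)
  minimum-run inA V (node w n q s f L R X Y) =
    rTreeNode refl (rCaseCell refl (rLet rZero (rThen refl refl ≤ᴿ-refl rVar)))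
  minimum-run inB V (node w n q s f L R X Y) =
    rTreeNode refl (rCaseCell refl (rLet rZero (rElse refl refl 1≰0 rVar)))

  flag-run : ∀ {j} (V : View j) (t : St (suc j)) →
             Run (enc {suc j} V t ∷ []) (functions flagᶠ) (boolV (flag {suc j} V t)) 16
  flag-run {zero} V empty = rTreeEmpty refl rNil within m≤m+n 2 14
  flag-run {zero} V (leaf e) = rTreeLeaf refl rNil within m≤m+n 3 13
  flag-run {zero} V t@(node _ _ _ _ _ _ _ _ _) =
    rTreeNode refl (rCaseCell refl (rCall (test-run (minimum inA V t) (minimum inB V t))))
  flag-run {suc j} V empty = rTreeEmpty refl rNil within m≤m+n 2 14
  flag-run {suc j} V (leaf e) = rTreeLeaf refl rNil within m≤m+n 3 13
  flag-run {suc j} V t@(node _ _ _ _ _ _ _ _ _) =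
    rTreeNode refl (copy (flag {suc (suc j)} V t) refl) within m≤m+n 8 8
    where
    copy : ∀ b {n} {ρ : Vec Val n} {i e} → lookup ρ i ≡ boolV b →
           Run ρ (case i nil (var i) e) (boolV b) 2
    copy false p = rCaseNil p rNil
    copy true  p = rCaseReal p (rCast p rVar)

  Secondaries : ∀ {j} → View j → St j → St j → Val
  Secondaries V X Y = cell (enc (subview left V) X) (enc (subview right V) Y)

  nodeCost : ℕ
  nodeCost = 131

  summary-run : ∀ {j} (V : View j) w n q s f (L R : St (suc j)) (X Y : St j) →
    Run (item V s ∷ enc V L ∷ enc V R ∷ Secondaries V X Y ∷ []) (functions summaryᶠ)
        (sumV V (node w n q s f L R X Y)) 120
  summary-run {zero} V w n q s f L R X Y with rem V s
  ... | [] = rCaseCell refl (rCaseNil refl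
    (rLet rZero (rLet (rCall (minimum-run inA V L)) (rLet (rCall (minimum-run inA V R))
      (rLet (rCall (optMin-run (minimum inA V L) (minimum inA V R)))
    (rLet rOne (rLet (rCall (minimum-run inB V L)) (rLet (rCall (minimum-run inB V R))
      (rLet (rCall (optMin-run (minimum inB V L) (minimum inB V R))) rCons)))))))))
    within ≤ᵇ⇒≤ _ _ tt
  summary-run {suc j} V w n q s f L R X Y with rem V s
  ... | x ∷ _ = rCaseCell refl (rCaseCell refl
    (rLet (rCall (flag-run {suc j} V L)) (rLet (rCall (flag-run {suc j} V R))
    (rLet (rCall (or-run (flag V L) (flag V R)))
    (rCaseCell refl (rLet (rCall (flag-run {j} (subview left V) X)) (rLet (rCall (flag-run {j} (subview right V) Y))
    (rLet (rCall (or-run (flag (subview left V) X) (flag (subview right V) Y)))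
      (rCall (or-run (flag V L ∨ flag V R) (flag (subview left V) X ∨ flag (subview right V) Y)))))))))))
    within ≤ᵇ⇒≤ _ _ tt

  node-run : ∀ {j} (V : View j) w n q s f (L R : St (suc j)) (X Y : St j) →
    Run (item V s ∷ items V f ∷ enc V L ∷ enc V R ∷ Secondaries V X Y ∷ [])
        (functions nodeᶠ) (enc {suc j} V (node w n q s f L R X Y)) nodeCost
  node-run V w n q s f L R X Y =
    rLet (rCall (summary-run V w n q s f L R X Y))
      (rLet rCons (rLet rCons (rLet rCons (rLet rCons rCons))))

  -- The program chooses the sign by the child alone, subtracting on the left and adding on the
  -- right. As `dirOf` is an involution, this is the sign that the view of the receiving structure
  -- prescribes.
  advance-run : ∀ {j} (V : View (suc j)) δ e →
    Run (dirV δ ∷ item V e ∷ []) (functions advanceᶠ)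
        (item (subview {suc j} (dirOf δ (sideOf e)) V) e) 9
  advance-run V δ e rewrite dirOf-involutive δ (sideOf e) with rem V e
  ... | x ∷ xs = rCaseCell refl (rCaseCell refl (rCaseCell refl
    (rLet (move δ) (rLet rCons rCons))))
    where
    move : ∀ δ {v₁ v₃ v₄ v₅ v₇} → Run (real (acc V e) ∷ v₁ ∷ real x ∷ v₃ ∷ v₄ ∷ v₅ ∷ dirV δ ∷ v₇ ∷ [])
      (case 6F (arith sub 0F 2F) (arith add 0F 2F) nil) (real (shift δ (acc V e) x)) 2
    move left  = rCaseNil refl (rSub refl refl)
    move right = rCaseReal refl (rAdd refl refl)

  target-run : ∀ {j} (V : View j) δ e →
    Run (dirV δ ∷ item V e ∷ []) (functions targetᶠ) (dirV (dirOf δ (sideOf e))) 8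
  target-run V δ e@(s , p) = rCaseCell refl (rCaseCell refl (rCaseCell refl (pick δ s)))
    where
    pick : ∀ δ s {v₁ v₂ v₃ v₄ v₅ v₇} →
      Run (real (sideᴿ s) ∷ v₁ ∷ v₂ ∷ v₃ ∷ v₄ ∷ v₅ ∷ dirV δ ∷ v₇ ∷ [])
      (case 6F (letIn zeroᴿ (ifLeq 1F 0F nil zeroᴿ)) (letIn zeroᴿ (ifLeq 1F 0F zeroᴿ nil)) nil)
      (dirV (dirOf δ s)) 5
    pick left  inA = rCaseNil refl (rLet rZero (rThen refl refl ≤ᴿ-refl rNil))
    pick left  inB = rCaseNil refl (rLet rZero (rElse refl refl 1≰0 rZero))
    pick right inA = rCaseReal refl (rLet rZero (rThen refl refl ≤ᴿ-refl rZero))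
    pick right inB = rCaseReal refl (rLet rZero (rElse refl refl 1≰0 rNil))

  flat-run : ∀ {j} (V : View j) (t : St (suc j)) es →
    Run (enc {suc j} V t ∷ items V es ∷ []) (functions flatᶠ) (items V (elems t ++ es))
        (treeSize t * 12)
  flat-run V empty    es = rTreeEmpty refl rVar within m≤m+n 2 10
  flat-run V (leaf e) es = rTreeLeaf refl rCons within m≤m+n 3 9
  flat-run V (node w n q s f L R X Y) es =
    rTreeNode refl (rLet (rCall (flat-run V R es)) (rCast (cong (items V) (sym (++-assoc (elems L) (elems R) es)))
      (rCall (flat-run V L (elems R ++ es)))))
    within poly 2 (λ l r → con 8 :+ (r :* con 12 :+ (con 1 :+ l :* con 12))
                        :≤ (con 1 :+ (l :+ r)) :* con 12) (treeSize L ∷ treeSize R ∷ [])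

  -- Prices, potential and the invariant

  β W u : ℕ → ℕ → ℕ

  -- Building a structure of level j from n elements, n + 3 ≤ 2 ^ ℓ, takes time
  -- at most (n + 1) * β j ℓ.
  β zero    ℓ = 0
  β (suc j) ℓ = suc ℓ * (sortCost + (2 * β j ℓ + 200)) + 11

  -- The price of rebuilding a tree, per element and per update since its root
  -- was built, respectively.
  rebuildCost : ℕ → ℕ → ℕ
  rebuildCost j ℓ = stepCost + 60 + suc ℓ * (2 * β j ℓ + 200)

  W j ℓ = 10 * rebuildCost j ℓ

  -- The price of one node on the path of an update: a comparison, a constant amount of work, an
  -- update of one secondary structure, and the growth of the potential. The last summand is taken
  -- at `3 + ℓ` because the exponent stored at birth may exceed the present one by 3.
  levelCost : ℕ → ℕ → ℕ

  -- The amortised time of an update.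
  u zero    ℓ = 0
  u (suc j) ℓ = (3 * ℓ + 4) * levelCost j ℓ

  levelCost j ℓ = compareCost + 300 + u j ℓ + W j (3 + ℓ)

  pot : ∀ {j} → St j → ℕ
  pot {zero}  _ = 0
  pot {suc j} t = treePot (W j) pot t

  -- Each update turns a unit of the fuel `f` into one of `q`, so `q + f` remains ⌊n/8⌋. It changes
  -- the count of one child by at most one, so the counts `l` and `r` stay within about `q` of n/2.
  -- All bounds refer to the number `n` at birth, which does not move between two rebuildings.
  record Shape (w n q f l r bl br : ℕ) : Set where
    field
      2≤n    : 2 ≤ n
      fuel≤  : 8 * (q + f) ≤ n
      fuel≥  : n ≤ 8 * (q + f) + 7
      left≥  : n ≤ 2 * l + 1 + 2 * q
      left≤  : 2 * l ≤ n + 1 + 2 * q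
      right≥ : n ≤ 2 * r + 1 + 2 * q
      right≤ : 2 * r ≤ n + 1 + 2 * q
      birthˡ : 4 * bl ≤ 3 * n
      birthʳ : 4 * br ≤ 3 * n
      log≥   : 2 * n + 5 ≤ 2 ^ w
      log≤   : 2 ^ w ≤ 2 * (2 * n + 5)

  -- The elements of the secondary structure of direction c.
  Joined : Dir → List Elem → List Elem → Elem → Set
  Joined c l r e = (e ∈ l × dirOf left (sideOf e) ≡ c) ⊎ (e ∈ r × dirOf right (sideOf e) ≡ c)

  Represents : ∀ {j} → St j → (Elem → Set) → Set
  Represents {zero}  _ P = ⊤
  Represents {suc j} t P = ∀ e → e ∈ elems t ⇔ P e

  data TreeGood {j S} (V : View j) (GX GY : S → Set) (Rep : S → (Elem → Set) → Set) : Tree S → Set where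
    empty : TreeGood V GX GY Rep empty
    leaf  : ∀ {e} → TreeGood V GX GY Rep (leaf e)
    node  : ∀ {w n q s f L R X Y} →
            TreeGood V GX GY Rep L → TreeGood V GX GY Rep R → GX X → GY Y →
            (∀ {e} → e ∈ elems L → e ≺[ V ] s) → (∀ {e} → e ∈ elems R → ¬ e ≺[ V ] s) →
            Rep X (Joined left (elems L) (elems R)) → Rep Y (Joined right (elems L) (elems R)) →
            Shape w n q (length f) (count L) (count R) (birth L) (birth R) →
            TreeGood V GX GY Rep (node w n q s f L R X Y)

  Good : ∀ {j} → ViewOf j → St j → Set
  Good {zero}  _ _ = ⊤
  Good {suc j} V t = TreeGood V (Good (subview left V)) (Good (subview right V)) Represents t

  -- Building

  log-exists : ∀ m → 1 ≤ m → ∃[ w ] m ≤ 2 ^ w × 2 ^ w ≤ 2 * m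
  log-exists (suc zero)    _ = 0 , ≤-refl , s≤s z≤n
  log-exists (suc m@(suc _)) _ with log-exists m (s≤s z≤n)
  ... | w , lo , hi with suc m ≤? 2 ^ w
  ...   | yes h = w , h , ≤-trans hi (*-monoʳ-≤ 2 (n≤1+n m))
  ...   | no  h = suc w ,
    ≤-trans (s≤s lo) (≤-trans (+-monoˡ-≤ (2 ^ w) (m^n>0 2 w)) (+-monoʳ-≤ (2 ^ w) (m≤m+n (2 ^ w) 0))) ,
    *-monoʳ-≤ 2 (<⇒≤ (≰⇒> h))

  allPairs-++⁻ : ∀ {A : Set} {_~_ : A → A → Set} xs {ys} → AllPairs _~_ (xs ++ ys) →
                 AllPairs _~_ xs × AllPairs _~_ ys × (∀ {x y} → x ∈ xs → y ∈ ys → x ~ y)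
  allPairs-++⁻ []       ps       = [] , ps , λ ()
  allPairs-++⁻ (x ∷ xs) (p ∷ ps) = let pˡ , pʳ , pˡʳ = allPairs-++⁻ xs ps in
    All.tabulate (λ h → All.lookup p (∈-++⁺ˡ h)) ∷ pˡ , pʳ ,
    λ { (here refl) h′ → All.lookup p (∈-++⁺ʳ xs h′) ; (there h) h′ → pˡʳ h h′ }

  Routed : Dir → Dir → List Elem → List Elem → List Elem → Set
  Routed δ c xs Zs Zs′ = ∀ e → e ∈ Zs′ ⇔ ((e ∈ xs × dirOf δ (sideOf e) ≡ c) ⊎ e ∈ Zs)

  -- The equation between the lengths carries the cost analysis: the two secondary structures of a
  -- node have together as many elements as the node, so building them is paid once per element.
  SplitRun : ∀ {j} → View (suc j) → Dir → List Elem → List Elem → List Elem → Set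
  SplitRun {j} V δ xs Xs Ys = ∃[ Xs′ ] ∃[ Ys′ ] Routed δ left xs Xs Xs′ × Routed δ right xs Ys Ys′ ×
    length Xs′ + length Ys′ ≡ length xs + (length Xs + length Ys) ×
    Run (dirV δ ∷ items V xs ∷ cell (items (subview {suc j} left V) Xs) (items (subview {suc j} right V) Ys) ∷ [])
        (functions splitᶠ)
        (cell (items (subview {suc j} left V) Xs′) (items (subview {suc j} right V) Ys′))
        (length xs * 30 + 2)

  split-run : ∀ {j} (V : View (suc j)) δ xs Xs Ys → SplitRun V δ xs Xs Ys
  split-run V δ [] Xs Ys = Xs , Ys , (λ e → mk⇔ inj₂ λ { (inj₂ h) → h ; (inj₁ ()) }) ,
    (λ e → mk⇔ inj₂ λ { (inj₂ h) → h ; (inj₁ ()) }) , refl , rCaseNil refl rVar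
  split-run {j} V δ (x ∷ xs) Xs Ys =
    let Xs′ , Ys′ , mx , my , len , D = split-run V δ xs Xs Ys
    in extend (Xs′ , Ys′ , mx , my , len , D) _ refl (advance-run {j} V δ x) (target-run V δ x)
    where

    skip : ∀ {c c′ zs Zs Zs′} → dirOf δ (sideOf x) ≡ c → c ≢ c′ →
           Routed δ c′ zs Zs Zs′ → Routed δ c′ (x ∷ zs) Zs Zs′
    skip p c≢ m e = mk⇔ (λ h → [ (λ { (h , q) → inj₁ (there h , q) }) , inj₂ ]′ (to (m e) h))
      λ { (inj₁ (here refl , q)) → ⊥-elim (c≢ (trans (sym p) q))
        ; (inj₁ (there h , q)) → from (m e) (inj₁ (h , q)) ; (inj₂ h) → from (m e) (inj₂ h) }

    take : ∀ {c zs Zs Zs′} → dirOf δ (sideOf x) ≡ c →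
           Routed δ c zs Zs Zs′ → Routed δ c (x ∷ zs) Zs (x ∷ Zs′)
    take p m e = mk⇔
      (λ { (here refl) → inj₁ (here refl , p)
         ; (there h) → [ (λ { (h , q) → inj₁ (there h , q) }) , inj₂ ]′ (to (m e) h) })
      λ { (inj₁ (here refl , q)) → here refl
        ; (inj₁ (there h , q)) → there (from (m e) (inj₁ (h , q)))
        ; (inj₂ h) → there (from (m e) (inj₂ h)) }

    cost : 1 + (2 + (length xs * 30 + 2) + (2 + (9) + (2 + (8) + (2 + (3)))))
           ≤ length (x ∷ xs) * 30 + 2
    cost = poly 1 (λ n → con 3 :+ (n :+ con 2 :+ con 26) :≤ con 30 :+ n :+ con 2)
             (length xs * 30 ∷ [])

    extend : SplitRun V δ xs Xs Ys → ∀ c → dirOf δ (sideOf x) ≡ c →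
      Run (dirV δ ∷ item V x ∷ []) (functions advanceᶠ)
          (item (subview {suc j} (dirOf δ (sideOf x)) V) x) 9 →
      Run (dirV δ ∷ item V x ∷ []) (functions targetᶠ) (dirV (dirOf δ (sideOf x))) 8 →
      SplitRun V δ (x ∷ xs) Xs Ys
    extend (Xs′ , Ys′ , mx , my , len , D) left p A T = x ∷ Xs′ , Ys′ , take p mx , skip p (λ ()) my , cong suc len ,
      (rCaseCell refl (rLet (rCall D) (rLet (rCall (rCast (cong (λ c → item (subview {suc j} c V) x) p) A))
        (rLet (rCall (rCast (cong dirV p) T)) (rCaseCell refl (rCaseNil refl (rLet rCons rCons)))))) within cost)
    extend (Xs′ , Ys′ , mx , my , len , D) right p A T = Xs′ , x ∷ Ys′ , skip p (λ ()) mx , take p my ,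
      trans (+-suc (length Xs′) (length Ys′)) (cong suc len) ,
      (rCaseCell refl (rLet (rCall D) (rLet (rCall (rCast (cong (λ c → item (subview {suc j} c V) x) p) A))
        (rLet (rCall (rCast (cong dirV p) T)) (rCaseCell refl (rCaseReal refl (rLet rCons rCons)))))) within cost)

  -- `1 ≤ length r` holds at every node and supplies the item from which the program reads the
  -- level.
  SecondariesRun : ℕ → ℕ → Set
  SecondariesRun j ℓ = (V : View j) (l r : List Elem) → 1 ≤ length r → length l + length r + 3 ≤ 2 ^ ℓ →
    ∃[ X ] ∃[ Y ] Good (subview left V) X × Good (subview right V) Y ×
    Represents X (Joined left l r) × Represents Y (Joined right l r) ×
    pot X ≡ 0 × pot Y ≡ 0 ×
    Run (items V l ∷ items V r ∷ []) (functions secondariesᶠ) (Secondaries V X Y)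
        ((length l + length r + 2) * (β j ℓ + 30))

  BuildRun : ℕ → ℕ → Set
  BuildRun j ℓ = (V : View j) (xs : List Elem) → length xs + 3 ≤ 2 ^ ℓ →
    Σ[ t ∈ St (suc j) ] Good V t × (∀ e → e ∈ elems t ⇔ e ∈ xs) × pot t ≡ 0 ×
    Run (items V xs ∷ []) (functions buildᶠ) (enc {suc j} V t) ((length xs + 1) * β (suc j) ℓ)

  -- `h` bounds the depth and decreases in the recursion, whereas `ℓ` is fixed by the whole input,
  -- which gives one price `β j ℓ` for the secondary structures of all nodes.
  BalanceRun : ℕ → ℕ → Set
  BalanceRun j ℓ = (V : View j) (h : ℕ) (xs : List Elem) → Sorted V xs → length xs ≤ 2 ^ h → length xs + 3 ≤ 2 ^ ℓ →
    Σ[ t ∈ St (suc j) ] Good V t × elems t ≡ xs × pot t ≡ 0 × birth t ≡ length xs ⊔ 1 ×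
    Run (items V xs ∷ []) (functions balanceᶠ) (enc {suc j} V t)
        (suc h * (length xs * (2 * β j ℓ + 200)) + 5)

  -- The halving bounds for n, l and f₁, added with weights 1, 2 and 4, place `8 * f₂` between n - 7
  -- and n.
  balanced-shape : ∀ {n l r f₁ f₂ bl br} → n ≡ l + r → 2 ≤ n → 2 * l ≤ n → n ≤ 2 * l + 1 →
    2 * f₁ ≤ l → l ≤ 2 * f₁ + 1 → 2 * f₂ ≤ f₁ → f₁ ≤ 2 * f₂ + 1 →
    bl ≡ l ⊔ 1 → br ≡ r ⊔ 1 → ∃[ w ] Shape w n 0 f₂ l r bl br
  balanced-shape {n} {l} {r} {f₁} {f₂} n≡ 2≤n lo hi lo₁ hi₁ lo₂ hi₂ bl≡ br≡ =
    let w , w≥ , w≤ = log-exists (2 * n + 5) (≤-trans (s≤s z≤n) (m≤n+m 5 (2 * n)))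
    in w , record
      { 2≤n = 2≤n
      ; fuel≤ = cancel (+-mono-≤ (+-mono-≤ (*-monoʳ-≤ 4 lo₂) (*-monoʳ-≤ 2 lo₁)) lo)
          (poly 4 (λ n l f g → con 8 :* (con 0 :+ g) :+ (con 4 :* f :+ con 2 :* l :+ n) :≤
            n :+ (con 4 :* (con 2 :* g) :+ con 2 :* (con 2 :* f) :+ con 2 :* l)) (n ∷ l ∷ f₁ ∷ f₂ ∷ []))
      ; fuel≥ = cancel (+-mono-≤ (+-mono-≤ (*-monoʳ-≤ 4 hi₂) (*-monoʳ-≤ 2 hi₁)) hi)
          (poly 4 (λ n l f g → n :+ (con 4 :* (con 2 :* g :+ con 1) :+ con 2 :* (con 2 :* f :+ con 1) :+ (con 2 :* l :+ con 1)) :≤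
            con 8 :* (con 0 :+ g) :+ con 7 :+ (con 4 :* f :+ con 2 :* l :+ n)) (n ∷ l ∷ f₁ ∷ f₂ ∷ []))
      ; left≥ = ≤-trans hi (m≤m+n _ _)
      ; left≤ = ≤-trans lo (≤-trans (m≤m+n n 1) (m≤m+n _ _))
      ; right≥ = ≤-trans n≤2r (≤-trans (m≤m+n _ 1) (m≤m+n _ _))
      ; right≤ = ≤-trans 2r≤ (m≤m+n _ _)
      ; birthˡ = subst (λ b → 4 * b ≤ 3 * n) (sym (trans bl≡ (m≥n⇒m⊔n≡m 1≤l)))
          (cancel (+-mono-≤ (*-monoʳ-≤ 2 lo) z≤n)
            (poly 2 (λ n l → con 4 :* l :+ (con 2 :* n :+ n)
              :≤ con 3 :* n :+ (con 2 :* (con 2 :* l) :+ con 0)) (n ∷ l ∷ [])))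
      ; birthʳ = subst (λ b → 4 * b ≤ 3 * n) (sym (trans br≡ (m≥n⇒m⊔n≡m 1≤r)))
          (cancel (+-mono-≤ (*-monoʳ-≤ 2 2r≤) 2≤n)
            (poly 2 (λ n r → con 4 :* r :+ (con 2 :* (n :+ con 1) :+ n)
              :≤ con 3 :* n :+ (con 2 :* (con 2 :* r) :+ con 2)) (n ∷ r ∷ [])))
      ; log≥ = w≥
      ; log≤ = w≤
      }
    where
    l+r≤n : l + r ≤ n
    l+r≤n = ≤-reflexive (sym n≡)

    n≤l+r : n ≤ l + r
    n≤l+r = ≤-reflexive n≡

    n≤2r : n ≤ 2 * r
    n≤2r = cancel (+-mono-≤ (*-monoʳ-≤ 2 n≤l+r) lo)
      (poly 3 (λ n l r → n :+ (con 2 :* (l :+ r) :+ n) :≤ con 2 :* r :+ (con 2 :* n :+ con 2 :* l)) (n ∷ l ∷ r ∷ []))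

    2r≤ : 2 * r ≤ n + 1
    2r≤ = cancel (+-mono-≤ (*-monoʳ-≤ 2 l+r≤n) hi)
      (poly 3 (λ n l r → con 2 :* r :+ (con 2 :* n :+ (con 2 :* l :+ con 1))
        :≤ n :+ con 1 :+ (con 2 :* (l :+ r) :+ n)) (n ∷ l ∷ r ∷ []))

    positive : ∀ {m} → 2 ≤ 2 * m + 1 → 1 ≤ m
    positive {zero}  (s≤s ())
    positive {suc _} _ = s≤s z≤n

    1≤l : 1 ≤ l
    1≤l = positive (≤-trans 2≤n hi)

    1≤r : 1 ≤ r
    1≤r = positive (≤-trans 2≤n (≤-trans n≤2r (m≤m+n _ 1)))

  -- The secondary structures cost `(n + 2) * b`, which is at most `2 * n * b` since `2 ≤ n`; this
  -- is the origin of the factor 2 in `β`.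
  balance-cost : ∀ b h n l r m → n ≡ l + r → 2 ≤ n → m ≤ n →
    4 + (n * 5 + 5 + (3 + (l * 5 + 5 + (3 + (m * 5 + 5 + (3 + (suc h * (l * (2 * b + 200)) + 5 +
      (2 + (suc h * (r * (2 * b + 200)) + 5 + (2 + ((l + r + 2) * (b + 30) + (2 + nodeCost))))))))))))
    ≤ suc (suc h) * (n * (2 * b + 200)) + 5
  balance-cost b h n l r m refl 2≤n m≤ =
    cancel (+-mono-≤ (+-mono-≤ (*-monoˡ-≤ b 2≤n) (*-monoʳ-≤ 120 2≤n)) (*-monoʳ-≤ 5 m≤))
    (poly 5 (λ b h l r m →
      con 4 :+ ((l :+ r) :* con 5 :+ con 5 :+ (con 3 :+ (l :* con 5 :+ con 5 :+ (con 3 :+ (m :* con 5 :+ con 5 :+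
        (con 3 :+ ((con 1 :+ h) :* (l :* (con 2 :* b :+ con 200)) :+ con 5 :+
          (con 2 :+ ((con 1 :+ h) :* (r :* (con 2 :* b :+ con 200)) :+ con 5 :+
            (con 2 :+ ((l :+ r :+ con 2) :* (b :+ con 30) :+ (con 2 :+ con 131))))))))))))
      :+ ((l :+ r) :* b :+ con 120 :* (l :+ r) :+ con 5 :* (l :+ r))
      :≤ (con 2 :+ h) :* ((l :+ r) :* (con 2 :* b :+ con 200)) :+ con 5 :+
        (con 2 :* b :+ con 120 :* con 2 :+ con 5 :* m))
      (b ∷ h ∷ l ∷ r ∷ m ∷ []))

  module _ {j : ℕ} {V : View j} where

    ≺-asym : ∀ {e f} → e ≺[ V ] f → ¬ f ≺[ V ] e
    ≺-asym p q = <ₗₑₓ-irrefl (<ₗₑₓ-trans p q)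

  balance-run : ∀ {j ℓ} → SecondariesRun j ℓ → BalanceRun j ℓ
  balance-run sec V h [] _ _ _ = empty , empty , refl , refl , refl ,
    (rCaseNil refl rNil within ≤-trans (m≤n+m 2 3) (m≤n+m 5 (suc h * 0)))
  balance-run {j} {ℓ} sec V h (x ∷ []) _ _ _ = leaf x , leaf , refl , refl , refl ,
    (rCaseCell refl (rCaseNil refl (rLet rNil rCons)) within m≤n+m 5 (suc h * (1 * (2 * β j ℓ + 200))))
  balance-run sec V zero (_ ∷ _ ∷ _) _ (s≤s ()) _
  balance-run {j} {ℓ} sec V (suc h) xs@(_ ∷ _ ∷ _) sorted n≤ nℓ =
    let l , r , xs≡ , lo , hi , D = half-run V xs xs ≤-refl
    in halves l r xs≡ lo hi D
    where
    halves : ∀ l r → xs ≡ l ++ r → 2 * length l ≤ length xs → length xs ≤ 2 * length l + 1 →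
      Run (items V xs ∷ items V xs ∷ []) (functions halfᶠ) (cell (items V l) (items V r)) (length xs * 5 + 5) →
      Σ[ t ∈ St (suc j) ] Good V t × elems t ≡ xs × pot t ≡ 0 × birth t ≡ length xs ⊔ 1 ×
      Run (items V xs ∷ []) (functions balanceᶠ) (enc {suc j} V t)
          (suc (suc h) * (length xs * (2 * β j ℓ + 200)) + 5)
    halves l [] xs≡ lo hi D = ⊥-elim (1+n≰n {0}
      (cancel (+-mono-≤ (subst (2 * length l ≤_) len lo) (subst (2 ≤_) len (s≤s (s≤s z≤n))))
        (poly 1 (λ l → con 1 :+ (l :+ l) :≤ con 0 :+ (con 2 :* l :+ con 2)) (length l ∷ []))))
      where
      len : length xs ≡ length l
      len = trans (cong length xs≡) (trans (length-++ l) (+-identityʳ _))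
    halves l r@(s ∷ r′) xs≡ lo hi D =
      let n≡ = trans (cong length xs≡) (length-++ l)
          f₁ , _ , _ , lo₁ , hi₁ , D₁ = half-run V l l ≤-refl
          f₂ , _ , _ , lo₂ , hi₂ , D₂ = half-run V f₁ f₁ ≤-refl
          sl , sr , l≺r = allPairs-++⁻ l (subst (Sorted V) xs≡ sorted)
          l≤ , r≤ = half-≤ h n≡ lo hi n≤
          L , GL , l≡ , pL , bL , DL = balance-run sec V h l sl l≤
            (fits (≤-trans (m≤m+n (length l) (length r)) (≤-reflexive (sym n≡))))
          R , GR , r≡ , pR , bR , DR = balance-run sec V h r sr r≤
            (fits (≤-trans (m≤n+m (length r) (length l)) (≤-reflexive (sym n≡))))
          X , Y , GX , GY , RX , RY , pX , pY , DS = sec V l r (s≤s z≤n) (fits (≤-reflexive (sym n≡)))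
          w , shape = balanced-shape n≡ (s≤s (s≤s z≤n)) lo hi lo₁ hi₁ lo₂ hi₂ bL bR
      in node w (length xs) 0 s f₂ L R X Y ,
      node GL GR GX GY
        (λ h → l≺r (subst (_ ∈_) l≡ h) (here refl))
        (λ h → s⊀ sr (subst (_ ∈_) r≡ h))
        (subst₂ (λ l r → Represents X (Joined left l r)) (sym l≡) (sym r≡) RX)
        (subst₂ (λ l r → Represents Y (Joined right l r)) (sym l≡) (sym r≡) RY)
        (subst₂ (λ l r → Shape w (length xs) 0 (length f₂) (length l) (length r) (birth L) (birth R)) (sym l≡) (sym r≡) shape) ,
      trans (cong₂ _++_ l≡ r≡) (sym xs≡) ,
      cong₂ _+_ (cong₂ _+_ pL pR) (cong₂ _+_ pX pY) ,
      sym (m≥n⇒m⊔n≡m (s≤s z≤n)) ,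
      (rCaseCell refl (rCaseCell refl (rLet (rCall D) (rCaseCell refl
        (rLet (rCall D₁) (rCaseCell refl (rLet (rCall D₂) (rCaseCell refl
        (rLet (rCall DL) (rLet (rCall DR) (rLet (rCall DS) (rCaseCell refl
        (rCall (node-run V w (length xs) 0 s f₂ L R X Y))))))))))))) within
        balance-cost (β j ℓ) h (length xs) (length l) (length r) (length f₁) n≡ (s≤s (s≤s z≤n))
          (≤-trans (m≤m+n _ _) (≤-trans lo₁ (≤-trans (m≤m+n _ _) lo))))
      where
      s⊀ : Sorted V r → ∀ {e} → e ∈ r → ¬ e ≺[ V ] s
      s⊀ _        (here refl) = <ₗₑₓ-irrefl
      s⊀ (s≺ ∷ _) (there h)   = ≺-asym {V = V} (All.lookup s≺ h)

      fits : ∀ {m} → m ≤ length xs → m + 3 ≤ 2 ^ ℓ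
      fits m≤ = ≤-trans (+-monoˡ-≤ 3 m≤) nℓ

  build-cost : ∀ s g ℓ n m → m ≤ n →
    2 + (suc ℓ * (n * s) + 3 + (1 + (suc ℓ * (m * g) + 5))) ≤ (n + 1) * (suc ℓ * (s + g) + 11)
  build-cost s g ℓ n m m≤ = cancel (*-monoˡ-≤ (suc ℓ * g) m≤)
    (poly 5 (λ s g ℓ n m →
      con 2 :+ ((con 1 :+ ℓ) :* (n :* s) :+ con 3 :+
        (con 1 :+ ((con 1 :+ ℓ) :* (m :* g) :+ con 5))) :+ n :* ((con 1 :+ ℓ) :* g)
      :≤ (n :+ con 1) :* ((con 1 :+ ℓ) :* (s :+ g) :+ con 11) :+ m :* ((con 1 :+ ℓ) :* g))
      (s ∷ g ∷ ℓ ∷ n ∷ m ∷ []))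

  build-run : ∀ {j ℓ} → SecondariesRun j ℓ → BuildRun j ℓ
  build-run {j} {ℓ} sec V xs nℓ =
    let ys , sy , my , ly , Dy = sort-run V ℓ xs (m+n≤o⇒m≤o _ nℓ)
        yℓ = ≤-trans (+-monoˡ-≤ 3 ly) nℓ
        t , G , t≡ , p , _ , Dt = balance-run sec V ℓ ys sy (m+n≤o⇒m≤o _ yℓ) yℓ
    in t , G ,
       (λ e → mk⇔ (λ h → to (my e) (subst (e ∈_) t≡ h)) (λ h → subst (e ∈_) (sym t≡) (from (my e) h))) ,
       p ,
       (rLet (rCall Dy) (rCall Dt) within build-cost sortCost (2 * β j ℓ + 200) ℓ (length xs) (length ys) ly)

  secondaries-cost : ∀ b l r x y x₁ y₁ → x₁ + y₁ ≡ r + (0 + 0) → x + y ≡ l + (x₁ + y₁) →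
    11 + (r * 30 + 2 + (2 + (l * 30 + 2 + (3 + ((x + 1) * b + (2 + ((y + 1) * b + 1)))))))
    ≤ (l + r + 2) * (b + 30)
  secondaries-cost b l r x y x₁ y₁ p q = cancel (*-monoˡ-≤ b (≤-reflexive (trans q (cong (l +_) p))))
    (poly 5 (λ b l r x y →
      con 11 :+ (r :* con 30 :+ con 2 :+ (con 2 :+ (l :* con 30 :+ con 2 :+ (con 3 :+ ((x :+ con 1) :* b :+
        (con 2 :+ ((y :+ con 1) :* b :+ con 1))))))) :+ (l :+ (r :+ (con 0 :+ con 0))) :* b
      :≤ (l :+ r :+ con 2) :* (b :+ con 30) :+ (x :+ y) :* b)
      (b ∷ l ∷ r ∷ x ∷ y ∷ []))

  secondaries-step : ∀ {j ℓ} → BuildRun j ℓ → SecondariesRun (suc j) ℓ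
  secondaries-step {j} {ℓ} build V l r@(e ∷ _) _ nℓ =
    let Xs₁ , Ys₁ , mx₁ , my₁ , len₁ , D₁ = split-run V right r [] []
        Xs , Ys , mx , my , len , D = split-run V left l Xs₁ Ys₁
        n≤ = ≤-reflexive (trans len (cong (length l +_) (trans len₁ (+-identityʳ (length r)))))
        X , GX , RX , pX , DX = build (subview left V) Xs
          (≤-trans (+-monoˡ-≤ 3 (≤-trans (m≤m+n (length Xs) (length Ys)) n≤)) nℓ)
        Y , GY , RY , pY , DY = build (subview right V) Ys
          (≤-trans (+-monoˡ-≤ 3 (≤-trans (m≤n+m (length Ys) (length Xs)) n≤)) nℓ)
    in X , Y , GX , GY ,
      (λ z → mk⇔ (joined mx₁ mx ∘ to (RX z)) (from (RX z) ∘ routed mx₁ mx)) ,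
      (λ z → mk⇔ (joined my₁ my ∘ to (RY z)) (from (RY z) ∘ routed my₁ my)) ,
      pX , pY ,
      (rCaseCell refl (rCaseCell refl (rCaseMore (rem V e) refl
        (rLet rNil (rLet rCons (rLet rZero (rLet (rCall D₁) (rLet (rCall D) (rCaseCell refl
          (rLet (rCall DX) (rLet (rCall DY) rCons)))))))))) within
      secondaries-cost (β (suc j) ℓ) (length l) (length r) (length Xs) (length Ys)
        (length Xs₁) (length Ys₁) len₁ len)
    where
    joined : ∀ {c Zs₁ Zs z} → Routed right c r [] Zs₁ → Routed left c l Zs₁ Zs → z ∈ Zs → Joined c l r z
    joined m₁ m h with to (m _) h
    ... | inj₁ p = inj₁ p
    ... | inj₂ h with to (m₁ _) h
    ...   | inj₁ p = inj₂ p

    routed : ∀ {c Zs₁ Zs z} → Routed right c r [] Zs₁ → Routed left c l Zs₁ Zs → Joined c l r z → z ∈ Zs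
    routed m₁ m (inj₁ p) = from (m _) (inj₁ p)
    routed m₁ m (inj₂ p) = from (m _) (inj₂ (from (m₁ _) (inj₁ p)))

  secondaries-run : ∀ j ℓ → SecondariesRun j ℓ
  secondaries-run zero ℓ V l r@(e ∷ _) _ _ = tt , tt , tt , tt , tt , tt , refl , refl ,
    (rCaseCell refl (rCaseCell refl (rCaseDone (rem V e) refl (rLet rNil rCons))) within
      poly 2 (λ l r → con 6 :≤ (l :+ r :+ con 2) :* (con 0 :+ con 30)) (length l ∷ length r ∷ []))
  secondaries-run (suc j) ℓ = secondaries-step (build-run (secondaries-run j ℓ))

  -- Counts, sizes and heights of trees

  -- The contents of a tree are specified up to membership; for duplicate-free lists this already
  -- yields bounds on counts.
  unique-⊆ : ∀ {A : Set} {xs ys : List A} → Unique xs → (∀ {x} → x ∈ xs → x ∈ ys) → length xs ≤ length ys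
  unique-⊆ {xs = []} [] _ = z≤n
  unique-⊆ {xs = x ∷ xs} (x∉ ∷ u) xs⊆ with ∈-∃++ (xs⊆ (here refl))
  ... | as , bs , refl = ≤-trans (s≤s (unique-⊆ u rest)) (≤-reflexive (sym
      (trans (length-++ as) (trans (+-suc (length as) (length bs)) (cong suc (sym (length-++ as)))))))
    where
    rest : ∀ {y} → y ∈ xs → y ∈ as ++ bs
    rest h with ∈-++⁻ as (xs⊆ (there h))
    ... | inj₁ h′         = ∈-++⁺ˡ h′
    ... | inj₂ (here p)   = ⊥-elim (All.lookup x∉ h (sym p))
    ... | inj₂ (there h′) = ∈-++⁺ʳ as h′

  2^-cancel-≤ : ∀ {a b} → 2 ^ a ≤ 2 ^ b → a ≤ b
  2^-cancel-≤ {a} {b} h = ≮⇒≥ λ b<a → <⇒≱ (^-monoʳ-< 2 (s≤s (s≤s z≤n)) b<a) h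

  β-mono : ∀ j {ℓ ℓ′} → ℓ ≤ ℓ′ → β j ℓ ≤ β j ℓ′
  β-mono zero    h = z≤n
  β-mono (suc j) h = +-monoˡ-≤ 11 (*-mono-≤ (s≤s h)
    (+-monoʳ-≤ sortCost (+-monoˡ-≤ 200 (*-monoʳ-≤ 2 (β-mono j h)))))

  rebuildCost-mono : ∀ j {ℓ ℓ′} → ℓ ≤ ℓ′ → rebuildCost j ℓ ≤ rebuildCost j ℓ′
  rebuildCost-mono j h = +-monoʳ-≤ (stepCost + 60)
    (*-mono-≤ (s≤s h) (+-monoˡ-≤ 200 (*-monoʳ-≤ 2 (β-mono j h))))

  module _ {w n q f l r bl br : ℕ} (σ : Shape w n q f l r bl br) where
    open Shape σ

    8q≤n : 8 * q ≤ n
    8q≤n = ≤-trans (*-monoʳ-≤ 8 (m≤m+n q f)) fuel≤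

    -- A child starts with about n/2 elements and loses at most q ≤ n/8 of them before the node is
    -- rebuilt, so it never runs empty.
    child-nonempty : ∀ {c} → n ≤ 2 * c + 1 + 2 * q → 1 ≤ c
    child-nonempty {zero} h = ⊥-elim (1+n≰n {5} (cancel (+-mono-≤ (+-mono-≤ (*-monoʳ-≤ 4 h) 8q≤n) (*-monoʳ-≤ 3 2≤n))
      (poly 2 (λ n q → con 6 :+ (con 4 :* (con 0 :+ con 1 :+ con 2 :* q) :+ n :+ con 3 :* n)
                    :≤ con 5 :+ (con 4 :* n :+ con 8 :* q :+ con 3 :* con 2)) (n ∷ q ∷ []))))
    child-nonempty {suc _} _ = s≤s z≤n

    n-bound : 3 * n ≤ 4 * (l + r) + 4
    n-bound = cancel (+-mono-≤ (*-monoʳ-≤ 2 (+-mono-≤ left≥ right≥)) 8q≤n)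
      (poly 4 (λ n q l r → con 3 :* n :+ (con 2 :* (con 2 :* l :+ con 1 :+ con 2 :* q :+
        (con 2 :* r :+ con 1 :+ con 2 :* q)) :+ n)
                        :≤ con 4 :* (l :+ r) :+ con 4 :+ (con 2 :* (n :+ n) :+ con 8 :* q)) (n ∷ q ∷ l ∷ r ∷ []))

    count-bound : l + r ≤ n + 1 + 2 * q
    count-bound = *-cancelˡ-≤ 2 (cancel (+-mono-≤ left≤ right≤)
      (poly 4 (λ n q l r → con 2 :* (l :+ r) :+ (n :+ con 1 :+ con 2 :* q :+ (n :+ con 1 :+ con 2 :* q))
                        :≤ con 2 :* (n :+ con 1 :+ con 2 :* q) :+ (con 2 :* l :+ con 2 :* r)) (n ∷ q ∷ l ∷ r ∷ [])))

    -- The count never exceeds n + 1 + n/4, so the exponent chosen at birth is large enough for a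
    -- rebuilding at any later time.
    count-log : l + r + 4 ≤ 2 ^ w
    count-log = ≤-trans (*-cancelˡ-≤ 4 (cancel (+-mono-≤ (*-monoʳ-≤ 4 count-bound) 8q≤n)
      (poly 4 (λ n q l r → con 4 :* (l :+ r :+ con 4) :+ (con 4 :* (n :+ con 1 :+ con 2 :* q) :+ n)
                        :≤ con 4 :* (con 2 :* n :+ con 5) :+ (con 4 :* (l :+ r) :+ con 8 :* q))
                          (n ∷ q ∷ l ∷ r ∷ [])))) log≥

    -- Nor does the count fall far below n: `3 * n` is at most `4 * (l + r) + 4`. Hence the exponent
    -- stored at birth is at most 3 above any exponent that fits the present count.
    log-bound : ∀ {ℓ} → l + r + 3 ≤ 2 ^ ℓ → w ≤ 3 + ℓ
    log-bound {ℓ} h = 2^-cancel-≤ (≤-trans log≤ (≤-trans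
      (*-cancelˡ-≤ 3 (cancel (*-monoʳ-≤ 4 n-bound)
        (poly 2 (λ n c → con 3 :* (con 2 :* (con 2 :* n :+ con 5)) :+ con 4 :* (con 4 :* c :+ con 4)
                      :≤ con 3 :* (con 8 :* (c :+ con 3)) :+ con 4 :* (con 3 :* n)) (n ∷ l + r ∷ []))))
      (≤-trans (*-monoʳ-≤ 8 h) (≤-reflexive (8*2^ ℓ)))))
      where
      8*2^ : ∀ ℓ → 8 * 2 ^ ℓ ≡ 2 ^ (3 + ℓ)
      8*2^ ℓ = trans (*-assoc 2 4 (2 ^ ℓ)) (cong (2 *_) (*-assoc 2 2 (2 ^ ℓ)))

  -- The last hypothesis distinguishes whether the child has itself been rebuilt. If so, its birth
  -- is its present count or 1, and the unit of fuel just spent gives `8 * suc q ≤ n`, which keeps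
  -- that count below 3/4 of n.
  shape-left : ∀ {w n q f l l′ r bl bl′ br} → Shape w n q (suc f) l r bl br →
    l ≤ suc l′ → l′ ≤ suc l → bl′ ≡ bl ⊎ bl′ ≡ l′ ⊔ 1 → Shape w n (suc q) f l′ r bl′ br
  shape-left {w} {n} {q} {f} {l} {l′} {r} {bl} {bl′} σ l≤ l′≤ b = record
    { 2≤n = 2≤n
    ; fuel≤ = subst (λ m → 8 * m ≤ n) (+-suc q f) fuel≤
    ; fuel≥ = subst (λ m → n ≤ 8 * m + 7) (+-suc q f) fuel≥
    ; left≥ = cancel (+-mono-≤ left≥ (*-monoʳ-≤ 2 l≤))
        (poly 4 (λ n q l l′ → n :+ (con 2 :* l :+ con 1 :+ con 2 :* q :+ con 2 :* (con 1 :+ l′))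
          :≤ con 2 :* l′ :+ con 1 :+ con 2 :* (con 1 :+ q) :+ (n :+ con 2 :* l)) (n ∷ q ∷ l ∷ l′ ∷ []))
    ; left≤ = left≤′
    ; right≥ = ≤-trans right≥ (+-monoʳ-≤ (2 * r + 1) (*-monoʳ-≤ 2 (n≤1+n q)))
    ; right≤ = ≤-trans right≤ (+-monoʳ-≤ (n + 1) (*-monoʳ-≤ 2 (n≤1+n q)))
    ; birthˡ = [ (λ { refl → birthˡ })
               , (λ { refl → [ (λ p → subst small (sym p) small-l′) , (λ p → subst small (sym p) small-1) ]′ (⊔-sel l′ 1) }) ]′ b
    ; birthʳ = birthʳ
    ; log≥ = log≥
    ; log≤ = log≤
    }
    where
    open Shape σ
    small : ℕ → Set
    small b = 4 * b ≤ 3 * n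

    left≤′ : 2 * l′ ≤ n + 1 + 2 * suc q
    left≤′ = cancel (+-mono-≤ left≤ (*-monoʳ-≤ 2 l′≤))
        (poly 4 (λ n q l l′ → con 2 :* l′ :+ (n :+ con 1 :+ con 2 :* q :+ con 2 :* (con 1 :+ l))
          :≤ n :+ con 1 :+ con 2 :* (con 1 :+ q) :+ (con 2 :* l :+ con 2 :* l′)) (n ∷ q ∷ l ∷ l′ ∷ []))

    8q≤n′ : 8 * suc q ≤ n
    8q≤n′ = ≤-trans (*-monoʳ-≤ 8 (≤-trans (s≤s (m≤m+n q f)) (≤-reflexive (sym (+-suc q f))))) fuel≤

    small-l′ : small l′
    small-l′ = *-cancelˡ-≤ 2 (cancel (+-mono-≤ (*-monoʳ-≤ 4 left≤′) (*-monoʳ-≤ 2 8q≤n′))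
        (poly 3 (λ n q l′ → con 2 :* (con 4 :* l′) :+ (con 4 :* (n :+ con 1 :+ con 2 :* (con 1 :+ q)) :+ con 2 :* n)
          :≤ con 2 :* (con 3 :* n) :+ (con 4 :* (con 2 :* l′) :+ con 2 :* (con 8 :* (con 1 :+ q))))
            (n ∷ q ∷ l′ ∷ [])))

    small-1 : small 1
    small-1 = ≤-trans (≤ᵇ⇒≤ 4 6 tt) (*-monoʳ-≤ 3 2≤n)

  shape-mirror : ∀ {w n q f l r bl br} → Shape w n q f l r bl br → Shape w n q f r l br bl
  shape-mirror σ = record
    { 2≤n = 2≤n ; fuel≤ = fuel≤ ; fuel≥ = fuel≥ ; left≥ = right≥ ; left≤ = right≤
    ; right≥ = left≥ ; right≤ = left≤ ; birthˡ = birthʳ ; birthʳ = birthˡ ; log≥ = log≥ ; log≤ = log≤ }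
    where open Shape σ

  -- (3/4)³ ≤ 1/2
  cube : ∀ {n} b → 4 * b ≤ 3 * n → 2 * (b * b * b) ≤ n * n * n
  cube {n} b h = *-cancelˡ-≤ 32 (≤-trans (cancel (*-mono-≤ (*-mono-≤ h h) h)
    (poly 2 (λ b n → con 32 :* (con 2 :* (b :* b :* b)) :+ con 3 :* n :* (con 3 :* n) :* (con 3 :* n)
      :≤ con 27 :* (n :* n :* n) :+ con 4 :* b :* (con 4 :* b) :* (con 4 :* b)) (b ∷ n ∷ [])))
    (*-monoˡ-≤ (n * n * n) (≤ᵇ⇒≤ 27 32 tt)))

  module Node {S : Set} (w n q : ℕ) (s : Elem) (f : List Elem) (L R : Tree S) (X Y : S) where

    count≡ : count (node w n q s f L R X Y) ≡ count L + count R
    count≡ = length-++ (elems L)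

    countˡ : count L ≤ count (node w n q s f L R X Y)
    countˡ = ≤-trans (m≤m+n (count L) (count R)) (≤-reflexive (sym count≡))

    countʳ : count R ≤ count (node w n q s f L R X Y)
    countʳ = ≤-trans (m≤n+m (count R) (count L)) (≤-reflexive (sym count≡))

    joined-∈ : ∀ {c x} → Joined c (elems L) (elems R) x → x ∈ elems L ++ elems R
    joined-∈ (inj₁ (h , _)) = ∈-++⁺ˡ h
    joined-∈ (inj₂ (h , _)) = ∈-++⁺ʳ (elems L) h

  module _ {j : ℕ} {S : Set} {V : View j} {GX GY : S → Set} {Rep : S → (Elem → Set) → Set} where

    private
      G = TreeGood V GX GY Rep

    sorted : ∀ {t} → G t → Sorted V (elems t)
    sorted empty = []
    sorted leaf  = [] ∷ []
    sorted (node {s = s} GL GR _ _ L≺ R⊀ _ _ _) = AllPairsₚ.++⁺ (sorted GL) (sorted GR)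
      (All.tabulate λ {x} h → All.tabulate λ {y} h′ → cross (L≺ h) (R⊀ h′))
      where
      cross : ∀ {x y} → x ≺[ V ] s → ¬ y ≺[ V ] s → x ≺[ V ] y
      cross {x} {y} p q with proj₁ (cmpItem-run V y s)
      ... | eq refl = p
      ... | lt y≺s  = ⊥-elim (q y≺s)
      ... | gt s≺y  = <ₗₑₓ-trans p s≺y

    unique : ∀ {t} → G t → Unique (elems t)
    unique g = AllPairs.map (λ { p refl → <ₗₑₓ-irrefl p }) (sorted g)

    -- No node has an empty child, so a tree has fewer inner nodes than leaves. This makes
    -- flattening linear in the count.
    treeSize-bound : ∀ {t} → G t → 1 ≤ count t → suc (treeSize t) ≤ 2 * count t
    treeSize-bound leaf _ = ≤-refl
    treeSize-bound t@(node {L = L} {R} GL GR _ _ _ _ _ _ σ) _ = ≤-trans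
      (cancel (+-mono-≤ (treeSize-bound GL (child-nonempty σ (Shape.left≥ σ))) (treeSize-bound GR (child-nonempty σ (Shape.right≥ σ))))
        (poly 4 (λ l r c d → con 2 :+ (l :+ r) :+ (con 2 :* c :+ con 2 :* d)
          :≤ con 2 :* (c :+ d) :+ (con 1 :+ l :+ (con 1 :+ r)))
          (treeSize L ∷ treeSize R ∷ count L ∷ count R ∷ [])))
      (*-monoʳ-≤ 2 (≤-reflexive (sym (length-++ (elems L)))))

    treeSize≤ : ∀ {t} → G t → treeSize t ≤ 2 * count t + 1
    treeSize≤ empty = ≤-refl
    treeSize≤ leaf  = s≤s z≤n
    treeSize≤ t@(node {L = L} {R} _ _ _ _ _ _ _ _ σ) = ≤-trans (n≤1+n _) (≤-trans
      (treeSize-bound t (≤-trans (child-nonempty σ (Shape.left≥ σ))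
        (≤-trans (m≤m+n (count L) (count R)) (≤-reflexive (sym (length-++ (elems L)))))))
      (m≤m+n _ 1))

    -- Stated with births instead of counts: deletions lower a count without lowering the height,
    -- while births shrink by the factor 3/4 from parent to child at all times.
    height-birth : ∀ {t} → G t → 2 ^ height t ≤ birth t * birth t * birth t
    height-birth empty = ≤-refl
    height-birth leaf  = ≤-refl
    height-birth (node {n = n} {L = L} {R} GL GR _ _ _ _ _ _ σ) with ⊔-sel (height L) (height R)
    ... | inj₁ p rewrite p = ≤-trans (*-monoʳ-≤ 2 (height-birth GL)) (cube {n} (birth L) (Shape.birthˡ σ))
    ... | inj₂ p rewrite p = ≤-trans (*-monoʳ-≤ 2 (height-birth GR)) (cube {n} (birth R) (Shape.birthʳ σ))

    birth-bound : ∀ {t} → G t → 3 * birth t ≤ 4 * count t + 4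
    birth-bound empty = ≤ᵇ⇒≤ 3 4 tt
    birth-bound leaf  = ≤ᵇ⇒≤ 3 8 tt
    birth-bound (node {L = L} _ _ _ _ _ _ _ _ σ) =
      subst (λ c → _ ≤ 4 * c + 4) (sym (length-++ (elems L))) (n-bound σ)

    height-bound : ∀ {t ℓ} → G t → count t + 3 ≤ 2 ^ ℓ → height t ≤ 3 * ℓ + 3
    height-bound {t} {ℓ} g h = ≤-trans (2^-cancel-≤ {b = suc ℓ + suc ℓ + suc ℓ} (≤-trans (height-birth g)
      (≤-trans (*-mono-≤ (*-mono-≤ b≤ b≤) b≤) (≤-reflexive
        (sym (trans (^-distribˡ-+-* 2 (suc ℓ + suc ℓ) (suc ℓ)) (cong (_* 2 ^ suc ℓ) (^-distribˡ-+-* 2 (suc ℓ) (suc ℓ)))))))))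
      (poly 1 (λ ℓ → con 1 :+ ℓ :+ (con 1 :+ ℓ) :+ (con 1 :+ ℓ) :≤ con 3 :* ℓ :+ con 3) (ℓ ∷ []))
      where
      b≤ : birth t ≤ 2 ^ suc ℓ
      b≤ = *-cancelˡ-≤ 3 (cancel (+-mono-≤ (birth-bound g) (*-monoʳ-≤ 6 h))
        (poly 3 (λ b c p → con 3 :* b :+ (con 4 :* c :+ con 4 :+ con 6 :* p)
          :≤ con 3 :* (con 2 :* p) :+ (con 3 :* b :+ con 6 :* (c :+ con 3)))
          (birth t ∷ count t ∷ 2 ^ ℓ ∷ [])))

  -- Updates and their amortised cost

  Updated : Kind → Elem → (Elem → Set) → Elem → Set
  Updated insertion e P x = x ≡ e ⊎ P x
  Updated deletion  e P x = P x × x ≢ e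

  kindV : Kind → Val
  kindV insertion = real 0#
  kindV deletion  = nil

  updated-cong : ∀ k {e P Q} → (∀ x → P x ⇔ Q x) → ∀ x → Updated k e P x ⇔ Updated k e Q x
  updated-cong insertion h x = mk⇔ [ inj₁ , inj₂ ∘ to (h x) ]′ [ inj₁ , inj₂ ∘ from (h x) ]′
  updated-cong deletion  h x = mk⇔ (λ { (p , n) → to (h x) p , n }) λ { (p , n) → from (h x) p , n }

  rebuild-cost-insert : ∀ s g ℓ c t m → t ≤ 2 * c + 1 → m ≤ 1 + c →
    4 + (t * 12 + (5 + ((1 + c) * s + 3 + (1 + (suc ℓ * (m * g) + 5)))))
    ≤ (c + 1) * (s + 60 + suc ℓ * g)
  rebuild-cost-insert s g ℓ c t m t≤ m≤ = cancel (+-mono-≤ (*-monoʳ-≤ 12 t≤) (*-monoˡ-≤ (suc ℓ * g) m≤))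
    (poly 6 (λ s g ℓ c t m →
      con 4 :+ (t :* con 12 :+ (con 5 :+ ((con 1 :+ c) :* s :+ con 3 :+
        (con 1 :+ ((con 1 :+ ℓ) :* (m :* g) :+ con 5)))))
      :+ (con 12 :* (con 2 :* c :+ con 1) :+ (con 1 :+ c) :* ((con 1 :+ ℓ) :* g))
      :≤ (c :+ con 1) :* (s :+ con 60 :+ (con 1 :+ ℓ) :* g) :+ (con 12 :* t :+ m :* ((con 1 :+ ℓ) :* g)))
      (s ∷ g ∷ ℓ ∷ c ∷ t ∷ m ∷ []))

  rebuild-cost-delete : ∀ s g ℓ c t m → t ≤ 2 * c + 1 → m ≤ c →
    4 + (t * 12 + (3 + (c * s + 2 + (1 + (suc ℓ * (m * g) + 5)))))
    ≤ (c + 1) * (s + 60 + suc ℓ * g)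
  rebuild-cost-delete s g ℓ c t m t≤ m≤ = cancel (+-mono-≤ (*-monoʳ-≤ 12 t≤) (*-monoˡ-≤ (suc ℓ * g) m≤))
    (poly 6 (λ s g ℓ c t m →
      con 4 :+ (t :* con 12 :+ (con 3 :+ (c :* s :+ con 2 :+ (con 1 :+ ((con 1 :+ ℓ) :* (m :* g) :+ con 5)))))
      :+ (con 12 :* (con 2 :* c :+ con 1) :+ c :* ((con 1 :+ ℓ) :* g))
      :≤ (c :+ con 1) :* (s :+ con 60 :+ (con 1 :+ ℓ) :* g) :+ (con 12 :* t :+ m :* ((con 1 :+ ℓ) :* g)))
      (s ∷ g ∷ ℓ ∷ c ∷ t ∷ m ∷ []))

  RebuildRun : ∀ {j} → View j → Kind → Elem → St (suc j) → ℕ → Set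
  RebuildRun {j} V k e t ℓ = Σ[ t′ ∈ St (suc j) ] Good V t′ ×
    (∀ x → x ∈ elems t′ ⇔ Updated k e (_∈ elems t) x) × pot t′ ≡ 0 × birth t′ ≡ count t′ ⊔ 1 ×
    Run (kindV k ∷ item V e ∷ enc {suc j} V t ∷ []) (functions rebuildᶠ) (enc {suc j} V t′)
        ((count t + 1) * rebuildCost j ℓ)

  rebuild-run : ∀ {j} (V : View j) k e t ℓ → Good V t → count t + 4 ≤ 2 ^ ℓ → RebuildRun V k e t ℓ
  rebuild-run {j} V insertion e t ℓ G c≤ =
    let ys , sy , my , ly , Dy = merge-run V (e ∷ []) (elems t) ([] ∷ []) (sorted G)
        yℓ = ≤-trans (+-monoˡ-≤ 3 ly) (≤-trans (≤-reflexive (sym (+-suc (count t) 3))) c≤)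
        t′ , G′ , t≡ , p , b , Dt = balance-run (secondaries-run j ℓ) V ℓ ys sy (m+n≤o⇒m≤o _ yℓ) yℓ
    in t′ , G′ ,
       (λ x → mk⇔ (λ h → [ (λ { (here q) → inj₁ q ; (there ()) }) , inj₂ ]′ (to (my x) (subst (x ∈_) t≡ h)))
                  (λ h → subst (x ∈_) (sym t≡) (from (my x) ([ inj₁ ∘ here , inj₂ ]′ h)))) ,
       p , trans b (cong (λ es → length es ⊔ 1) (sym t≡)) ,
       (rLet rNil (rLet (rCall (rCast (cong (items V) (++-identityʳ (elems t))) (flat-run V t [])))
         (rCaseReal refl (rLet rCons (rLet (rCall Dy) (rCall Dt)))))
        within rebuild-cost-insert stepCost (2 * β j ℓ + 200) ℓ (count t) (treeSize t) (length ys) (treeSize≤ G) ly)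
  rebuild-run {j} V deletion e t ℓ G c≤ =
    let ys , sy , my , ly , Dy = remove-run V e (elems t) (sorted G)
        yℓ = ≤-trans (+-mono-≤ ly (n≤1+n 3)) c≤
        t′ , G′ , t≡ , p , b , Dt = balance-run (secondaries-run j ℓ) V ℓ ys sy (m+n≤o⇒m≤o _ yℓ) yℓ
    in t′ , G′ ,
       (λ x → mk⇔ (λ h → to (my x) (subst (x ∈_) t≡ h)) (λ h → subst (x ∈_) (sym t≡) (from (my x) h))) ,
       p , trans b (cong (λ es → length es ⊔ 1) (sym t≡)) ,
       (rLet rNil (rLet (rCall (rCast (cong (items V) (++-identityʳ (elems t))) (flat-run V t [])))
         (rCaseNil refl (rLet (rCall Dy) (rCall Dt))))
        within rebuild-cost-delete stepCost (2 * β j ℓ + 200) ℓ (count t) (treeSize t) (length ys) (treeSize≤ G) ly)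

  card : ∀ {j} → St j → ℕ
  card {zero}  _ = 0
  card {suc j} t = count t

  card-≤ : ∀ {j} (V : ViewOf j) (X : St j) {P zs} → Good V X → Represents X P →
           (∀ {x} → P x → x ∈ zs) → card X ≤ length zs
  card-≤ {zero}  V X _ _ _ = z≤n
  card-≤ {suc j} V X G r h = unique-⊆ (unique G) (λ x∈ → h (to (r _) x∈))

  represents-cong : ∀ {j} (X : St j) {P Q : Elem → Set} → (∀ x → P x ⇔ Q x) → Represents X P → Represents X Q
  represents-cong {zero}  X h r   = tt
  represents-cong {suc j} X h r x = mk⇔ (to (h x) ∘ to (r x)) (from (r x) ∘ from (h x))

  -- The alternative on `birth` is what the parent needs to restore its own `Shape`. The cost
  -- depends on the height of the tree at hand, so that it can be summed along the path before the
  -- height is bounded by a logarithm.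
  UpdRun : ℕ → ℕ → Set
  UpdRun j ℓ = (V : View j) (k : Kind) (e : Elem) (t : St (suc j)) → Good V t → count t + 4 ≤ 2 ^ ℓ →
    Σ[ t′ ∈ St (suc j) ] ∃[ c ] Good V t′ × (∀ x → x ∈ elems t′ ⇔ Updated k e (_∈ elems t) x) ×
    (birth t′ ≡ birth t ⊎ birth t′ ≡ count t′ ⊔ 1) ×
    c + pot t′ ≤ pot t + suc (height t) * levelCost j ℓ ×
    Run (kindV k ∷ item V e ∷ enc {suc j} V t ∷ []) (functions updᶠ) (enc {suc j} V t′) c

  -- What becomes of the secondary structure of direction c′ if an element is
  -- sent to that of direction c.
  Sent : Dir → Dir → Kind → Elem → (Elem → Set) → Elem → Set
  Sent left  left  k e P = Updated k e P
  Sent right right k e P = Updated k e P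
  Sent _     _     k e P = P

  PushRun : ℕ → ℕ → Set₁
  PushRun j ℓ = (V : View j) (k : Kind) (δ : Dir) (e : Elem) (X Y : St j) (P Q : Elem → Set) →
    Good (subview left V) X → Good (subview right V) Y → Represents X P → Represents Y Q →
    card X + 4 ≤ 2 ^ ℓ → card Y + 4 ≤ 2 ^ ℓ →
    Σ[ X′ ∈ St j ] Σ[ Y′ ∈ St j ] ∃[ c ] Good (subview left V) X′ × Good (subview right V) Y′ ×
    Represents X′ (Sent (dirOf δ (sideOf e)) left k e P) × Represents Y′ (Sent (dirOf δ (sideOf e)) right k e Q) ×
    c + (pot X′ + pot Y′) ≤ pot X + pot Y + u j ℓ + 30 ×
    Run (kindV k ∷ dirV δ ∷ item V e ∷ Secondaries V X Y ∷ []) (functions pushᶠ) (Secondaries V X′ Y′) c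

  push-zero : ∀ ℓ → PushRun 0 ℓ
  push-zero ℓ V k δ e X Y P Q GX GY RX RY _ _ = tt , tt , 3 , tt , tt , tt , tt , ≤ᵇ⇒≤ 3 30 tt ,
    rCaseCell refl (rCaseDone (rem V e) refl rVar)

  push-price : ∀ c a a′ b u → c + a′ ≤ a + u → c + 28 + (a′ + b) ≤ a + b + u + 30
  push-price c a a′ b u h = cancel h
    (poly 5 (λ c a a′ b u → c :+ con 28 :+ (a′ :+ b) :+ (a :+ u) :≤ a :+ b :+ u :+ con 30 :+ (c :+ a′))
      (c ∷ a ∷ a′ ∷ b ∷ u ∷ []))

  push-suc : ∀ {j ℓ} → UpdRun j ℓ → PushRun (suc j) ℓ
  push-suc {j} {ℓ} upd V k δ e X Y P Q GX GY RX RY cX cY =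
    send (dirOf δ (sideOf e)) (advance-run {j} V δ e) (target-run V δ e)
    where
    amortised : ∀ t c p → Good (subview {suc j} left V) t ⊎ Good (subview {suc j} right V) t → count t + 4 ≤ 2 ^ ℓ →
                c + p ≤ pot t + suc (height t) * levelCost j ℓ → c + p ≤ pot t + u (suc j) ℓ
    amortised t c p g c≤ h = ≤-trans h (+-monoʳ-≤ (pot t) (*-monoˡ-≤ (levelCost j ℓ)
      (≤-trans (s≤s (bound g)) (≤-reflexive (sym (+-suc (3 * ℓ) 3))))))
      where
      c≤′ : count t + 3 ≤ 2 ^ ℓ
      c≤′ = ≤-trans (+-monoʳ-≤ (count t) (n≤1+n 3)) c≤

      bound : Good (subview {suc j} left V) t ⊎ Good (subview {suc j} right V) t → height t ≤ 3 * ℓ + 3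
      bound (inj₁ g) = height-bound {ℓ = ℓ} g c≤′
      bound (inj₂ g) = height-bound {ℓ = ℓ} g c≤′

    send : ∀ c →
      Run (dirV δ ∷ item V e ∷ []) (functions advanceᶠ) (item (subview {suc j} c V) e) 9 →
      Run (dirV δ ∷ item V e ∷ []) (functions targetᶠ) (dirV c) 8 →
      Σ[ X′ ∈ St (suc j) ] Σ[ Y′ ∈ St (suc j) ] ∃[ t ] Good (subview left V) X′ × Good (subview right V) Y′ ×
      Represents X′ (Sent c left k e P) × Represents Y′ (Sent c right k e Q) ×
      t + (pot X′ + pot Y′) ≤ pot X + pot Y + u (suc j) ℓ + 30 ×
      Run (kindV k ∷ dirV δ ∷ item V e ∷ Secondaries V X Y ∷ []) (functions pushᶠ) (Secondaries V X′ Y′) t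
    send left A T =
      let X′ , c , GX′ , RX′ , _ , p , D = upd (subview left V) k e X GX cX
      in X′ , Y , c + 28 , GX′ , GY ,
         (λ x → mk⇔ (to (updated-cong k RX x) ∘ to (RX′ x)) (from (RX′ x) ∘ from (updated-cong k RX x))) , RY ,
         push-price c (pot X) (pot X′) (pot Y) (u (suc j) ℓ) (amortised X c (pot X′) (inj₁ GX) cX p) ,
         (rCaseCell refl (rCaseMore (rem V e) refl (rLet (rCall A) (rLet (rCall T) (rCaseCell refl (rCaseNil refl
           (rLet (rCall D) rCons))))))
          within poly 1 (λ c → con 27 :+ (c :+ con 1) :≤ c :+ con 28) (c ∷ []))
    send right A T =
      let Y′ , c , GY′ , RY′ , _ , p , D = upd (subview right V) k e Y GY cY
      in X , Y′ , c + 28 , GX , GY′ , RX ,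
         (λ x → mk⇔ (to (updated-cong k RY x) ∘ to (RY′ x)) (from (RY′ x) ∘ from (updated-cong k RY x))) ,
         subst₂ (λ a b → c + 28 + a ≤ b + u (suc j) ℓ + 30) (+-comm (pot Y′) (pot X)) (+-comm (pot Y) (pot X))
           (push-price c (pot Y) (pot Y′) (pot X) (u (suc j) ℓ) (amortised Y c (pot Y′) (inj₂ GY) cY p)) ,
         (rCaseCell refl (rCaseMore (rem V e) refl (rLet (rCall A) (rLet (rCall T) (rCaseCell refl (rCaseReal refl
           (rLet (rCall D) rCons))))))
          within poly 1 (λ c → con 27 :+ (c :+ con 1) :≤ c :+ con 28) (c ∷ []))

  sent-elim : ∀ c₀ c {k e x} {P : Elem → Set} {Q : Set} → (c₀ ≡ c → Updated k e P x ⇔ Q) →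
              (c₀ ≢ c → P x ⇔ Q) → Sent c₀ c k e P x ⇔ Q
  sent-elim left  left  f g = f refl
  sent-elim left  right f g = g (λ ())
  sent-elim right left  f g = g (λ ())
  sent-elim right right f g = f refl

  -- How an update of the child C in direction δ affects the elements joined in
  -- the secondary structure of direction c.
  sent-joined : ∀ k δ e c {C C′ F : Elem → Set} → (∀ x → C′ x ⇔ Updated k e C x) → ¬ F e → ∀ x →
    Sent (dirOf δ (sideOf e)) c k e (λ x → (C x × dirOf δ (sideOf x) ≡ c) ⊎ F x) x ⇔
    ((C′ x × dirOf δ (sideOf x) ≡ c) ⊎ F x)
  sent-joined insertion δ e c m ¬F x = sent-elim (dirOf δ (sideOf e)) c
    (λ d → mk⇔
      (λ { (inj₁ refl) → inj₁ (from (m x) (inj₁ refl) , d)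
         ; (inj₂ (inj₁ (p , q))) → inj₁ (from (m x) (inj₂ p) , q)
         ; (inj₂ (inj₂ f)) → inj₂ f })
      (λ { (inj₁ (p , q)) → [ inj₁ , (λ p → inj₂ (inj₁ (p , q))) ]′ (to (m x) p)
         ; (inj₂ f) → inj₂ (inj₂ f) }))
    (λ d → mk⇔
      (λ { (inj₁ (p , q)) → inj₁ (from (m x) (inj₂ p) , q) ; (inj₂ f) → inj₂ f })
      (λ { (inj₁ (p , q)) → [ (λ { refl → ⊥-elim (d q) }) , (λ p → inj₁ (p , q)) ]′ (to (m x) p)
         ; (inj₂ f) → inj₂ f }))
  sent-joined deletion δ e c m ¬F x = sent-elim (dirOf δ (sideOf e)) c
    (λ d → mk⇔
      (λ { (inj₁ (p , q) , n) → inj₁ (from (m x) (p , n) , q) ; (inj₂ f , n) → inj₂ f })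
      (λ { (inj₁ (p , q)) → inj₁ (proj₁ (to (m x) p) , q) , proj₂ (to (m x) p)
         ; (inj₂ f) → inj₂ f , λ { refl → ¬F f } }))
    (λ d → mk⇔
      (λ { (inj₁ (p , q)) → inj₁ (from (m x) (p , (λ { refl → d q })) , q) ; (inj₂ f) → inj₂ f })
      (λ { (inj₁ (p , q)) → inj₁ (proj₁ (to (m x) p) , q) ; (inj₂ f) → inj₂ f }))

  module _ {j : ℕ} {V : View j} {k : Kind} {e : Elem} {L L′ : St (suc j)} (G : Good V L) (G′ : Good V L′)
           (m : ∀ x → x ∈ elems L′ ⇔ Updated k e (_∈ elems L) x) where

    updated-∈ : ∀ {x} → x ∈ elems L′ → x ∈ e ∷ elems L
    updated-∈ {x} h = go k (to (m x) h)
      where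
      go : ∀ k → Updated k e (_∈ elems L) x → x ∈ e ∷ elems L
      go insertion (inj₁ refl) = here refl
      go insertion (inj₂ h)    = there h
      go deletion  (h , _)     = there h

    kept : ∀ k {x} → x ∈ elems L → x ≢ e → Updated k e (_∈ elems L) x
    kept insertion h n = inj₂ h
    kept deletion  h n = h , n

    ∈-updated : ∀ {x} → x ∈ elems L → x ∈ e ∷ elems L′
    ∈-updated {x} h with proj₁ (cmpItem-run V x e)
    ... | eq refl = here refl
    ... | lt p    = there (from (m x) (kept k h λ { refl → <ₗₑₓ-irrefl p }))
    ... | gt p    = there (from (m x) (kept k h λ { refl → <ₗₑₓ-irrefl p }))

    count-updated : count L′ ≤ suc (count L)
    count-updated = unique-⊆ (unique G′) updated-∈

    updated-count : count L ≤ suc (count L′)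
    updated-count = unique-⊆ (unique G) ∈-updated

  ⊎-swap : ∀ {P Q : Set} → (P ⊎ Q) ⇔ (Q ⊎ P)
  ⊎-swap = mk⇔ Sum.swap Sum.swap

  updated-⊎ : ∀ k {e} {P P′ Q : Elem → Set} → (∀ x → P′ x ⇔ Updated k e P x) → ¬ Q e →
              ∀ x → (P′ x ⊎ Q x) ⇔ Updated k e (λ x → P x ⊎ Q x) x
  updated-⊎ insertion m ¬Q x = mk⇔
    [ [ inj₁ , inj₂ ∘ inj₁ ]′ ∘ to (m x) , inj₂ ∘ inj₂ ]′
    [ inj₁ ∘ from (m x) ∘ inj₁ , [ inj₁ ∘ from (m x) ∘ inj₂ , inj₂ ]′ ]′
  updated-⊎ deletion m ¬Q x = mk⇔
    [ (λ p → inj₁ (proj₁ (to (m x) p)) , proj₂ (to (m x) p)) , (λ q → inj₂ q , λ { refl → ¬Q q }) ]′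
    λ { (inj₁ p , n) → inj₁ (from (m x) (p , n)) ; (inj₂ q , n) → inj₂ q }

  updated-++ˡ : ∀ k {e ls ls′ rs} → (∀ x → x ∈ ls′ ⇔ Updated k e (_∈ ls) x) → ¬ e ∈ rs →
                ∀ x → x ∈ ls′ ++ rs ⇔ Updated k e (_∈ ls ++ rs) x
  updated-++ˡ k m ∉ x = ⇔-trans ++-∈⇔ (⇔-trans (updated-⊎ k m ∉ x)
    (updated-cong k (λ x → ⇔-sym ++-∈⇔) x))

  updated-++ʳ : ∀ k {e ls rs rs′} → (∀ x → x ∈ rs′ ⇔ Updated k e (_∈ rs) x) → ¬ e ∈ ls →
                ∀ x → x ∈ ls ++ rs′ ⇔ Updated k e (_∈ ls ++ rs) x
  updated-++ʳ k m ∉ x = ⇔-trans ++-∈⇔ (⇔-trans ⊎-swap (⇔-trans (updated-⊎ k m ∉ x)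
    (updated-cong k (λ x → ⇔-trans ⊎-swap (⇔-sym ++-∈⇔)) x)))

  -- Empty trees and leaves carry no fuel and are rebuilt by every update. With at most one element
  -- this costs two units of `rebuildCost`, of which `levelCost` contains ten.
  tip-price : ∀ j ℓ {m c p} → m ≤ 1 → c ≤ 3 → p ≡ 0 →
              c + (m + 1) * rebuildCost j ℓ + p ≤ 0 + 1 * levelCost j ℓ
  tip-price j ℓ {m} {c} m≤ c≤ refl = ≤-trans
    (+-monoˡ-≤ 0 (+-mono-≤ c≤ (*-mono-≤ (+-monoˡ-≤ 1 m≤) (rebuildCost-mono j (m≤n+m ℓ 3)))))
    (poly 3 (λ r c u → con 3 :+ con 2 :* r :+ con 0 :≤ con 0 :+ con 1 :* (c :+ con 300 :+ u :+ con 10 :* r))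
      (rebuildCost j (3 + ℓ) ∷ compareCost ∷ u j ℓ ∷ []))

  -- Exhausted fuel means that the count plus one is at most `10 * suc q`, the origin of the factor
  -- 10 in `W`. The potential pays for `q` of these tens and `levelCost` for the last one; the old
  -- potential `p₀` of the parts is given up.
  rebuild-price : ∀ j ℓ {w q c h p p₀} → c + 1 ≤ 10 * suc q → w ≤ 3 + ℓ → p ≡ 0 →
    8 + (c + 1) * rebuildCost j w + p ≤ q * W j w + p₀ + suc h * levelCost j ℓ
  rebuild-price j ℓ {w} {q} {c} {h} {_} {p₀} c≤ w≤ refl = ≤-trans
    (+-monoˡ-≤ 0 (+-monoʳ-≤ 8 (*-monoˡ-≤ (rebuildCost j w) c≤)))
    (cancel (*-monoʳ-≤ 10 (rebuildCost-mono j w≤))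
      (poly 7 (λ q r r′ c u h p₀ → con 8 :+ con 10 :* (con 1 :+ q) :* r :+ con 0 :+ con 10 :* r′
        :≤ q :* (con 10 :* r) :+ p₀ :+ (con 1 :+ h) :* (c :+ con 300 :+ u :+ con 10 :* r′) :+ con 10 :* r)
        (q ∷ rebuildCost j w ∷ rebuildCost j (3 + ℓ) ∷ compareCost ∷ u j ℓ ∷ h ∷ p₀ ∷ [])))

  -- The two hypotheses on time charge the recursive call to the lower levels of the tree and the
  -- secondary structure to `u`. The unit by which `q` grows costs `W j w`, at most the summand
  -- `W j (3 + ℓ)` of `levelCost`.
  descend-price : ∀ j ℓ {w q t p p′ h h′ t₂ a a′ b} → w ≤ 3 + ℓ → h ≤ h′ →
    t + p′ ≤ p + suc h * levelCost j ℓ → t₂ + a′ ≤ a + u j ℓ + 30 →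
    compareCost + t + t₂ + 160 + (suc q * W j w + (p′ + b + a′))
    ≤ q * W j w + (p + b + a) + suc (suc h′) * levelCost j ℓ
  descend-price j ℓ {w} {q} {t} {p} {p′} {h} {h′} {t₂} {a} {a′} {b} w≤ h≤ x y =
    cancel (+-mono-≤ (+-mono-≤ (≤-trans x (+-monoʳ-≤ p (*-monoˡ-≤ (levelCost j ℓ) (s≤s h≤)))) y)
                     (*-monoʳ-≤ 10 (rebuildCost-mono j w≤)))
      (poly 13 (λ c t t₂ q r r′ p p′ b a a′ u H →
        c :+ t :+ t₂ :+ con 160 :+ ((con 1 :+ q) :* (con 10 :* r) :+ (p′ :+ b :+ a′)) :+ (p :+ H :+ (a :+ u :+ con 30) :+ con 10 :* r′)
        :≤ q :* (con 10 :* r) :+ (p :+ b :+ a) :+ (c :+ con 300 :+ u :+ con 10 :* r′ :+ H) :+ (t :+ p′ :+ (t₂ :+ a′) :+ con 10 :* r))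
        (compareCost ∷ t ∷ t₂ ∷ q ∷ rebuildCost j w ∷ rebuildCost j (3 + ℓ) ∷
         p ∷ p′ ∷ b ∷ a ∷ a′ ∷ u j ℓ ∷ suc h′ * levelCost j ℓ ∷ []))

  descend-cost : ∀ c t t₂ →
    9 + (c + (4 + (t + (4 + (t₂ + (1 + nodeCost))))))
    ≤ c + t + t₂ + 160
  descend-cost c t t₂ = poly 3 (λ c t t₂ →
    con 9 :+ (c :+ (con 4 :+ (t :+ (con 4 :+ (t₂ :+ (con 1 :+ con 131))))))
    :≤ c :+ t :+ t₂ :+ con 160) (c ∷ t ∷ t₂ ∷ [])

  upd-run : ∀ {j ℓ} → PushRun j ℓ → UpdRun j ℓ
  upd-run {j} {ℓ} push V k e empty G c≤ =
    let t′ , G′ , m , p , b , D = rebuild-run V k e empty ℓ G c≤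
    in t′ , _ , G′ , m , inj₂ b , tip-price j ℓ {0} {2} z≤n (n≤1+n 2) p , rTreeEmpty refl (rCall D)
  upd-run {j} {ℓ} push V k e (leaf x) G c≤ =
    let t′ , G′ , m , p , b , D = rebuild-run V k e (leaf x) ℓ G c≤
    in t′ , _ , G′ , m , inj₂ b , tip-price j ℓ {1} {3} ≤-refl ≤-refl p , rTreeLeaf refl (rCall D)
  upd-run {j} {ℓ} push V k e t@(node w n q s [] L R X Y) G@(node _ _ _ _ _ _ _ _ σ) c≤ =
    -- The rebuilding is priced with the exponent `w` stored at birth, in which the potential of the
    -- node has been measured.
    let t′ , G′ , m , p , b , D = rebuild-run V k e t w G (subst (λ c → c + 4 ≤ 2 ^ w) (sym c≡) (count-log σ))
    in t′ , _ , G′ , m , inj₂ b ,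
       rebuild-price j ℓ {w} {q} {count t} {height t} few
         (log-bound σ (≤-trans (+-mono-≤ (≤-reflexive (sym c≡)) (n≤1+n 3)) c≤)) p ,
       rTreeNode refl (rCaseNil refl (rCall D))
    where
    c≡ : count t ≡ count L + count R
    c≡ = length-++ (elems L)

    few : count t + 1 ≤ 10 * suc q
    few = ≤-trans (+-monoˡ-≤ 1 (≤-reflexive c≡)) (cancel (+-mono-≤ (count-bound σ) (Shape.fuel≥ σ))
      (poly 3 (λ c n q → c :+ con 1 :+ (n :+ con 1 :+ con 2 :* q :+ (con 8 :* (q :+ con 0) :+ con 7))
        :≤ con 10 :* (con 1 :+ q) :+ (c :+ n)) (count L + count R ∷ n ∷ q ∷ [])))
  upd-run {j} {ℓ} push V k e t@(node w n q s (x ∷ f) L R X Y) G@(node GL GR GX GY L≺ R⊀ RX RY σ) c≤ =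
    descend (cmpItem-run V e s)
    where
    open Node w n q s (x ∷ f) L R X Y

    w≤ : w ≤ 3 + ℓ
    w≤ = log-bound σ (≤-trans (+-mono-≤ (≤-reflexive (sym count≡)) (n≤1+n 3)) c≤)

    child-≤ : ∀ {c} → c ≤ count t → c + 4 ≤ 2 ^ ℓ
    child-≤ h = ≤-trans (+-monoˡ-≤ 4 h) c≤

    X≤ : card X + 4 ≤ 2 ^ ℓ
    X≤ = child-≤ (card-≤ (subview left V) X GX RX joined-∈)

    Y≤ : card Y + 4 ≤ 2 ^ ℓ
    Y≤ = child-≤ (card-≤ (subview right V) Y GY RY joined-∈)

    Result = Σ[ t′ ∈ St (suc j) ] ∃[ c ] Good V t′ × (∀ x → x ∈ elems t′ ⇔ Updated k e (_∈ elems t) x) ×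
      (birth t′ ≡ birth t ⊎ birth t′ ≡ count t′ ⊔ 1) ×
      c + pot t′ ≤ pot t + suc (height t) * levelCost j ℓ ×
      Run (kindV k ∷ item V e ∷ enc {suc j} V t ∷ []) (functions updᶠ) (enc {suc j} V t′) c

    goLeft : e ≺[ V ] s →
      Run (item V e ∷ item V s ∷ []) (functions cmpItemᶠ) (real 0#) compareCost → Result
    goLeft e≺s C =
      let L′ , cL , GL′ , mL , bL , pL , DL = upd-run push V k e L GL (child-≤ countˡ)
          X′ , Y′ , cP , GX′ , GY′ , RX′ , RY′ , pP , DP = push V k left e X Y _ _ GX GY RX RY X≤ Y≤
          joined = λ c → sent-joined k left e c {_∈ elems L} {_∈ elems L′} {λ x → x ∈ elems R × dirOf right (sideOf x) ≡ c}
            mL (λ h → R⊀ (proj₁ h) e≺s)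
      in node w n (suc q) s f L′ R X′ Y′ , _ ,
         node GL′ GR GX′ GY′
           (λ h → [ (λ { refl → e≺s }) , L≺ ]′ (Any.toSum (updated-∈ {V = V} GL GL′ mL h))) R⊀
           (represents-cong X′ (joined left) RX′) (represents-cong Y′ (joined right) RY′)
           (shape-left σ (updated-count {V = V} GL GL′ mL) (count-updated {V = V} GL GL′ mL) bL) ,
         updated-++ˡ k mL (λ h → R⊀ h e≺s) ,
         inj₁ refl ,
         descend-price j ℓ {w} {q} {cL} {pot L} {pot L′} {height L} {height L ⊔ height R} {cP} {pot X + pot Y} {pot X′ + pot Y′} {pot R}
           w≤ (m≤m⊔n _ _) pL pP ,
         (rTreeNode refl (rCaseCell refl (rLet (rCall C) (rCaseReal refl (rCall
           (rLet (rCall DL) (rLet rNil (rLet (rCall DP) (rCall (node-run V w n (suc q) s f L′ R X′ Y′)))))))))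
           within descend-cost compareCost cL cP)

    goRight : ¬ e ≺[ V ] s →
      (∀ {v c} → Run (kindV k ∷ item V e ∷ item V s ∷ items V f ∷ enc {suc j} V L ∷ enc {suc j} V R ∷ Secondaries V X Y ∷ [])
                     (functions rightᶠ) v c →
       Run (kindV k ∷ item V e ∷ enc {suc j} V t ∷ []) (functions updᶠ) v
           (9 + (compareCost + (2 + (c))))) → Result
    goRight e⊀s enter =
      let R′ , cR , GR′ , mR , bR , pR , DR = upd-run push V k e R GR (child-≤ countʳ)
          X′ , Y′ , cP , GX′ , GY′ , RX′ , RY′ , pP , DP = push V k right e X Y _ _ GX GY
            (represents-cong X (λ _ → ⊎-swap) RX) (represents-cong Y (λ _ → ⊎-swap) RY) X≤ Y≤
          joined = λ c x → ⇔-trans (sent-joined k right e c {_∈ elems R} {_∈ elems R′} {λ x → x ∈ elems L × dirOf left (sideOf x) ≡ c}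
            mR (λ h → e⊀s (L≺ (proj₁ h))) x) ⊎-swap
      in node w n (suc q) s f L R′ X′ Y′ , _ ,
         node GL GR′ GX′ GY′ L≺
           (λ h → [ (λ { refl → e⊀s }) , R⊀ ]′ (Any.toSum (updated-∈ {V = V} GR GR′ mR h)))
           (represents-cong X′ (joined left) RX′) (represents-cong Y′ (joined right) RY′)
           (shape-mirror (shape-left (shape-mirror σ) (updated-count {V = V} GR GR′ mR) (count-updated {V = V} GR GR′ mR) bR)) ,
         updated-++ʳ k mR (λ h → e⊀s (L≺ h)) ,
         inj₁ refl ,
         subst₂ (λ a b → compareCost + cR + cP + 160 + (suc q * W j w + (a + (pot X′ + pot Y′)))
                         ≤ q * W j w + (b + (pot X + pot Y)) + suc (height t) * levelCost j ℓ)
           (+-comm (pot R′) (pot L)) (+-comm (pot R) (pot L))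
           (descend-price j ℓ {w} {q} {cR} {pot R} {pot R′} {height R} {height L ⊔ height R} {cP} {pot X + pot Y} {pot X′ + pot Y′} {pot L}
             w≤ (m≤n⊔m (height L) _) pR pP) ,
         (enter (rLet (rCall DR) (rLet rZero (rLet (rCall DP) (rCall (node-run V w n (suc q) s f L R′ X′ Y′)))))
           within descend-cost compareCost cR cP)

    descend : Σ[ c ∈ Compare (λ e f → e ≺[ V ] f) e s ]
      Run (item V e ∷ item V s ∷ []) (functions cmpItemᶠ) (compareV c) compareCost → Result
    descend (lt p , C) = goLeft p C
    descend (eq refl , C) = goRight <ₗₑₓ-irrefl
      (λ D → rTreeNode refl (rCaseCell refl (rLet (rCall C) (rCaseNil refl (rCall D)))))
    descend (gt p , C) = goRight (≺-asym {V = V} p)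
      (λ D → rTreeNode refl (rCaseCell refl (rLet (rCall C) (rCaseCell refl (rCall D)))))

  mutual
    push-run : ∀ j ℓ → PushRun j ℓ
    push-run zero    ℓ = push-zero ℓ
    push-run (suc j) ℓ = push-suc (update-run j ℓ)

    update-run : ∀ j ℓ → UpdRun j ℓ
    update-run j ℓ = upd-run (push-run j ℓ)

  -- Enumeration at the last level

  Pair : Set
  Pair = Point ℝ d × Point ℝ d

  emitted : List Pair → List Val
  emitted = List.map (encodePair ℝ d)

  module _ {δ n : ℕ} {ρ : Vec Val n} where

    -- For a part that reports something only the slack `a` matters, so the bound on silent time may
    -- be replaced by any other.
    eBusy : ∀ {k k′ a a′ e vs} → a ≤ a′ → Emits δ k true a ρ e vs → Emits δ k′ true a′ ρ e vs
    eBusy a≤ (emits {trace = τ} D o p) = emits D o λ g τ′ h c →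
      p g τ′ (≤-trans (+-monoʳ-≤ g a≤) h) (λ g′ h′ → c g′ (≤-trans h′ a≤))

    eCast : ∀ {k a e b b′ vs vs′} → b ≡ b′ → vs ≡ vs′ → Emits δ k b a ρ e vs → Emits δ k b′ a ρ e vs′
    eCast refl refl E = E

  -- Makes pruning exact: a node passes the test just when one of its children does, so every
  -- subtree that is entered leads to an element that passes.
  within?-minOf : ∀ a b c → within? (minOf a b) c ≡ within? a c ∨ within? b c
  within?-minOf nothing  b        c        = refl
  within?-minOf (just x) nothing  c        = sym (∨-identityʳ _)
  within?-minOf (just x) (just y) nothing with x ≤ᴿ? y
  ... | yes _ = refl
  ... | no  _ = refl
  within?-minOf (just x) (just y) (just z) with x ≤ᴿ? y
  ... | yes x≤y with x +ᴿ z ≤ᴿ? 0# | y +ᴿ z ≤ᴿ? 0#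
  ...   | yes _ | _     = refl
  ...   | no  p | yes q = ⊥-elim (p (≤ᴿ-trans (+ᴿ-monoˡ-≤ z x≤y) q))
  ...   | no  _ | no  _ = refl
  within?-minOf (just x) (just y) (just z) | no x≰y with x +ᴿ z ≤ᴿ? 0# | y +ᴿ z ≤ᴿ? 0#
  ...   | yes _ | yes _ = refl
  ...   | yes q | no  p = ⊥-elim (p (≤ᴿ-trans (+ᴿ-monoˡ-≤ z
            ([ (λ h → ⊥-elim (x≰y h)) , (λ h → h) ]′ (≤ᴿ-total x y))) q))
  ...   | no  _ | yes _ = refl
  ...   | no  _ | no  _ = refl

  within?-true : ∀ {x y} → x +ᴿ y ≤ᴿ 0# → within? (just x) (just y) ≡ true
  within?-true {x} {y} h with x +ᴿ y ≤ᴿ? 0#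
  ... | yes _ = refl
  ... | no  n = ⊥-elim (n h)

  true-within? : ∀ {x y} → within? (just x) (just y) ≡ true → x +ᴿ y ≤ᴿ 0#
  true-within? {x} {y} h with x +ᴿ y ≤ᴿ? 0#
  ... | yes p = p

  visited : ∀ {j} {B : Set} → Side → View j → Carrier → (Elem → List B) → Elem → List B
  visited σ V β f e = if within? (select σ (sideOf e) (acc V e)) (just β) then f e else []

  concatMap-++ : ∀ {A B : Set} (f : A → List B) xs ys →
                 List.concatMap f (xs ++ ys) ≡ List.concatMap f xs ++ List.concatMap f ys
  concatMap-++ f []       ys = refl
  concatMap-++ f (x ∷ xs) ys = trans (cong (f x ++_) (concatMap-++ f xs ys)) (sym (++-assoc (f x) _ _))

  module _ (σ : Side) (V : View 0) (β : Carrier) {B : Set} (f : Elem → List B) where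

    below : St 1 → Bool
    below t = within? (minimum σ V t) (just β)

    below-node : ∀ {w n q s fuel L R X Y} → below (node w n q s fuel L R X Y) ≡ below L ∨ below R
    below-node {L = L} {R} = within?-minOf (minimum σ V L) (minimum σ V R) (just β)

    visited-none : ∀ t → below t ≡ false → List.concatMap (visited σ V β f) (elems t) ≡ []
    visited-none empty    _ = refl
    visited-none (leaf e) h rewrite h = refl
    visited-none t@(node _ _ _ _ _ L R _ _) h = trans (concatMap-++ (visited σ V β f) (elems L) (elems R))
      (cong₂ _++_ (visited-none L (∨-conicalˡ _ _ h′)) (visited-none R (∨-conicalʳ (below L) _ h′)))
      where
      h′ : below L ∨ below R ≡ false
      h′ = trans (sym (within?-minOf (minimum σ V L) (minimum σ V R) (just β))) h

  -- Each element that passes the test must report something within slack `a`. A pruned subtree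
  -- costs at most 30, a node on the way to an element at most 100, so the slack grows by 100 per
  -- level of the tree. The room for twice the slack is used where a left subtree ends and the right
  -- one begins.
  trav-run : ∀ σ (V : View 0) β (aux : Val) (f : Elem → List Pair) δ a (t : St 1) →
    (∀ e → e ∈ elems t → sideOf e ≡ σ → acc V e +ᴿ β ≤ᴿ 0# →
      Emits δ 30 true a (item V e ∷ aux ∷ []) (functions visitᶠ) (emitted (f e))) →
    (a + 100 * suc (height t)) + (a + 100 * suc (height t)) ≤ δ →
    Emits δ 30 (below σ V β f t) (a + 100 * suc (height t))
      (real (sideᴿ σ) ∷ real β ∷ enc V t ∷ aux ∷ []) (functions travᶠ)
      (emitted (List.concatMap (visited σ V β f) (elems t)))
  trav-run σ V β aux f δ a t visit a≤ = go t refl visit a≤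
    where
    b : St 1 → Bool
    b = below σ V β f

    outs : St 1 → List Val
    outs t = emitted (List.concatMap (visited σ V β f) (elems t))

    least : ∀ t → Run (real (sideᴿ σ) ∷ real β ∷ enc V t ∷ aux ∷ []) (call minimumᶠ (0F ∷ 2F ∷ [])) (maybeV (minimum σ V t)) 12
    least t = rCall (minimum-run σ V t)

    tested : ∀ t → Run (maybeV (minimum σ V t) ∷ real (sideᴿ σ) ∷ real β ∷ enc V t ∷ aux ∷ [])
                  (call testᶠ (0F ∷ 2F ∷ [])) (boolV (b t)) 9
    tested t = rCall (test-run (minimum σ V t) (just β))

    Goal : St 1 → Set
    Goal t = (∀ e → e ∈ elems t → sideOf e ≡ σ → acc V e +ᴿ β ≤ᴿ 0# →
        Emits δ 30 true a (item V e ∷ aux ∷ []) (functions visitᶠ) (emitted (f e))) →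
      (a + 100 * suc (height t)) + (a + 100 * suc (height t)) ≤ δ →
      Emits δ 30 (b t) (a + 100 * suc (height t))
        (real (sideᴿ σ) ∷ real β ∷ enc V t ∷ aux ∷ []) (functions travᶠ) (outs t)

    pruned : ∀ t → b t ≡ false → Goal t
    pruned t h _ _ = eCast (sym h) (sym (cong emitted (visited-none σ V β f t h)))
      (eSilent (rLet (least t) (rLet (rCast (cong boolV h) (tested t)) (rCaseNil refl rNil)) within ≤ᵇ⇒≤ _ _ tt))

    select-true : ∀ e → within? (select σ (sideOf e) (acc V e)) (just β) ≡ true →
                  sideOf e ≡ σ × acc V e +ᴿ β ≤ᴿ 0#
    select-true e = pick σ (sideOf e)
      where
      pick : ∀ σ s → within? (select σ s (acc V e)) (just β) ≡ true → s ≡ σ × acc V e +ᴿ β ≤ᴿ 0#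
      pick inA inA h = refl , true-within? h
      pick inB inB h = refl , true-within? h

    go : ∀ t {c} → b t ≡ c → Goal t
    go t {false} h = pruned t h
    go (leaf e) {true} h visit a≤ = let s , p = select-true e h in
      eCast (sym h) (sym (trans (cong emitted (++-identityʳ _)) (cong (λ c → emitted (if c then f e else [])) h)))
        (eBusy (poly 1 (λ a → con 27 :+ (a) :≤ a :+ con 100) (a ∷ []))
          (eAfter true (least (leaf e)) (eAfter true (rCast (cong boolV h) (tested (leaf e))) (eCaseReal true refl
            (eTreeLeaf true refl (eCall true (visit e (here refl) s p)))))))
    go t@(node w n q s fu L R X Y) {true} h visit a≤ =
      eCast (sym h) (sym (trans (cong emitted (concatMap-++ (visited σ V β f) (elems L) (elems R)))
                                (map-++ (encodePair ℝ d) (List.concatMap (visited σ V β f) (elems L)) _)))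
        (eBusy cost (eAfter true (least t) (eAfter true (rCast (cong boolV h) (tested t)) (eCaseReal true refl (eTreeNode true refl
          (eCast {vs = outs L ++ outs R} both refl (eLet (b L) (b R) room (eCall (b L) L′) λ v → eCall (b R) R′)))))))
      where
      both : b L ∨ b R ≡ true
      both = trans (sym (below-node σ V β f {w} {n} {q} {s} {fu} {L} {R} {X} {Y})) h

      H = a + 100 * suc (height L ⊔ height R)

      cost : 13 + (80 + (suc H)) ≤ a + 100 * suc (height t)
      cost = poly 2 (λ a h → con 94 :+ (a :+ con 100 :* (con 1 :+ h)) :≤ a :+ con 100 :* (con 2 :+ h))
        (a ∷ height L ⊔ height R ∷ [])

      H≤ : H + 100 ≤ a + 100 * suc (height t)
      H≤ = poly 2 (λ a h → a :+ con 100 :* (con 1 :+ h) :+ con 100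
        :≤ a :+ con 100 :* (con 2 :+ h)) (a ∷ height L ⊔ height R ∷ [])

      room : suc H + suc H ≤ δ
      room = ≤-trans (+-mono-≤ (≤-trans (≤-trans (≤-reflexive (+-comm 1 H)) (+-monoʳ-≤ H (s≤s z≤n))) H≤)
                               (≤-trans (≤-trans (≤-reflexive (+-comm 1 H)) (+-monoʳ-≤ H (s≤s z≤n))) H≤)) a≤

      smaller : ∀ {h} → h ≤ height L ⊔ height R → a + 100 * suc h ≤ H
      smaller h≤ = +-monoʳ-≤ a (*-monoʳ-≤ 100 (s≤s h≤))

      roomy : ∀ {x} → x ≤ H → x + x ≤ δ
      roomy x≤ = ≤-trans (+-mono-≤ (m≤n⇒m≤1+n x≤) (m≤n⇒m≤1+n x≤)) room

      L′ : Emits δ 30 (b L) H (real (sideᴿ σ) ∷ real β ∷ enc V L ∷ aux ∷ []) (functions travᶠ) (outs L)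
      L′ = eWeaken (b L) ≤-refl (smaller (m≤m⊔n _ _))
        (go L refl (λ e h → visit e (∈-++⁺ˡ h)) (roomy (smaller (m≤m⊔n _ _))))

      R′ : Emits δ 30 (b R) H (real (sideᴿ σ) ∷ real β ∷ enc V R ∷ aux ∷ []) (functions travᶠ) (outs R)
      R′ = eWeaken (b R) ≤-refl (smaller (m≤n⊔m (height L) _))
        (go R refl (λ e h → visit e (∈-++⁺ʳ (elems L) h)) (roomy (smaller (m≤n⊔m (height L) _))))

  -- At the last level 200 is 100 for the search through A and 100 for the nested search through B.
  -- The other levels contribute summands, not factors: a descent to the next result leaves each
  -- tree for a secondary structure at most once.
  enumCost : ℕ → ℕ → ℕ
  enumCost zero    ℓ = 100 + 200 * (3 * ℓ + 4)
  enumCost (suc j) ℓ = enumCost j ℓ + 320 * (3 * ℓ + 4)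

  Close : ∀ {j} → View j → Elem → Elem → Set
  Close {j} V a b = acc V a +ᴿ acc V b +ᴿ dist ℝ j (rem V a) (rem V b) ≤ᴿ 0#

  -- The bound holds for every sufficiently large `δ`, because the parts of a tree are enumerated
  -- under the delay of the whole enumeration and not under their own.
  EnumRun : ∀ {j} → View j → St (suc j) → ℕ → Set
  EnumRun {j} V t a = Σ[ ps ∈ List Pair ] Unique ps ×
    (∀ p q → (p , q) ∈ ps ⇔ ((inA , p) ∈ elems t × (inB , q) ∈ elems t × Close V (inA , p) (inB , q))) ×
    (flag {suc j} V t ≡ false → ps ≡ []) ×
    (∀ δ → a + a ≤ δ → Emits δ 30 (flag {suc j} V t) a (enc {suc j} V t ∷ []) (functions enumᶠ) (emitted ps))

  unflagged : ∀ {j} (V : View j) (t : St (suc j)) {ps δ a} → flag {suc j} V t ≡ false → ps ≡ [] →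
    Emits δ 30 (flag {suc j} V t) a (enc {suc j} V t ∷ []) (functions enumᶠ) (emitted ps)
  unflagged {j} V t h refl = eCast (sym h) refl
    (eSilent (rLet (rCall (rCast (cong boolV h) (flag-run V t))) (rCaseNil refl rNil) within ≤ᵇ⇒≤ _ _ tt))

  concatMap-unique : ∀ {A B : Set} {f : A → List B} (g : B → A) → (∀ {a b} → b ∈ f a → g b ≡ a) →
    (∀ a → Unique (f a)) → ∀ {xs} → Unique xs → Unique (List.concatMap f xs)
  concatMap-unique g h u []       = []
  concatMap-unique {f = f} g h u (x∉ ∷ uxs) = Uniqueₚ.++⁺ (u _) (concatMap-unique g h u uxs)
    λ { (y∈ , y∈′) → let z , z∈ , y∈″ = find (∈-concatMap⁻ f y∈′) in
        All.lookup x∉ z∈ (trans (sym (h y∈)) (h y∈″)) }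

  minimum-≤ : ∀ {j S} σ (V : View j) (t : Tree S) {e} → e ∈ elems t → sideOf e ≡ σ →
              ∃[ m ] minimum σ V t ≡ just m × m ≤ᴿ acc V e
  minimum-≤ inA V (leaf e) (here refl) refl = _ , refl , ≤ᴿ-refl
  minimum-≤ inB V (leaf e) (here refl) refl = _ , refl , ≤ᴿ-refl
  minimum-≤ σ V (node _ _ _ _ _ L R _ _) h s with ∈-++⁻ (elems L) h
  ... | inj₁ h′ with m , p , m≤ ← minimum-≤ σ V L h′ s rewrite p with minimum σ V R
  ...   | nothing = m , refl , m≤
  ...   | just m′ with m ≤ᴿ? m′
  ...     | yes _ = m , refl , m≤
  ...     | no  n = m′ , refl , ≤ᴿ-trans ([ (λ q → ⊥-elim (n q)) , (λ q → q) ]′ (≤ᴿ-total m m′)) m≤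
  minimum-≤ σ V (node _ _ _ _ _ L R _ _) h s | inj₂ h′
    with m , p , m≤ ← minimum-≤ σ V R h′ s rewrite p with minimum σ V L
  ...   | nothing = m , refl , m≤
  ...   | just m′ with m′ ≤ᴿ? m
  ...     | yes q = m′ , refl , ≤ᴿ-trans q m≤
  ...     | no  _ = m , refl , m≤

  ∈-visited : ∀ {j} σ (V : View j) β {B : Set} (f : Elem → List B) e {x} →
              x ∈ visited σ V β f e → (sideOf e ≡ σ × acc V e +ᴿ β ≤ᴿ 0#) × x ∈ f e
  ∈-visited σ V β f e h = go σ (sideOf e) h
    where
    go : ∀ σ s {x} → x ∈ (if within? (select σ s (acc V e)) (just β) then f e else []) →
         (s ≡ σ × acc V e +ᴿ β ≤ᴿ 0#) × x ∈ f e
    go inA inA h with acc V e +ᴿ β ≤ᴿ? 0#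
    ... | yes p = (refl , p) , h
    go inB inB h with acc V e +ᴿ β ≤ᴿ? 0#
    ... | yes p = (refl , p) , h

  visited-∈ : ∀ {j} (V : View j) {β} {B : Set} (f : Elem → List B) e {x} →
              acc V e +ᴿ β ≤ᴿ 0# → x ∈ f e → x ∈ visited (sideOf e) V β f e
  visited-∈ V {β} f (inA , p) h x∈ with acc V (inA , p) +ᴿ β ≤ᴿ? 0#
  ... | yes _ = x∈
  ... | no  n = ⊥-elim (n h)
  visited-∈ V {β} f (inB , p) h x∈ with acc V (inB , p) +ᴿ β ≤ᴿ? 0#
  ... | yes _ = x∈
  ... | no  n = ⊥-elim (n h)

  visited-unique : ∀ {j} σ (V : View j) β {B : Set} (f : Elem → List B) e → Unique (f e) → Unique (visited σ V β f e)
  visited-unique σ V β f e u with within? (select σ (sideOf e) (acc V e)) (just β)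
  ... | true  = u
  ... | false = []

  module _ (V : View 0) (t : St 1) where

    pairWith : Elem → Elem → List Pair
    pairWith a b = (proj₂ a , proj₂ b) ∷ []

    partners : Elem → List Pair
    partners a = List.concatMap (visited inB V (acc V a) (pairWith a)) (elems t)

    joinedBelow : Carrier → List Pair
    joinedBelow m = List.concatMap (visited inA V m partners) (elems t)

    ∈-partners : ∀ a {p q} → (p , q) ∈ partners a →
      p ≡ proj₂ a × (inB , q) ∈ elems t × acc V (inB , q) +ᴿ acc V a ≤ᴿ 0#
    ∈-partners a h with find (∈-concatMap⁻ (visited inB V (acc V a) (pairWith a)) h)
    ... | (s , b) , b∈ , h′ with ∈-visited inB V (acc V a) (pairWith a) (s , b) h′
    ...   | (refl , c) , here refl = refl , b∈ , c

    ∈-joinedBelow : ∀ m {p q} → (p , q) ∈ joinedBelow m →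
      (inA , p) ∈ elems t × (inB , q) ∈ elems t × acc V (inB , q) +ᴿ acc V (inA , p) ≤ᴿ 0#
    ∈-joinedBelow m h with find (∈-concatMap⁻ (visited inA V m partners) h)
    ... | (s , a) , a∈ , h′ with ∈-visited inA V m partners (s , a) h′
    ...   | (refl , _) , h″ with ∈-partners (inA , a) h″
    ...     | refl , b∈ , c = a∈ , b∈ , c

    joinedBelow-∈ : ∀ {m} → minimum inB V t ≡ just m → ∀ {p q} → (inA , p) ∈ elems t → (inB , q) ∈ elems t →
      acc V (inA , p) +ᴿ acc V (inB , q) ≤ᴿ 0# → (p , q) ∈ joinedBelow m
    joinedBelow-∈ {m} min {p} {q} a∈ b∈ c = ∈-concatMap⁺ (visited inA V m partners)
      (lose a∈ (visited-∈ V partners (inA , p) a+m≤0 (∈-concatMap⁺ (visited inB V (acc V (inA , p)) (pairWith (inA , p)))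
        (lose b∈ (visited-∈ V (pairWith (inA , p)) (inB , q) (subst (_≤ᴿ 0#) (ℝᶜ.+-comm _ _) c) (here refl))))))
      where
      -- An element with some partner passes the test against the minimum of B, so the outer search
      -- misses no pair.
      a+m≤0 : acc V (inA , p) +ᴿ m ≤ᴿ 0#
      a+m≤0 with minimum-≤ inB V t b∈ refl
      ... | m′ , min′ , m≤ with trans (sym min) min′
      ...   | refl = ≤ᴿ-trans (subst₂ _≤ᴿ_ (ℝᶜ.+-comm _ _) (ℝᶜ.+-comm _ _)
                       (+ᴿ-monoˡ-≤ (acc V (inA , p)) m≤)) c

    joinedBelow-unique : ∀ m → Unique (elems t) → Unique (joinedBelow m)
    joinedBelow-unique m u = concatMap-unique {f = visited inA V m partners} (λ x → inA , proj₁ x)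
      (λ {a} {x} h → let (s , _) , h′ = ∈-visited inA V m partners a h
                     in cong₂ _,_ (sym s) (proj₁ (∈-partners a h′)))
      (λ a → visited-unique inA V m partners a
        (concatMap-unique {f = visited inB V (acc V a) (pairWith a)} (λ x → inB , proj₂ x)
          (λ {b} h → let (s , _) , h′ = ∈-visited inB V (acc V a) (pairWith a) b h
                     in cong₂ _,_ (sym s) (second h′))
          (λ b → visited-unique inB V (acc V a) (pairWith a) b ([] ∷ [])) u)) u
      where
      second : ∀ {a b} {x : Pair} → x ∈ (a , b) ∷ [] → proj₂ x ≡ b
      second (here refl) = refl

    visitB-run : ∀ δ a e → sideOf e ≡ inB →
      Emits δ 30 true 10 (item V e ∷ reals (Vec.toList (proj₂ a)) ∷ []) (functions visitᶠ) (emitted (pairWith a e))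
    visitB-run δ a (inB , q) refl = eBusy (n≤1+n 9) (eCaseCell true refl (eCaseCell true refl (eCaseCell true refl
      (eAfter true rZero (eElse true refl refl 1≰0 (eAfter true rCons (eEmit {k = 0})))))))

    -- The minimum of B belongs to a partner of any element that has passed the outer test;
    -- therefore the inner search is flagged at its root and reports something.
    visitA-run : ∀ {δ m} e → minimum inB V t ≡ just m → sideOf e ≡ inA → acc V e +ᴿ m ≤ᴿ 0# →
      (10 + 100 * suc (height t)) + (10 + 100 * suc (height t)) ≤ δ →
      Emits δ 30 true (20 + 100 * suc (height t))
        (item V e ∷ enc {1} V t ∷ []) (functions visitᶠ) (emitted (partners e))
    visitA-run {δ} {m} e@(inA , p) min refl e+m≤0 a≤ =
      eBusy (n≤1+n _) (eCaseCell true refl (eCaseCell true refl (eCaseCell true refl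
        (eAfter true rZero (eThen true refl refl ≤ᴿ-refl (eAfter true rOne (eCall true inner)))))))
      where
      flagged : within? (minimum inB V t) (just (acc V e)) ≡ true
      flagged = trans (cong (λ m → within? m (just (acc V e))) min)
        (within?-true (subst (_≤ᴿ 0#) (ℝᶜ.+-comm _ _) e+m≤0))

      inner : Emits δ 30 true (10 + 100 * suc (height t))
        (real 1# ∷ real (acc V e) ∷ enc {1} V t ∷ reals (Vec.toList p) ∷ []) (functions travᶠ) (emitted (partners e))
      inner = eCast flagged refl (trav-run inB V (acc V e) (reals (Vec.toList p)) (pairWith e) δ 10 t
        (λ b _ s _ → visitB-run δ e b s) a≤)

  close-zero : ∀ (V : View 0) a b → Close V a b ⇔ (acc V a +ᴿ acc V b ≤ᴿ 0#)
  close-zero V a b = mk⇔ (subst (_≤ᴿ 0#) sum≡) (subst (_≤ᴿ 0#) (sym sum≡))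
    where
    norm≡ : ∀ (x y : Vec Carrier 0) → dist ℝ 0 x y ≡ 0#
    norm≡ [] [] = refl

    sum≡ : acc V a +ᴿ acc V b +ᴿ dist ℝ 0 (rem V a) (rem V b) ≡ acc V a +ᴿ acc V b
    sum≡ = trans (cong (acc V a +ᴿ acc V b +ᴿ_) (norm≡ (rem V a) (rem V b))) (ℝᶜ.+-identityʳ _)

  tip-pairs : ∀ {e : Elem} {p q} → (inA , p) ∈ e ∷ [] → ¬ (inB , q) ∈ e ∷ []
  tip-pairs (here refl) (here ())
  tip-pairs (here refl) (there ())

  enum-zero : ∀ (V : View 0) t → Good {1} V t → EnumRun V t (100 + 200 * suc (height t))
  enum-zero V empty G = [] , [] , (λ p q → mk⇔ (λ ()) λ { (() , _) }) , (λ _ → refl) , λ δ _ → unflagged V empty refl refl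
  enum-zero V (leaf e) G = [] , [] , (λ p q → mk⇔ (λ ()) λ { (a , b , _) → ⊥-elim (tip-pairs a b) }) ,
    (λ _ → refl) , λ δ _ → unflagged V (leaf e) refl refl
  enum-zero V t@(node w n q s f L R X Y) G = go (within? (minimum inA V t) (minimum inB V t)) refl
    where
    H = 100 * suc (height t)

    within?-just : ∀ a b → within? a b ≡ true → ∃[ m ] b ≡ just m
    within?-just (just _) (just m) _ = m , refl

    close⇒flag : ∀ {p q} → (inA , p) ∈ elems t → (inB , q) ∈ elems t →
      acc V (inA , p) +ᴿ acc V (inB , q) ≤ᴿ 0# → within? (minimum inA V t) (minimum inB V t) ≡ true
    close⇒flag {p} {q} a b c with minimum-≤ inA V t a refl | minimum-≤ inB V t b refl
    ... | mA , pA , mA≤ | mB , pB , mB≤ = trans (cong₂ within? pA pB) (within?-true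
      (≤ᴿ-trans (+ᴿ-monoˡ-≤ mB mA≤) (≤ᴿ-trans (subst₂ _≤ᴿ_ (ℝᶜ.+-comm _ _) (ℝᶜ.+-comm _ _)
        (+ᴿ-monoˡ-≤ (acc V (inA , p)) mB≤)) c)))

    go : ∀ c → within? (minimum inA V t) (minimum inB V t) ≡ c → EnumRun V t (100 + 200 * suc (height t))
    go false h = [] , [] ,
      (λ p q → mk⇔ (λ ()) λ { (a , b , c) → ⊥-elim (false≢true (trans (sym h)
        (close⇒flag a b (to (close-zero V (inA , p) (inB , q)) c)))) }) ,
      (λ _ → refl) , λ δ _ → unflagged V t h refl
      where
      false≢true : false ≢ true
      false≢true ()
    go true h = let m , pB = within?-just (minimum inA V t) (minimum inB V t) h in
      joinedBelow V t m , joinedBelow-unique V t m (unique G) ,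
      (λ p q → mk⇔
        (λ h → let a , b , c = ∈-joinedBelow V t m h
               in a , b , from (close-zero V (inA , p) (inB , q)) (subst (_≤ᴿ 0#) (ℝᶜ.+-comm _ _) c))
        (λ { (a , b , c) → joinedBelow-∈ V t pB a b (to (close-zero V (inA , p) (inB , q)) c) })) ,
      (λ h′ → ⊥-elim (true≢false (trans (sym h) h′))) ,
      λ δ a≤ → eCast (sym h) refl (eBusy
        (poly 1 (λ h → con 49 :+ (h :+ h) :≤ con 100 :+ con 2 :* h) (H ∷ [])
          ⟨≤⟩ ≤-reflexive (cong (100 +_) (sym (*-assoc 2 100 (suc (height t))))))
        (eAfter true (rCall (rCast (cong boolV h) (flag-run V t))) (eCaseReal true refl (eTreeNode true refl (eCaseCell true refl
          (eAfter true rZero (eCall true (outer m pB δ a≤))))))))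
      where
      true≢false : true ≢ false
      true≢false ()

      _⟨≤⟩_ : ∀ {a b c} → a ≤ b → b ≤ c → a ≤ c
      _⟨≤⟩_ = ≤-trans

      200H : 200 * suc (height t) ≡ 2 * H
      200H = *-assoc 2 100 (suc (height t))

      room : ∀ {δ} x → x ≤ 20 + H + H → (100 + 200 * suc (height t)) + (100 + 200 * suc (height t)) ≤ δ → x + x ≤ δ
      room x x≤ a≤ = ≤-trans (+-mono-≤ x≤′ x≤′) a≤
        where
        x≤′ : x ≤ 100 + 200 * suc (height t)
        x≤′ = ≤-trans x≤ (≤-trans (poly 1 (λ h → con 20 :+ h :+ h :≤ con 100 :+ con 2 :* h) (H ∷ []))
          (≤-reflexive (cong (100 +_) (sym 200H))))

      outer : ∀ m → minimum inB V t ≡ just m → ∀ δ → (100 + 200 * suc (height t)) + (100 + 200 * suc (height t)) ≤ δ →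
        Emits δ 30 true (20 + H + H) (real 0# ∷ maybeV (minimum inB V t) ∷ enc {1} V t ∷ enc {1} V t ∷ [])
          (functions travᶠ) (emitted (joinedBelow V t m))
      outer m pB δ a≤ = subst (λ v → Emits δ 30 true (20 + H + H)
        (real 0# ∷ maybeV v ∷ enc {1} V t ∷ enc {1} V t ∷ [])
          (functions travᶠ) (emitted (joinedBelow V t m))) (sym pB)
        (eCast (trans (cong (within? (minimum inA V t)) (sym pB)) h) refl
          (trav-run inA V m (enc {1} V t) (partners V t) δ (20 + H) t
            (λ e _ s c → visitA-run V t e pB s c (room (10 + H) (+-mono-≤ (≤ᵇ⇒≤ 10 20 tt) ≤-refl ⟨≤⟩ m≤m+n (20 + H) H) a≤))
            (room (20 + H + H) ≤-refl a≤)))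

  -- Enumeration at the other levels

  open CommutativeMonoidSolver ℝᶜ.+-commutativeMonoid using (solve; _⊕_; _⊜_; id)

  0≤x-y : ∀ {x y} → y ≤ᴿ x → 0# ≤ᴿ x -ᴿ y
  0≤x-y {x} {y} h = subst (_≤ᴿ x -ᴿ y) (ℝᶜ.-‿inverseʳ y) (+ᴿ-monoˡ-≤ (ℝᶜ.- y) h)

  abs-diff : ∀ {x y} → y ≤ᴿ x → ∣ x -ᴿ y ∣ᴿ ≡ x -ᴿ y
  abs-diff {x} {y} h with 0# ≤ᴿ? x -ᴿ y
  ... | yes _ = refl
  ... | no  n = ⊥-elim (n (0≤x-y h))

  neg-diff : ∀ x y → ℝᶜ.- (x -ᴿ y) ≡ y -ᴿ x
  neg-diff x y = trans (sym (ℝₚ.-‿+-comm x (ℝᶜ.- y))) (trans (ℝᶜ.+-comm _ _) (cong (_+ᴿ (ℝᶜ.- x)) (ℝₚ.-‿involutive y)))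

  abs-diff′ : ∀ {x y} → x ≤ᴿ y → ∣ x -ᴿ y ∣ᴿ ≡ y -ᴿ x
  abs-diff′ {x} {y} h with 0# ≤ᴿ? x -ᴿ y
  ... | no  _ = neg-diff x y
  -- Here x - y is both nonnegative and nonpositive, so it vanishes together with y - x.
  ... | yes p = trans (sym 0≡) (trans 0≡′ (ℝᶜ.+-identityˡ (y -ᴿ x)))
    where
    q : x -ᴿ y ≤ᴿ 0#
    q = subst (x -ᴿ y ≤ᴿ_) (ℝᶜ.-‿inverseʳ y) (+ᴿ-monoˡ-≤ (ℝᶜ.- y) h)

    0≡ : 0# ≡ x -ᴿ y
    0≡ = ≤ᴿ-antisym p q

    0≡′ : 0# ≡ 0# +ᴿ (y -ᴿ x)
    0≡′ = trans (sym (ℝᶜ.-‿inverseʳ (x -ᴿ y))) (cong₂ _+ᴿ_ (sym 0≡) (neg-diff x y))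

  dist-suc : ∀ {j} (xs ys : Vec Carrier (suc j)) →
    dist ℝ (suc j) xs ys ≡ ∣ Vec.head xs -ᴿ Vec.head ys ∣ᴿ +ᴿ dist ℝ j (Vec.tail xs) (Vec.tail ys)
  dist-suc (_ ∷ _) (_ ∷ _) = refl

  module _ {j : ℕ} (V : View (suc j)) where

    x₁ : Elem → Carrier
    x₁ e = Vec.head (rem V e)

    ≺⇒≤ : ∀ {e f} → e ≺[ V ] f → x₁ e ≤ᴿ x₁ f
    ≺⇒≤ {e} {f} h with rem V e | rem V f
    ≺⇒≤ (here n) | x ∷ _ | y ∷ _ = [ (λ h → h) , (λ h → ⊥-elim (n h)) ]′ (≤ᴿ-total x y)
    ≺⇒≤ (next _) | x ∷ _ | _ ∷ _ = ≤ᴿ-refl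

    ⊀⇒≥ : ∀ {e f} → ¬ e ≺[ V ] f → x₁ f ≤ᴿ x₁ e
    ⊀⇒≥ {e} {f} h with rem V e | rem V f
    ... | x ∷ _ | y ∷ _ with y ≤ᴿ? x
    ...   | yes p = p
    ...   | no  n = ⊥-elim (h (here n))

    -- Shifting 0 by both coordinates writes y - x and x - y in one form. Both directions then
    -- reduce to the same regrouping in a commutative monoid, in which the negated coordinate is an
    -- atom.
    close-sub : ∀ c p q →
      ∣ x₁ (inA , p) -ᴿ x₁ (inB , q) ∣ᴿ ≡ shift c (shift (dirOf c inB) 0# (x₁ (inB , q))) (x₁ (inA , p)) →
      Close V (inA , p) (inB , q) ⇔ Close (subview {suc j} c V) (inA , p) (inB , q)
    close-sub c p q h = mk⇔ (subst (_≤ᴿ 0#) sum≡) (subst (_≤ᴿ 0#) (sym sum≡))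
      where
      a = acc V (inA , p)
      b = acc V (inB , q)
      x = x₁ (inA , p)
      y = x₁ (inB , q)
      D = dist ℝ j (Vec.tail (rem V (inA , p))) (Vec.tail (rem V (inB , q)))

      regroup′ : ∀ x y → a +ᴿ b +ᴿ (0# +ᴿ y +ᴿ x +ᴿ D) ≡ a +ᴿ x +ᴿ (b +ᴿ y) +ᴿ D
      regroup′ x y = solve 5 (λ a b x y D → ((a ⊕ b) ⊕ (((id ⊕ y) ⊕ x) ⊕ D)) ⊜ (((a ⊕ x) ⊕ (b ⊕ y)) ⊕ D)) refl a b x y D

      regroup : ∀ c → a +ᴿ b +ᴿ (shift c (shift (dirOf c inB) 0# y) x +ᴿ D) ≡
                      shift c a x +ᴿ shift (dirOf c inB) b y +ᴿ D
      regroup left  = regroup′ (ℝᶜ.- x) y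
      regroup right = regroup′ x (ℝᶜ.- y)

      sum≡ : a +ᴿ b +ᴿ dist ℝ (suc j) (rem V (inA , p)) (rem V (inB , q)) ≡
             shift c a x +ᴿ shift (dirOf c inB) b y +ᴿ D
      sum≡ = trans (cong (a +ᴿ b +ᴿ_) (trans (dist-suc (rem V (inA , p)) (rem V (inB , q))) (cong (_+ᴿ D) h))) (regroup c)

    -- The splitter separates the first coordinates, x₁ of a ≤ x₁ of s ≤ x₁ of b, and thereby fixes
    -- the sign of their difference.
    close-left : ∀ {p q s} → (inA , p) ≺[ V ] s → ¬ (inB , q) ≺[ V ] s →
      Close V (inA , p) (inB , q) ⇔ Close (subview {suc j} left V) (inA , p) (inB , q)
    close-left {p} {q} h h′ = close-sub left p q (trans (abs-diff′ (≤ᴿ-trans (≺⇒≤ h) (⊀⇒≥ h′)))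
      (cong (_-ᴿ x₁ (inA , p)) (sym (ℝᶜ.+-identityˡ _))))

    close-right : ∀ {p q s} → ¬ (inA , p) ≺[ V ] s → (inB , q) ≺[ V ] s →
      Close V (inA , p) (inB , q) ⇔ Close (subview {suc j} right V) (inA , p) (inB , q)
    close-right {p} {q} h h′ = close-sub right p q (trans (abs-diff (≤ᴿ-trans (≺⇒≤ h′) (⊀⇒≥ h)))
      (trans (ℝᶜ.+-comm _ _) (cong (_+ᴿ x₁ (inA , p)) (sym (ℝᶜ.+-identityˡ _)))))

  ∨-false : ∀ {a b} → a ∨ b ≡ false → a ≡ false × b ≡ false
  ∨-false {a} h = ∨-conicalˡ a _ h , ∨-conicalʳ a _ h

  module _ {j ℓ : ℕ} (enumSub : (V : View j) (X : St (suc j)) → Good {suc j} V X → count X + 3 ≤ 2 ^ ℓ →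
                                EnumRun V X (enumCost j ℓ)) where

    E = enumCost j ℓ

    enum-suc : (V : View (suc j)) (t : St (suc (suc j))) → Good {suc (suc j)} V t → count t + 3 ≤ 2 ^ ℓ →
               EnumRun V t (E + 320 * suc (height t))
    enum-suc V empty _ _ = [] , [] , (λ p q → mk⇔ (λ ()) λ { (() , _) }) , (λ _ → refl) , λ δ _ → unflagged V empty refl refl
    enum-suc V (leaf e) _ _ = [] , [] , (λ p q → mk⇔ (λ ()) λ { (a , b , _) → ⊥-elim (tip-pairs a b) }) ,
      (λ _ → refl) , λ δ _ → unflagged V (leaf e) refl refl
    enum-suc V t@(node w n q s f L R X Y) G@(node GL GR GX GY L≺ R⊀ RX RY _) c≤ =
      psL ++ (psR ++ (psX ++ psY)) ,
      Uniqueₚ.++⁺ uL (Uniqueₚ.++⁺ uR (Uniqueₚ.++⁺ uX uY disjXY) disjR) disjL ,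
      (λ p q → mk⇔ (sound p q) (complete p q)) ,
      none ,
      λ δ a≤ → flagged δ a≤ (flag {suc (suc j)} V t) refl
      where
      fits : ∀ {c} → c ≤ count t → c + 3 ≤ 2 ^ ℓ
      fits h = ≤-trans (+-monoˡ-≤ 3 h) c≤

      open Node w n q s f L R X Y

      EL = enum-suc V L GL (fits countˡ)
      ER = enum-suc V R GR (fits countʳ)
      EX = enumSub (subview {suc j} left V) X GX (fits (card-≤ (subview {suc j} left V) X GX RX joined-∈))
      EY = enumSub (subview {suc j} right V) Y GY (fits (card-≤ (subview {suc j} right V) Y GY RY joined-∈))
      psL = proj₁ EL
      psR = proj₁ ER
      psX = proj₁ EX
      psY = proj₁ EY
      uL = proj₁ (proj₂ EL)
      uR = proj₁ (proj₂ ER)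
      uX = proj₁ (proj₂ EX)
      uY = proj₁ (proj₂ EY)
      mL = proj₁ (proj₂ (proj₂ EL))
      mR = proj₁ (proj₂ (proj₂ ER))
      mX = proj₁ (proj₂ (proj₂ EX))
      mY = proj₁ (proj₂ (proj₂ EY))

      apart : ∀ {e} → e ∈ elems L → ¬ e ∈ elems R
      apart h h′ = R⊀ h′ (L≺ h)

      inL : ∀ {p q} → (p , q) ∈ psL → (inA , p) ∈ elems L × (inB , q) ∈ elems L
      inL h = let a , b , _ = to (mL _ _) h in a , b

      inR : ∀ {p q} → (p , q) ∈ psR → (inA , p) ∈ elems R × (inB , q) ∈ elems R
      inR h = let a , b , _ = to (mR _ _) h in a , b

      inX : ∀ {p q} → (p , q) ∈ psX → (inA , p) ∈ elems L × (inB , q) ∈ elems R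
      inX h with to (mX _ _) h
      ... | a , b , _ with to (RX _) a | to (RX _) b
      ...   | inj₁ (a′ , _) | inj₂ (b′ , _) = a′ , b′
      ...   | inj₂ (_ , ()) | _
      ...   | _ | inj₁ (_ , ())

      inY : ∀ {p q} → (p , q) ∈ psY → (inA , p) ∈ elems R × (inB , q) ∈ elems L
      inY h with to (mY _ _) h
      ... | a , b , _ with to (RY _) a | to (RY _) b
      ...   | inj₂ (a′ , _) | inj₁ (b′ , _) = a′ , b′
      ...   | inj₁ (_ , ()) | _
      ...   | _ | inj₂ (_ , ())

      disjXY : ∀ {v} → ¬ (v ∈ psX × v ∈ psY)
      disjXY (h , h′) = apart (proj₁ (inX h)) (proj₁ (inY h′))

      disjR : ∀ {v} → ¬ (v ∈ psR × v ∈ psX ++ psY)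
      disjR (h , h′) = [ (λ h′ → apart (proj₁ (inX h′)) (proj₁ (inR h)))
                       , (λ h′ → apart (proj₂ (inY h′)) (proj₂ (inR h))) ]′ (∈-++⁻ psX h′)

      disjL : ∀ {v} → ¬ (v ∈ psL × v ∈ psR ++ (psX ++ psY))
      disjL (h , h′) with ∈-++⁻ psR h′
      ... | inj₁ h″ = apart (proj₁ (inL h)) (proj₁ (inR h″))
      ... | inj₂ h″ = [ (λ h′ → apart (proj₂ (inL h)) (proj₂ (inX h′)))
                      , (λ h′ → apart (proj₁ (inL h)) (proj₁ (inY h′))) ]′ (∈-++⁻ psX h″)

      sound : ∀ p q → (p , q) ∈ psL ++ (psR ++ (psX ++ psY)) →
              (inA , p) ∈ elems t × (inB , q) ∈ elems t × Close V (inA , p) (inB , q)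
      sound p q h with ∈-++⁻ psL h
      ... | inj₁ h = let a , b , c = to (mL p q) h in ∈-++⁺ˡ a , ∈-++⁺ˡ b , c
      ... | inj₂ h with ∈-++⁻ psR h
      ...   | inj₁ h = let a , b , c = to (mR p q) h in ∈-++⁺ʳ (elems L) a , ∈-++⁺ʳ (elems L) b , c
      ...   | inj₂ h with ∈-++⁻ psX h
      ...     | inj₁ h = let a , b = inX h ; _ , _ , c = to (mX p q) h in
        ∈-++⁺ˡ a , ∈-++⁺ʳ (elems L) b , from (close-left V (L≺ a) (R⊀ b)) c
      ...     | inj₂ h = let a , b = inY h ; _ , _ , c = to (mY p q) h in
        ∈-++⁺ʳ (elems L) a , ∈-++⁺ˡ b , from (close-right V (R⊀ a) (L≺ b)) c

      complete : ∀ p q → (inA , p) ∈ elems t × (inB , q) ∈ elems t × Close V (inA , p) (inB , q) →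
                 (p , q) ∈ psL ++ (psR ++ (psX ++ psY))
      complete p q (a , b , c) with ∈-++⁻ (elems L) a | ∈-++⁻ (elems L) b
      ... | inj₁ a | inj₁ b = ∈-++⁺ˡ (from (mL p q) (a , b , c))
      ... | inj₂ a | inj₂ b = ∈-++⁺ʳ psL (∈-++⁺ˡ (from (mR p q) (a , b , c)))
      ... | inj₁ a | inj₂ b = ∈-++⁺ʳ psL (∈-++⁺ʳ psR (∈-++⁺ˡ (from (mX p q)
        (from (RX _) (inj₁ (a , refl)) , from (RX _) (inj₂ (b , refl)) , to (close-left V (L≺ a) (R⊀ b)) c))))
      ... | inj₂ a | inj₁ b = ∈-++⁺ʳ psL (∈-++⁺ʳ psR (∈-++⁺ʳ psX (from (mY p q)
        (from (RY _) (inj₂ (a , refl)) , from (RY _) (inj₁ (b , refl)) , to (close-right V (R⊀ a) (L≺ b)) c))))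

      fL = flag {suc (suc j)} V L
      fR = flag {suc (suc j)} V R
      fX = flag {suc j} (subview {suc j} left V) X
      fY = flag {suc j} (subview {suc j} right V) Y

      none : (fL ∨ fR) ∨ (fX ∨ fY) ≡ false → psL ++ (psR ++ (psX ++ psY)) ≡ []
      none h = let h₁ , h₂ = ∨-false {fL ∨ fR} h
                   hL , hR = ∨-false {fL} h₁
                   hX , hY = ∨-false {fX} h₂
               in cong₂ _++_ (proj₁ (proj₂ (proj₂ (proj₂ EL))) hL) (cong₂ _++_ (proj₁ (proj₂ (proj₂ (proj₂ ER))) hR)
                    (cong₂ _++_ (proj₁ (proj₂ (proj₂ (proj₂ EX))) hX) (proj₁ (proj₂ (proj₂ (proj₂ EY))) hY)))

      H = E + 320 * suc (height L ⊔ height R)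

      emitted≡ : emitted (psL ++ (psR ++ (psX ++ psY))) ≡ emitted psL ++ (emitted psR ++ (emitted psX ++ emitted psY))
      emitted≡ = trans (map-++ (encodePair ℝ d) psL _) (cong (emitted psL ++_)
        (trans (map-++ (encodePair ℝ d) psR _) (cong (emitted psR ++_) (map-++ (encodePair ℝ d) psX _))))

      reassoc : fL ∨ (fR ∨ (fX ∨ fY)) ≡ (fL ∨ fR) ∨ (fX ∨ fY)
      reassoc = sym (∨-assoc fL fR (fX ∨ fY))

      flagged : ∀ δ → (E + 320 * suc (height t)) + (E + 320 * suc (height t)) ≤ δ → ∀ b → flag {suc (suc j)} V t ≡ b →
        Emits δ 30 (flag {suc (suc j)} V t) (E + 320 * suc (height t)) (enc {suc (suc j)} V t ∷ []) (functions enumᶠ)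
          (emitted (psL ++ (psR ++ (psX ++ psY))))
      flagged δ a≤ false h = unflagged V t h (none h)
      flagged δ a≤ true  h = eCast (sym h) (sym emitted≡) (eBusy
        (poly 1 (λ H → con 312 :+ (H) :≤ H :+ con 320) (H ∷ []) ⟨≤⟩ H≤)
        (eAfter true (rCall (rCast (cong boolV h) (flag-run V t))) (eCaseReal true refl (eTreeNode true refl
          (eCaseReal true (cong boolV h) parts)))))
        where
        _⟨≤⟩_ : ∀ {a b c} → a ≤ b → b ≤ c → a ≤ c
        _⟨≤⟩_ = ≤-trans

        H≤ : H + 320 ≤ E + 320 * suc (height t)
        H≤ = poly 2 (λ e h → e :+ con 320 :* (con 1 :+ h) :+ con 320
          :≤ e :+ con 320 :* (con 2 :+ h)) (E ∷ height L ⊔ height R ∷ [])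

        room : ∀ {x} → x ≤ H + 320 → x + x ≤ δ
        room x≤ = ≤-trans (+-mono-≤ (≤-trans x≤ H≤) (≤-trans x≤ H≤)) a≤

        part : ∀ b {n} {ρ : Vec Val n} {i k vs a} → a ≤ H → lookup ρ i ≡ k →
          (∀ δ → a + a ≤ δ → Emits δ 30 b a (k ∷ []) (functions enumᶠ) vs) →
          Emits δ 31 b (suc H) ρ (call enumᶠ (i ∷ [])) vs
        part b a≤ refl D = eCall b (eWeaken b ≤-refl a≤ (D δ (room (≤-trans a≤ (m≤m+n H 320)))))

        smaller : ∀ {h} → h ≤ height L ⊔ height R → E + 320 * suc h ≤ H
        smaller h≤ = +-monoʳ-≤ E (*-monoʳ-≤ 320 (s≤s h≤))

        emission : ∀ {j} {V : View j} {t a} (r : EnumRun V t a) → ∀ δ → a + a ≤ δ →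
          Emits δ 30 (flag {suc j} V t) a (enc {suc j} V t ∷ []) (functions enumᶠ) (emitted (proj₁ r))
        emission (_ , _ , _ , _ , D) = D

        grow : ∀ m {k b n} {ρ : Vec Val n} {e vs} → Emits δ k b (suc H) ρ e vs → Emits δ k b (m + suc H) ρ e vs
        grow m {b = b} = eWeaken b ≤-refl (m≤n+m (suc H) m)

        XY : ∀ {n} {ρ : Vec Val n} {i i′} → lookup ρ i ≡ enc {suc j} (subview {suc j} left V) X →
             (∀ {v} → lookup (v ∷ ρ) i′ ≡ enc {suc j} (subview {suc j} right V) Y) →
             Emits δ 63 (fX ∨ fY) (63 + suc H) ρ (letIn (call enumᶠ (i ∷ [])) (call enumᶠ
               (i′ ∷ []))) (emitted psX ++ emitted psY)
        XY p p′ = eLet fX fY (room (≤-trans (≤-reflexive (+-comm 1 H)) (+-monoʳ-≤ H (s≤s z≤n))))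
          (part fX (m≤m+n E _) p (emission EX)) (λ v → part fY (m≤m+n E _) p′ (emission EY))

        parts = eCast (trans reassoc h) refl
          (eLet fL (fR ∨ (fX ∨ fY)) (room (poly 1 (λ H → con 159 :+ H :≤ H :+ con 320) (H ∷ [])))
            (grow 158 (part fL (smaller (m≤m⊔n _ _)) refl (emission EL)))
            (λ v → eLet fR (fX ∨ fY) (room (poly 1 (λ H → con 64 :+ H :≤ H :+ con 320) (H ∷ [])))
              (grow 63 (part fR (smaller (m≤n⊔m (height L) _)) refl (emission ER)))
              (λ v′ → XY refl refl)))

  enum-weaken : ∀ {j} {V : View j} {t a a′} → a ≤ a′ → EnumRun V t a → EnumRun V t a′
  enum-weaken {V = V} {t} a≤ (ps , u , m , e , D) = ps , u , m , e ,
    λ δ h → eWeaken (flag V t) ≤-refl a≤ (D δ (≤-trans (+-mono-≤ a≤ a≤) h))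

  suc-height : ∀ {j S V GX GY Rep} {t : Tree S} ℓ → TreeGood {j} V GX GY Rep t → count t + 3 ≤ 2 ^ ℓ →
               suc (height t) ≤ 3 * ℓ + 4
  suc-height ℓ G c≤ = ≤-trans (s≤s (height-bound {ℓ = ℓ} G c≤)) (≤-reflexive (sym (+-suc (3 * ℓ) 3)))

  enum-run : ∀ j ℓ (V : View j) (t : St (suc j)) → Good {suc j} V t → count t + 3 ≤ 2 ^ ℓ →
             EnumRun V t (enumCost j ℓ)
  enum-run zero    ℓ V t G c≤ = enum-weaken (+-monoʳ-≤ 100 (*-monoʳ-≤ 200 (suc-height ℓ G c≤))) (enum-zero V t G)
  enum-run (suc j) ℓ V t G c≤ = enum-weaken (+-monoʳ-≤ (enumCost j ℓ) (*-monoʳ-≤ 320 (suc-height ℓ G c≤)))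
    (enum-suc (enum-run j ℓ) V t G c≤)

  -- Space

  itemSize : ℕ → ℕ
  itemSize j = 2 * j + 2 * d + 8

  levelSize sizeCost : ℕ → ℕ → ℕ
  levelSize j ℓ = 3 * itemSize j + 4 * sizeCost j ℓ + 30
  sizeCost zero    ℓ = 1
  sizeCost (suc j) ℓ = (3 * ℓ + 4) * levelSize j ℓ + 1

  size-reals : ∀ xs → size ℝ (reals xs) ≡ 2 * length xs + 1
  size-reals []       = refl
  size-reals (x ∷ xs) rewrite size-reals xs = regroup (length xs)
    where
    regroup : ∀ n → 2 + (2 * n + 1) ≡ 2 * suc n + 1
    regroup = Ring.solve-∀

  size-item : ∀ {j} (V : View j) e → size ℝ (item V e) ≤ itemSize j
  size-item {j} V e@(_ , p)
    rewrite size-reals (Vec.toList (rem V e)) | length-toList (rem V e) | size-reals (Vec.toList p) | length-toList p =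
    poly 2 (λ j d → con 1 :+ (con 2 :* j :+ con 1 :+ (con 4 :+ (con 2 :* d :+ con 1)))
      :≤ con 2 :* j :+ con 2 :* d :+ con 8)
      (j ∷ d ∷ [])

  size-items : ∀ {j} (V : View j) es → size ℝ (items V es) ≤ length es * suc (itemSize j) + 1
  size-items V []       = ≤-refl
  size-items {j} V (e ∷ es) = s≤s (≤-trans (+-mono-≤ (size-item V e) (size-items V es))
    (≤-reflexive (sym (+-assoc (itemSize j) (length es * suc (itemSize j)) 1))))

  size-maybe : ∀ m → size ℝ (maybeV m) ≡ 1
  size-maybe nothing  = refl
  size-maybe (just _) = refl

  size-sum : ∀ {j} (V : View j) (t : St (suc j)) → size ℝ (sumV V t) ≤ 3
  size-sum {zero}  V t rewrite size-maybe (minimum inA V t) | size-maybe (minimum inB V t) = ≤-refl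
  size-sum {suc j} V t with flag {suc (suc j)} V t
  ... | true  = s≤s z≤n
  ... | false = s≤s z≤n

  -- Each of the two secondary structures is charged for all `c` elements although they share them,
  -- which costs a constant factor. `1 ≤ c` turns the bounds in `c + 1` into multiples of `c`, so
  -- that the totals of the two children add up.
  size-price : ∀ K b h c l r {s f m xs ys ls rs n} → 1 ≤ c → c ≡ l + r →
    s ≤ K → f ≤ n * suc K + 1 → n ≤ suc c → m ≤ 3 → xs ≤ b * (c + 1) → ys ≤ b * (c + 1) →
    ls ≤ suc h * (l * (3 * K + 4 * b + 30)) + 1 → rs ≤ suc h * (r * (3 * K + 4 * b + 30)) + 1 →
    suc (suc (s + f) + suc (m + suc (suc (ls + rs) + suc (xs + ys)))) ≤ suc (suc h) * (c * (3 * K + 4 * b + 30)) + 1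
  size-price K b h c l r {s} {f} {m} {xs} {ys} {ls} {rs} {n} 1≤c c≡ s≤ f≤ n≤ m≤ x≤ y≤ l≤ r≤ = ≤-trans
    (s≤s (+-mono-≤ (s≤s (+-mono-≤ s≤ (≤-trans f≤ (+-monoˡ-≤ 1 (*-monoˡ-≤ (suc K) n≤)))))
      (s≤s (+-mono-≤ m≤ (s≤s (+-mono-≤ (s≤s (+-mono-≤ l≤ r≤)) (s≤s (+-mono-≤ x≤ y≤))))))))
    (cancel (+-mono-≤ (*-monoʳ-≤ (2 * K + 2 * b + 20) 1≤c) (*-monoˡ-≤ (suc h * (3 * K + 4 * b + 30)) (≤-reflexive (sym c≡))))
      (poly 6 (λ K b h c l r →
        let M = con 3 :* K :+ con 4 :* b :+ con 30 in
        con 2 :+ (K :+ ((con 1 :+ c) :* (con 1 :+ K) :+ con 1) :+ (con 5 :+ (con 1 :+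
          ((con 1 :+ h) :* (l :* M) :+ con 1 :+ ((con 1 :+ h) :* (r :* M) :+ con 1)) :+
            (con 1 :+ (b :* (c :+ con 1) :+ b :* (c :+ con 1))))))
        :+ ((con 2 :* K :+ con 2 :* b :+ con 20) :* c :+ c :* ((con 1 :+ h) :* M))
        :≤ (con 2 :+ h) :* (c :* M) :+ con 1 :+ ((con 2 :* K :+ con 2 :* b :+ con 20) :* con 1 :+ (l :+ r) :* ((con 1 :+ h) :* M)))
        (K ∷ b ∷ h ∷ c ∷ l ∷ r ∷ [])))

  SizeBound : ℕ → ℕ → Set
  SizeBound j ℓ = (V : ViewOf j) (X : St j) → Good V X → card X + 3 ≤ 2 ^ ℓ →
    size ℝ (enc V X) ≤ sizeCost j ℓ * (card X + 1)

  size-tree : ∀ {j} ℓ → SizeBound j ℓ →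
    (V : View j) (t : St (suc j)) → Good {suc j} V t → count t + 3 ≤ 2 ^ ℓ →
    size ℝ (enc {suc j} V t) ≤ suc (height t) * (count t * levelSize j ℓ) + 1
  size-tree ℓ sec V empty _ _ = ≤-refl
  size-tree {j} ℓ sec V (leaf e) _ _ = ≤-trans (s≤s (s≤s (size-item V e)))
    (poly 2 (λ K b → con 2 :+ K
      :≤ con 1 :* (con 1 :* (con 3 :* K :+ con 4 :* b :+ con 30)) :+ con 1) (itemSize j ∷ sizeCost j ℓ ∷ []))
  size-tree {j} ℓ sec V t@(node w n q s f L R X Y) G@(node GL GR GX GY _ _ RX RY σ) c≤ =
    size-price (itemSize j) (sizeCost j ℓ) (height L ⊔ height R) (count t) (count L) (count R)
      (≤-trans (child-nonempty σ (Shape.left≥ σ)) countˡ) count≡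
      (size-item V s) (size-items V f) fuel (size-sum V t)
      (secondary (subview left V) X GX (card-≤ (subview left V) X GX RX joined-∈))
      (secondary (subview right V) Y GY (card-≤ (subview right V) Y GY RY joined-∈))
      (child L GL countˡ (m≤m⊔n (height L) (height R)))
      (child R GR countʳ (m≤n⊔m (height L) (height R)))
    where
    open Node w n q s f L R X Y

    fits : ∀ {c} → c ≤ count t → c + 3 ≤ 2 ^ ℓ
    fits h = ≤-trans (+-monoˡ-≤ 3 h) c≤

    child : ∀ c → Good {suc j} V c → count c ≤ count t → ∀ {h} → height c ≤ h →
      size ℝ (enc {suc j} V c) ≤ suc h * (count c * levelSize j ℓ) + 1
    child c G c≤ h≤ = ≤-trans (size-tree ℓ sec V c G (fits c≤))
      (+-monoˡ-≤ 1 (*-monoˡ-≤ (count c * levelSize j ℓ) (s≤s h≤)))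

    secondary : ∀ V X → Good V X → card X ≤ count t → size ℝ (enc V X) ≤ sizeCost j ℓ * (count t + 1)
    secondary V X G h = ≤-trans (sec V X G (fits h)) (*-monoʳ-≤ (sizeCost j ℓ) (+-monoˡ-≤ 1 h))

    -- The fuel is an eighth of the count at birth, but space is measured by the present count;
    -- `n-bound` links the two.
    fuel : length f ≤ suc (count t)
    fuel = *-cancelˡ-≤ 24 (cancel (+-mono-≤ (*-monoʳ-≤ 3 (Shape.fuel≤ σ))
      (+-mono-≤ (n-bound σ) (≤-reflexive (cong (24 *_) (sym count≡)))))
      (poly 5 (λ f q n c c′ → con 24 :* f :+ (con 3 :* n :+ (con 4 :* c :+ con 4 :+ con 24 :* c′))
          :≤ con 24 :* (con 1 :+ c′) :+ (con 3 :* (con 8 :* (q :+ f)) :+ (con 3 :* n :+ con 24 :* c)))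
        (length f ∷ q ∷ n ∷ count L + count R ∷ count t ∷ [])))

  size-run : ∀ j ℓ → SizeBound j ℓ
  size-run zero    ℓ V X G c≤ = ≤-refl
  size-run (suc j) ℓ V t G c≤ = ≤-trans (size-tree ℓ (size-run j ℓ) V t G c≤)
    (≤-trans (+-monoˡ-≤ 1 (*-monoˡ-≤ (count t * levelSize j ℓ) (suc-height ℓ G c≤)))
      (poly 3 (λ h c M → h :* (c :* M) :+ con 1
        :≤ (h :* M :+ con 1) :* (c :+ con 1)) (3 * ℓ + 4 ∷ count t ∷ levelSize j ℓ ∷ [])))

  -- Orders of growth

  -- Restricting to `1 ≤ ℓ` allows constants and lower powers to be absorbed without an additive
  -- term; this is what the shift in `polylog` provides for.
  record Order (k : ℕ) (f : ℕ → ℕ) : Set where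
    constructor _,_
    field
      constant : ℕ
      bound    : ∀ ℓ → 1 ≤ ℓ → f ℓ ≤ constant * ℓ ^ k

  power≥1 : ∀ {ℓ} k → 1 ≤ ℓ → 1 ≤ ℓ ^ k
  power≥1 {suc ℓ} k _ = m^n>0 (suc ℓ) k

  order-const : ∀ k c → Order k (λ _ → c)
  order-const k c = c , λ ℓ h → ≤-trans (≤-reflexive (sym (*-identityʳ c))) (*-monoʳ-≤ c (power≥1 k h))

  order-raise : ∀ {k k′ f} → k ≤ k′ → Order k f → Order k′ f
  order-raise {k} {k′} k≤ (C , h) = C , λ { ℓ@(suc _) p → ≤-trans (h ℓ p) (*-monoʳ-≤ C (^-monoʳ-≤ ℓ k≤)) }

  order-+ : ∀ {k f g} → Order k f → Order k g → Order k (λ ℓ → f ℓ + g ℓ)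
  order-+ {k} (C , h) (C′ , h′) = C + C′ , λ ℓ p →
    ≤-trans (+-mono-≤ (h ℓ p) (h′ ℓ p)) (≤-reflexive (sym (*-distribʳ-+ (ℓ ^ k) C C′)))

  order-* : ∀ {k f} c → Order k f → Order k (λ ℓ → c * f ℓ)
  order-* {k} c (C , h) = c * C , λ ℓ p →
    ≤-trans (*-monoʳ-≤ c (h ℓ p)) (≤-reflexive (sym (*-assoc c C (ℓ ^ k))))

  order-linear : ∀ {k f} a b → Order k f → Order (suc k) (λ ℓ → (a * ℓ + b) * f ℓ)
  order-linear {k} a b (C , h) = (a + b) * C , λ ℓ p → ≤-trans
    (*-mono-≤ (≤-trans (+-monoʳ-≤ (a * ℓ) (≤-trans (≤-reflexive (sym (*-identityʳ b))) (*-monoʳ-≤ b p)))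
      (≤-reflexive (sym (*-distribʳ-+ ℓ a b)))) (h ℓ p))
    (≤-reflexive (regroup (a + b) ℓ C (ℓ ^ k)))
    where
    regroup : ∀ a ℓ C x → a * ℓ * (C * x) ≡ a * C * (ℓ * x)
    regroup = Ring.solve-∀

  ^-distribʳ-* : ∀ k a b → (a * b) ^ k ≡ a ^ k * b ^ k
  ^-distribʳ-* zero    a b = refl
  ^-distribʳ-* (suc k) a b = trans (cong (a * b *_) (^-distribʳ-* k a b)) (regroup a b (a ^ k) (b ^ k))
    where
    regroup : ∀ a b x y → a * b * (x * y) ≡ a * x * (b * y)
    regroup = Ring.solve-∀

  order-shift : ∀ {k f} a → Order k f → Order k (λ ℓ → f (a + ℓ))
  order-shift {k} a (C , h) = C * suc a ^ k , λ ℓ p → ≤-trans (h (a + ℓ) (≤-trans p (m≤n+m ℓ a)))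
    (≤-trans (*-monoʳ-≤ C (≤-trans
      (^-monoˡ-≤ k (≤-trans (+-monoˡ-≤ ℓ (≤-trans (≤-reflexive (sym (*-identityʳ a))) (*-monoʳ-≤ a p))) (≤-reflexive (+-comm (a * ℓ) ℓ))))
      (≤-reflexive (^-distribʳ-* k (suc a) ℓ))))
    (≤-reflexive (sym (*-assoc C (suc a ^ k) (ℓ ^ k)))))

  order-≡ : ∀ {k f g} → (∀ ℓ → g ℓ ≡ f ℓ) → Order k f → Order k g
  order-≡ g≡ (C , h) = C , λ ℓ p → ≤-trans (≤-reflexive (g≡ ℓ)) (h ℓ p)

  suc≡ : ∀ ℓ x → suc ℓ * x ≡ (1 * ℓ + 1) * x
  suc≡ = Ring.solve-∀

  β-order : ∀ j → Order j (β j)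
  β-order zero    = order-const 0 0
  β-order (suc j) = order-+ (order-≡ (λ ℓ → suc≡ ℓ _) (order-linear 1 1
    (order-+ (order-const j sortCost) (order-+ (order-* 2 (β-order j)) (order-const j 200)))))
    (order-const (suc j) 11)

  W-order : ∀ j → Order (suc j) (W j)
  W-order j = order-* 10 (order-+ (order-const (suc j) (stepCost + 60)) (order-≡ (λ ℓ → suc≡ ℓ _)
    (order-linear 1 1 (order-+ (order-* 2 (β-order j)) (order-const j 200)))))

  -- The height contributes one factor. Of the remaining summands `u j` has exponent `2 * j` and
  -- `W j` has `suc j`, and `suc (2 * j)` is a common bound.
  u-order : ∀ j → Order (2 * j) (u j)
  u-order zero    = order-const 0 0
  u-order (suc j) = subst (λ k → Order k (u (suc j))) (sym (cong suc (+-suc j (j + 0)))) (order-linear 3 4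
    (order-+ (order-+ (order-const (suc (2 * j)) (compareCost + 300)) (order-raise (n≤1+n _) (u-order j)))
      (order-raise (s≤s (m≤m+n j (j + 0))) (order-shift 3 (W-order j)))))

  sizeCost-order : ∀ j → Order j (sizeCost j)
  sizeCost-order zero    = order-const 0 1
  sizeCost-order (suc j) = order-+ (order-linear 3 4 (order-+ (order-+ (order-const j (3 * itemSize j))
    (order-* 4 (sizeCost-order j))) (order-const j 30))) (order-const (suc j) 1)

  order-3ℓ+4 : Order 1 (λ ℓ → 3 * ℓ + 4)
  order-3ℓ+4 = order-≡ (λ ℓ → sym (*-identityʳ _)) (order-linear 3 4 (order-const 0 1))

  enumCost-order : ∀ j → Order 1 (enumCost j)
  enumCost-order zero    = order-+ (order-const 1 100) (order-* 200 order-3ℓ+4)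
  enumCost-order (suc j) = order-+ (enumCost-order j) (order-* 320 order-3ℓ+4)

  n≤2^⌈log₂n⌉ : ∀ n → n ≤ 2 ^ ⌈log₂ n ⌉
  n≤2^⌈log₂n⌉ = <-rec (λ n → n ≤ 2 ^ ⌈log₂ n ⌉) λ
    { zero          _   → z≤n
    ; (suc zero)    _   → m^n>0 2 ⌈log₂ 1 ⌉
    ; n@(suc (suc m)) rec → begin
        n                               ≡⟨ ⌊n/2⌋+⌈n/2⌉≡n n ⟨
        ⌊ n /2⌋ + ⌈ n /2⌉               ≤⟨ +-monoˡ-≤ ⌈ n /2⌉ (⌊n/2⌋≤⌈n/2⌉ n) ⟩
        ⌈ n /2⌉ + ⌈ n /2⌉               ≡⟨ cong (⌈ n /2⌉ +_) (sym (+-identityʳ _)) ⟩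
        2 * ⌈ n /2⌉                     ≤⟨ *-monoʳ-≤ 2 (rec (⌈n/2⌉<n m)) ⟩
        2 ^ suc ⌈log₂ ⌈ n /2⌉ ⌉         ≡⟨ cong (λ k → 2 ^ suc k) (⌈log₂⌈n/2⌉⌉≡⌈log₂n⌉∸1 n) ⟩
        2 ^ suc (⌈log₂ n ⌉ ∸ 1)         ≡⟨ cong (2 ^_) (m+[n∸m]≡n (⌈log₂⌉-mono-≤ {2} {n} (s≤s (s≤s z≤n)))) ⟩
        2 ^ ⌈log₂ n ⌉                   ∎ }
    where open ≤-Reasoning

  lg : ℕ → ℕ
  lg n = ⌈log₂ (2 + n) ⌉

  lg≥1 : ∀ n → 1 ≤ lg n
  lg≥1 n = ⌈log₂⌉-mono-≤ {2} {2 + n} (s≤s (s≤s z≤n))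

  -- An update is charged at the cardinality after it, whereas the tree it meets may hold one
  -- element more if it is a deletion; hence `suc m`.
  lg-fits : ∀ {c} m → c ≤ suc m → c + 4 ≤ 2 ^ (2 + lg m)
  lg-fits {c} m c≤ = ≤-trans (cancel (+-mono-≤ c≤ z≤n)
      (poly 2 (λ c m → c :+ con 4 :+ (con 1 :+ m :+ con 0) :≤ con 4 :* (con 2 :+ m) :+ (c :+ con 0)) (c ∷ m ∷ [])))
    (≤-trans (*-monoʳ-≤ 4 (n≤2^⌈log₂n⌉ (2 + m))) (≤-reflexive (*-assoc 2 2 (2 ^ lg m))))

  -- From trees to the states of the data structure

  -- The threshold is hidden in the contributions of B, so that every later test compares with 0 and
  -- the trees need not know r.
  initial : Carrier → View d
  initial r = record
    { acc = λ { (inA , _) → 0# ; (inB , _) → 0# -ᴿ r }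
    ; rem = proj₂
    }

  _≟ₑ_ : ∀ (e e′ : Point ℝ d) → Dec (e ≡ e′)
  _≟ₑ_ = _≟ₚ_ ℝ d

  open DecMembership _≟ₑ_ using (_∈?_)

  InState : State ℝ d → Elem → Set
  InState (A , B) (inA , p) = p ∈ A
  InState (A , B) (inB , p) = p ∈ B

  UpdatedSet : Kind → Point ℝ d → List (Point ℝ d) → Point ℝ d → Set
  UpdatedSet insertion p X x = x ≡ p ⊎ x ∈ X
  UpdatedSet deletion  p X x = x ∈ X × x ≢ p

  applyToSet-∈ : ∀ k p X x → x ∈ applyToSet ℝ d k p X ⇔ UpdatedSet k p X x
  applyToSet-∈ insertion p X x with p ∈? X
  ... | yes p∈ = mk⇔ inj₂ λ { (inj₁ refl) → p∈ ; (inj₂ h) → h }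
  ... | no  _  = mk⇔ (λ { (here h) → inj₁ h ; (there h) → inj₂ h }) [ here , there ]′
  applyToSet-∈ deletion p X x = mk⇔
    (λ h → let x∈ , n = ∈-filter⁻ (λ q → ¬? (p ≟ₑ q)) {xs = X} h in x∈ , λ { refl → n refl })
    (λ { (x∈ , n) → ∈-filter⁺ (λ q → ¬? (p ≟ₑ q)) x∈ λ { refl → n refl } })

  applyToSet-unique : ∀ k p X → Unique X → Unique (applyToSet ℝ d k p X)
  applyToSet-unique insertion p X u with p ∈? X
  ... | yes _ = u
  ... | no p∉ = All.tabulate (λ h → λ { refl → p∉ h }) ∷ u
  applyToSet-unique deletion p X u = Uniqueₚ.filter⁺ (λ q → ¬? (p ≟ₑ q)) u

  applyToSet-length : ∀ k p X → Unique X → length X ≤ suc (length (applyToSet ℝ d k p X))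
  applyToSet-length insertion p X u with p ∈? X
  ... | yes _ = n≤1+n _
  ... | no  _ = m≤n⇒m≤1+n (n≤1+n _)
  applyToSet-length deletion p X u = unique-⊆ u λ {x} h → back x h (x ≟ₑ p)
    where
    back : ∀ x → x ∈ X → Dec (x ≡ p) → x ∈ p ∷ applyToSet ℝ d deletion p X
    back x h (yes q) = here q
    back x h (no n)  = there (from (applyToSet-∈ deletion p X x) (h , n))

  UniqueState : State ℝ d → Set
  UniqueState (A , B) = Unique A × Unique B

  Inserted : State ℝ d → Update ℝ d → Elem → Set
  Inserted S (mkUpdate k s p) = Updated k (s , p) (InState S)

  apply-∈ : ∀ S u e → InState (apply ℝ d S u) e ⇔ Inserted S u e
  apply-∈ (A , B) (mkUpdate insertion inA p) (inA , x) = ⇔-trans (applyToSet-∈ insertion p A x)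
    (mk⇔ [ (λ { refl → inj₁ refl }) , inj₂ ]′ [ (λ { refl → inj₁ refl }) , inj₂ ]′)
  apply-∈ (A , B) (mkUpdate insertion inB p) (inB , x) = ⇔-trans (applyToSet-∈ insertion p B x)
    (mk⇔ [ (λ { refl → inj₁ refl }) , inj₂ ]′ [ (λ { refl → inj₁ refl }) , inj₂ ]′)
  apply-∈ (A , B) (mkUpdate insertion inA p) (inB , x) = mk⇔ inj₂ λ { (inj₂ h) → h ; (inj₁ ()) }
  apply-∈ (A , B) (mkUpdate insertion inB p) (inA , x) = mk⇔ inj₂ λ { (inj₂ h) → h ; (inj₁ ()) }
  apply-∈ (A , B) (mkUpdate deletion inA p) (inA , x) = ⇔-trans (applyToSet-∈ deletion p A x)
    (mk⇔ (λ { (h , n) → h , λ { refl → n refl } }) (λ { (h , n) → h , λ { refl → n refl } }))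
  apply-∈ (A , B) (mkUpdate deletion inB p) (inB , x) = ⇔-trans (applyToSet-∈ deletion p B x)
    (mk⇔ (λ { (h , n) → h , λ { refl → n refl } }) (λ { (h , n) → h , λ { refl → n refl } }))
  apply-∈ (A , B) (mkUpdate deletion inA p) (inB , x) = mk⇔ (λ h → h , λ ()) proj₁
  apply-∈ (A , B) (mkUpdate deletion inB p) (inA , x) = mk⇔ (λ h → h , λ ()) proj₁

  apply-unique : ∀ S u → UniqueState S → UniqueState (apply ℝ d S u)
  apply-unique (A , B) (mkUpdate k inA p) (uA , uB) = applyToSet-unique k p A uA , uB
  apply-unique (A , B) (mkUpdate k inB p) (uA , uB) = uA , applyToSet-unique k p B uB

  apply-cardinality : ∀ S u → UniqueState S → cardinality ℝ d S ≤ suc (cardinality ℝ d (apply ℝ d S u))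
  apply-cardinality (A , B) (mkUpdate k inA p) (uA , uB) = +-monoˡ-≤ (length B) (applyToSet-length k p A uA)
  apply-cardinality (A , B) (mkUpdate k inB p) (uA , uB) =
    ≤-trans (+-monoʳ-≤ (length A) (applyToSet-length k p B uB)) (≤-reflexive (+-suc (length A) _))

  elements : State ℝ d → List Elem
  elements (A , B) = List.map (inA ,_) A ++ (List.map (inB ,_) B ++ [])

  elements-∈ : ∀ S e → e ∈ elements S ⇔ InState S e
  elements-∈ (A , B) (s , x) = mk⇔
    (λ h → [ (λ h → case ∈-map⁻ (inA ,_) h of λ { (_ , x∈ , refl) → x∈ })
           , (λ h → [ (λ h → case ∈-map⁻ (inB ,_) h of λ { (_ , x∈ , refl) → x∈ }) , (λ ()) ]′
                      (∈-++⁻ (List.map (inB ,_) B) h)) ]′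
           (∈-++⁻ (List.map (inA ,_) A) h))
    (member s)
    where
    member : ∀ s → InState (A , B) (s , x) → (s , x) ∈ elements (A , B)
    member inA h = ∈-++⁺ˡ (∈-map⁺ (inA ,_) h)
    member inB h = ∈-++⁺ʳ (List.map (inA ,_) A) (∈-++⁺ˡ (∈-map⁺ (inB ,_) h))

  length-elements : ∀ S → length (elements S) ≡ cardinality ℝ d S
  length-elements (A , B) = trans (length-++ (List.map (inA ,_) A)) (cong₂ _+_ (length-map (inA ,_) A)
    (trans (length-++ (List.map (inB ,_) B)) (trans (+-identityʳ _) (length-map (inB ,_) B))))

  mkItem-run : ∀ r s p → Run (real (sideᴿ s) ∷ real r ∷ encodePoint ℝ d p ∷ []) (functions mkItemᶠ)
                             (item (initial r) (s , p)) 10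
  mkItem-run r inA p = rLet rZero (rLet (rThen refl refl ≤ᴿ-refl rVar) (rLet rCons (rLet rCons rCons)))
  mkItem-run r inB p = rLet rZero (rLet (rElse refl refl 1≰0 (rSub refl refl)) (rLet rCons (rLet rCons rCons)))

  mkItems-run : ∀ r s ps es →
    Run (real (sideᴿ s) ∷ real r ∷ encodePoints ℝ d ps ∷ items (initial r) es ∷ []) (functions mkItemsᶠ)
        (items (initial r) (List.map (s ,_) ps ++ es)) (length ps * 20 + 2)
  mkItems-run r s []       es = rCaseNil refl rVar
  mkItems-run r s (p ∷ ps) es =
    rCaseCell refl (rLet (rCall (mkItems-run r s ps es)) (rLet (rCall (mkItem-run r s p)) rCons))
    within poly 1 (λ n → con 3 :+ (n :+ con 2 :+ con 13) :≤ con 20 :+ n :+ con 2) (length ps * 20 ∷ [])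

  encodeState : Carrier → St (suc d) → Val
  encodeState r t = cell (real r) (enc {suc d} (initial r) t)

  record Holds (r : Carrier) (S : State ℝ d) (t : St (suc d)) : Set where
    field
      good    : Good {suc d} (initial r) t
      members : ∀ e → e ∈ elems t ⇔ InState S e
      distinct : UniqueState S

    count≤ : count t ≤ cardinality ℝ d S
    count≤ = ≤-trans (unique-⊆ (unique good) (λ h → from (elements-∈ S _) (to (members _) h)))
      (≤-reflexive (length-elements S))

  open Holds

  build-state : ∀ r A B → Unique A → Unique B → let n = cardinality ℝ d (A , B) in
    Σ[ t ∈ St (suc d) ] Holds r (A , B) t × pot t ≡ 0 ×
    Run (real r ∷ encodePoints ℝ d A ∷ encodePoints ℝ d B ∷ []) (DataStructure.build program)
        (encodeState r t) (suc n * (β (suc d) (2 + lg n) + 40))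
  build-state r A B uA uB =
    let S = (A , B)
        n = cardinality ℝ d S
        ℓ = 2 + lg n
        n≡ = length-elements S
        t , G , m , p , D = build-run (secondaries-run d ℓ) (initial r) (elements S)
          (≤-trans (+-mono-≤ (≤-reflexive n≡) (n≤1+n 3)) (lg-fits n (n≤1+n n)))
    in t , record { good = G ; members = λ e → ⇔-trans (m e) (elements-∈ S e) ; distinct = uA , uB } , p ,
       (rLet rNil (rLet rOne (rLet (rCall (mkItems-run r inB B [])) (rLet rZero
         (rLet (rCall (mkItems-run r inA A (List.map (inB ,_) B ++ []))) (rLet (rCall D) rCons)))))
        within cost (length (elements S)) (length A) (length B) (β (suc d) ℓ) n≡)
    where
    cost : ∀ n a b β → n ≡ a + b →
      6 + (b * 20 + 2 + (4 + (a * 20 + 2 + (2 + ((n + 1) * β + 1)))))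
      ≤ suc (a + b) * (β + 40)
    cost _ a b β refl = poly 3 (λ a b β →
      con 6 :+ (b :* con 20 :+ con 2 :+ (con 4 :+ (a :* con 20 :+ con 2 :+
        (con 2 :+ ((a :+ b :+ con 1) :* β :+ con 1)))))
      :≤ (con 1 :+ (a :+ b)) :* (β :+ con 40)) (a ∷ b ∷ β ∷ [])

  update-state : ∀ r S t k s p → Holds r S t → let S′ = apply ℝ d S (mkUpdate k s p) in
    Σ[ t′ ∈ St (suc d) ] ∃[ c ] Holds r S′ t′ ×
    c + pot t′ ≤ pot t + (u (suc d) (2 + lg (cardinality ℝ d S′)) + 40) ×
    Run (encodeState r t ∷ encodePoint ℝ d p ∷ []) (DataStructure.update program k s) (encodeState r t′) c
  update-state r S t k s p H =
    let S′ = apply ℝ d S (mkUpdate k s p)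
        m = cardinality ℝ d S′
        ℓ = 2 + lg m
        c≤ = lg-fits m (≤-trans (count≤ H) (apply-cardinality S (mkUpdate k s p) (distinct H)))
        t′ , c , G , mem , _ , amortised , D = update-run d ℓ (initial r) k (s , p) t (good H) c≤
        heights = *-monoˡ-≤ (levelCost d ℓ) (suc-height ℓ (good H) (≤-trans (+-monoʳ-≤ (count t) (n≤1+n 3)) c≤))
    in t′ , c + 20 ,
       record { good = G
              ; members = λ e → ⇔-trans (mem e) (⇔-trans (updated-cong k (members H) e) (⇔-sym (apply-∈ S (mkUpdate k s p) e)))
              ; distinct = apply-unique S (mkUpdate k s p) (distinct H) } ,
       cancel (≤-trans amortised (+-monoʳ-≤ (pot t) heights))
         (poly 4 (λ c p′ p u → c :+ con 20 :+ p′ :+ (p :+ u)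
           :≤ p :+ (u :+ con 40) :+ (c :+ p′)) (c ∷ pot t′ ∷ pot t ∷ u (suc d) ℓ ∷ [])) ,
       (rCaseCell refl (rLet (side s) (rLet (rCall (mkItem-run r s p)) (rLet (kind k) (rLet (rCall D) rCons))))
        within poly 1 (λ c → con 19 :+ (c :+ con 1) :≤ c :+ con 20) (c ∷ []))
    where
    side : ∀ s {n} {ρ : Vec Val n} → Run ρ (sideExp s) (real (sideᴿ s)) 1
    side inA = rZero
    side inB = rOne

    kind : ∀ k {n} {ρ : Vec Val n} → Run ρ (kindExp k) (kindV k) 1
    kind insertion = rZero
    kind deletion  = rNil

  updates-state : ∀ r S t us (f : ℕ → ℕ) → (∀ m → u (suc d) (2 + lg m) + 40 ≤ f m) → Holds r S t →
    Σ[ t′ ∈ St (suc d) ] ∃[ c ] Holds r (applyAll ℝ d S us) t′ ×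
    Updates ℝ d program (encodeState r t) us (encodeState r t′) c ×
    c + pot t′ ≤ pot t + sum (List.map f (cardinalities ℝ d S us))
  updates-state r S t []                    f f≥ H = t , 0 , H , [] , m≤m+n (pot t) 0
  updates-state r S t (mkUpdate k s p ∷ us) f f≥ H =
    let S′ = apply ℝ d S (mkUpdate k s p)
        t₁ , c₁ , H₁ , a₁ , run {τ} D c≤ _ = update-state r S t k s p H
        t₂ , c₂ , H₂ , Us , a₂ = updates-state r S′ t₁ us f f≥ H₁
    in t₂ , _ , H₂ , (D ∷ Us) ,
       cancel (+-mono-≤ (+-mono-≤ c≤ (≤-trans a₁ (+-monoʳ-≤ (pot t) (f≥ (cardinality ℝ d S′))))) a₂)
         (poly 8 (λ c c₁ c₂ p₀ p₁ p₂ f s → c :+ c₂ :+ p₂ :+ (c₁ :+ (p₀ :+ f) :+ (p₁ :+ s)) :≤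
             p₀ :+ (f :+ s) :+ (c :+ (c₁ :+ p₁) :+ (c₂ :+ p₂)))
           (time ℝ τ ∷ c₁ ∷ c₂ ∷ pot t ∷ pot t₁ ∷ pot t₂ ∷ f (cardinality ℝ d S′) ∷ sum (List.map f (cardinalities ℝ d S′ us)) ∷ []))

  close-initial : ∀ r p q → Close (initial r) (inA , p) (inB , q) ⇔ (dist ℝ d p q ≤ᴿ r)
  close-initial r p q = mk⇔
    (λ h → subst₂ _≤ᴿ_ shifted (ℝᶜ.+-identityˡ r) (+ᴿ-monoˡ-≤ r h))
    (λ h → subst₂ _≤ᴿ_ unshifted (ℝᶜ.-‿inverseʳ r) (+ᴿ-monoˡ-≤ (ℝᶜ.- r) h))
    where
    D = dist ℝ d p q

    shifted : 0# +ᴿ (0# -ᴿ r) +ᴿ D +ᴿ r ≡ D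
    shifted = trans (solve 3 (λ n D r → (((id ⊕ (id ⊕ n)) ⊕ D) ⊕ r) ⊜ ((r ⊕ n) ⊕ D)) refl (ℝᶜ.- r) D r)
      (trans (cong (_+ᴿ D) (ℝᶜ.-‿inverseʳ r)) (ℝᶜ.+-identityˡ D))

    unshifted : D +ᴿ (ℝᶜ.- r) ≡ 0# +ᴿ (0# -ᴿ r) +ᴿ D
    unshifted = solve 2 (λ n D → (D ⊕ n) ⊜ ((id ⊕ (id ⊕ n)) ⊕ D)) refl (ℝᶜ.- r) D

  -- Both lists are free of duplicates and have the same elements, so they agree as bags.
  join-↭ : ∀ r A B t {ps} → Holds r (A , B) t → Unique ps →
    (∀ p q → (p , q) ∈ ps ⇔ ((inA , p) ∈ elems t × (inB , q) ∈ elems t × Close (initial r) (inA , p) (inB , q))) →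
    ps ↭ similarityJoin ℝ d r A B
  join-↭ r A B t {ps} H u m = ∼bag⇒↭ (unique∧set⇒bag u
    (Uniqueₚ.filter⁺ _ (Uniqueₚ.cartesianProduct⁺ (proj₁ (distinct H)) (proj₂ (distinct H))))
    λ { {p , q} → mk⇔
      (λ h → let a , b , c = to (m p q) h in
        ∈-filter⁺ _ (∈-cartesianProduct⁺ (to (members H _) a) (to (members H _) b)) (to (close-initial r p q) c))
      (λ h → let ab , c = ∈-filter⁻ _ {xs = List.cartesianProduct A B} h
                 a , b = ∈-cartesianProduct⁻ A B ab
             in from (m p q) (from (members H _) a , from (members H _) b , from (close-initial r p q) c)) })

  enumerate-state : ∀ r A B t δ → Holds r (A , B) t →
    2 * (enumCost d (2 + lg (cardinality ℝ d (A , B))) + 40) ≤ δ →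
    ∃[ τ ] Enumerates ℝ d program (encodeState r t) τ ×
      outputs ℝ τ ↭ List.map (encodePair ℝ d) (similarityJoin ℝ d r A B) × HasDelay ℝ δ τ
  enumerate-state r A B t δ H δ≥ =
    let m = cardinality ℝ d (A , B)
        ℓ = 2 + lg m
        a = enumCost d ℓ
        ps , u , mem , _ , D = enum-run d ℓ (initial r) t (good H)
          (≤-trans (+-mono-≤ (count≤ H) (n≤1+n 3)) (lg-fits m (n≤1+n m)))
        b = flag {suc d} (initial r) t
        emits {v} {τ} E o P = eCaseCell b refl (eCall {f = enumᶠ} {is = 1F ∷ []} b (D δ (≤-trans
          (poly 1 (λ a → a :+ a :≤ con 2 :* (a :+ con 40)) (a ∷ [])) δ≥)))
    in τ , (v , E) , ↭-trans (↭-reflexive o) (↭ₚ.map⁺ (encodePair ℝ d) (join-↭ r A B t H u mem)) ,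
       paced⇒delay b {τ}
         (≤-trans (poly 1 (λ a → con 32 :≤ con 2 :* (a :+ con 40)) (a ∷ [])) δ≥)
         (≤-trans (poly 1 (λ a → con 2 :+ a :≤ con 2 :* (a :+ con 40)) (a ∷ [])) δ≥) P

  size-state : ∀ r S t → Holds r S t → let m = cardinality ℝ d S in
    size ℝ (encodeState r t) ≤ suc m * (sizeCost (suc d) (2 + lg m) + 3)
  size-state r S t H = ≤-trans (+-monoʳ-≤ 2 (≤-trans (size-run (suc d) (2 + lg m) (initial r) t (good H)
      (≤-trans (+-mono-≤ (count≤ H) (n≤1+n 3)) (lg-fits m (n≤1+n m))))
    (*-monoʳ-≤ (sizeCost (suc d) (2 + lg m)) (+-monoˡ-≤ 1 (count≤ H)))))
    (poly 2 (λ s m → con 2 :+ s :* (m :+ con 1)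
      :≤ (con 1 :+ m) :* (s :+ con 3)) (sizeCost (suc d) (2 + lg m) ∷ m ∷ []))
    where
    m = cardinality ℝ d S

  -- A common constant and exponent

  record Constant (k : ℕ) : Set where
    field
      C       : ℕ
      C-build : ∀ n → β (suc d) (2 + lg n) + 40 ≤ C * polylog k n
      C-upd   : ∀ n → u (suc d) (2 + lg n) + 40 ≤ C * polylog k n
      C-size  : ∀ n → sizeCost (suc d) (2 + lg n) + 3 ≤ C * polylog k n
      C-enum  : ∀ n → 2 * (enumCost d (2 + lg n) + 40) ≤ C * polylog k n

  -- The largest exponent is `2 * suc d`, that of updates, and `1 ≤ d` brings it below `4 * d`.
  -- Bounding the sum of all four costs yields one constant for each of them.
  constant : 1 ≤ d → Constant (4 * d)
  constant 1≤d = record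
    { C       = Order.constant total
    ; C-build = λ n → ≤-trans (m≤m+n (f₁ (lg n)) _) (bound n)
    ; C-upd   = λ n → ≤-trans (≤-trans (m≤m+n (f₂ (lg n)) _) (m≤n+m _ (f₁ (lg n)))) (bound n)
    ; C-size  = λ n → ≤-trans (≤-trans (m≤m+n (f₃ (lg n)) _) (≤-trans (m≤n+m _ (f₂ (lg n))) (m≤n+m _ (f₁ (lg n))))) (bound n)
    ; C-enum  = λ n → ≤-trans (≤-trans (m≤n+m _ (f₃ (lg n))) (≤-trans (m≤n+m _ (f₂ (lg n))) (m≤n+m _ (f₁ (lg n))))) (bound n)
    }
    where
    k = 4 * d

    f₁ f₂ f₃ f₄ : ℕ → ℕ
    f₁ ℓ = β (suc d) (2 + ℓ) + 40
    f₂ ℓ = u (suc d) (2 + ℓ) + 40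
    f₃ ℓ = sizeCost (suc d) (2 + ℓ) + 3
    f₄ ℓ = 2 * (enumCost d (2 + ℓ) + 40)

    1+d≤k : suc d ≤ k
    1+d≤k = cancel 1≤d (poly 1 (λ d → con 1 :+ d :+ d :≤ con 4 :* d :+ con 1) (d ∷ []))

    2+2d≤k : 2 * suc d ≤ k
    2+2d≤k = cancel (*-monoʳ-≤ 2 1≤d) (poly 1 (λ d → con 2 :* (con 1 :+ d) :+ con 2 :* d
      :≤ con 4 :* d :+ con 2 :* con 1) (d ∷ []))

    total : Order k (λ ℓ → f₁ ℓ + (f₂ ℓ + (f₃ ℓ + f₄ ℓ)))
    total = order-+ (order-+ (order-shift 2 (order-raise 1+d≤k (β-order (suc d)))) (order-const k 40))
      (order-+ (order-+ (order-shift 2 (order-raise 2+2d≤k (u-order (suc d)))) (order-const k 40))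
      (order-+ (order-+ (order-shift 2 (order-raise 1+d≤k (sizeCost-order (suc d)))) (order-const k 3))
        (order-* 2 (order-+ (order-shift 2 (order-raise (≤-trans (s≤s z≤n) 1+d≤k) (enumCost-order d))) (order-const k 40)))))

    bound : ∀ n → f₁ (lg n) + (f₂ (lg n) + (f₃ (lg n) + f₄ (lg n))) ≤ Order.constant total * polylog k n
    bound n = Order.bound total (lg n) (lg≥1 n)

theorem4 :
    (ℝ : CompleteOrderedField) →
    ∃[ c ] ((d : ℕ) → 1 ≤ d →
    Σ DataStructure λ 𝒟 → ∃[ C ] (
      let k = c * d in
      (r : CompleteOrderedField.Carrier ℝ) →
      CompleteOrderedField._<_ ℝ (CompleteOrderedField.0# ℝ) r →
      (A B : List (Point ℝ d)) → Unique A → Unique B →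
      let n = cardinality ℝ d (A , B) in
      ∃[ D₀ ] ∃[ τ₀ ] (
        Builds ℝ d 𝒟 r (A , B) D₀ τ₀ ×
        time ℝ τ₀ ≤ C * (suc n * polylog k n) ×
        ((us : List (Update ℝ d)) →
          let S = applyAll ℝ d (A , B) us
              m = cardinality ℝ d S in
          ∃[ D ] ∃[ t ] (
            Updates ℝ d 𝒟 D₀ us D t ×
            t ≤ sum (map (λ i → C * polylog k i) (cardinalities ℝ d (A , B) us)) ×
            size ℝ D ≤ C * (suc m * polylog k m) ×
            ∃[ τ ] (
              Enumerates ℝ d 𝒟 D τ ×
              outputs ℝ τ ↭ map (encodePair ℝ d) (uncurry (similarityJoin ℝ d r) S) ×
              HasDelay ℝ (C * polylog k m) τ))))))
theorem4 ℝ = 4 , λ d 1≤d → let open Constant (constant ℝ d 1≤d) in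
  program , C , λ r _ A B uA uB →
  let k = 4 * d
      t₀ , H₀ , p₀ , run {τ₀} D₀ τ₀≤ _ = build-state ℝ d r A B uA uB
  in encodeState ℝ d r t₀ , τ₀ , D₀ ,
     ≤-trans τ₀≤ (scale C (cardinality ℝ d (A , B)) k (C-build (cardinality ℝ d (A , B)))) , λ us →
  let S = applyAll ℝ d (A , B) us
      m = cardinality ℝ d S
      t , c , H , Us , c≤ = updates-state ℝ d r (A , B) t₀ us (λ i → C * polylog k i) C-upd H₀
      τ , E , τ↭ , delay = enumerate-state ℝ d r (proj₁ S) (proj₂ S) t (C * polylog k m) H (C-enum m)
  in encodeState ℝ d r t , c , Us ,
     -- The final potential is dropped and the initial one is 0, so amortised time bounds the total
     -- time.
     ≤-trans (m≤m+n c _) (≤-trans c≤ (+-monoˡ-≤ _ (≤-reflexive p₀))) ,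
     ≤-trans (size-state ℝ d r S t H) (scale C m k (C-size m)) ,
     τ , E , τ↭ , delay
  where
  scale : ∀ C n k {x} → x ≤ C * polylog k n → suc n * x ≤ C * (suc n * polylog k n)
  scale C n k h = ≤-trans (*-monoʳ-≤ (suc n) h) (≤-reflexive (regroup (suc n) C (polylog k n)))
    where
    regroup : ∀ n C x → n * (C * x) ≡ C * (n * x)
    regroup = Ring.solve-∀
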